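{- There exist infinitely many (pairwise non-isomorphic) $6$-connected $1$-plane graphs that have no $3$-connected spanning plane subgraphs.
   Context: All graphs are finite, simple and undirected. A (plane) drawing of a graph represents the vertices by distinct points of the plane and the edges by non-self-intersecting arcs joining the points of their end vertices and containing no vertex point in their interior. A $1$-plane graph is a graph given together with a plane drawing in which each edge is crossed at most once by another edge, i.e. each edge has at most one crossing point; crossings of adjacent edges are forbidden. A spanning plane subgraph of a $1$-plane graph $G$ is a subgraph $F$ with $V(F)=V(G)$ that is a plane graph with respect to the given drawing of $G$, i.e. no two edges of $F$ cross in that drawing. The connectivity is $\kappa(G)=\min\{p(u,v) : u,v\in V(G), u\neq v\}$, where $p(u,v)$ is the maximum number of pairwise internally vertex-disjoint $uv$-paths; $G$ is $k$-connected if $\kappa(G)\ge k$. -}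

module Defs where

open import Data.Fin.Base using (Fin; _<_)
open import Data.List.Base using (List; []; _∷_; _++_; [_])
open import Data.List.Membership.Propositional using () renaming (_∈_ to _∈ₗ_)
open import Data.List.Relation.Binary.Disjoint.Propositional using (Disjoint)
open import Data.List.Relation.Unary.Any using (Any)
open import Data.List.Relation.Unary.Linked using (Linked)
open import Data.List.Relation.Unary.Unique.Propositional using (Unique)
open import Data.Nat.Base as ℕ using (ℕ)
open import Data.Product.Base using (_×_; _,_; proj₁; proj₂; ∃; ∃-syntax; Σ-syntax)
open import Data.Rational.Base using (ℚ; 0ℚ; 1ℚ; _+_; _-_; _*_; _≤_)
open import Data.Unit.Base using (⊤)
open import Function.Bundles using (_↔_; _⇔_; Inverse)
open import Function.Definitions using (Injective)
open import Level using (0ℓ)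
open import Relation.Binary.Core using (Rel)
open import Relation.Binary.Definitions using (Decidable; Irreflexive; Symmetric)
open import Relation.Binary.PropositionalEquality.Core using (_≡_; _≢_)
open import Relation.Nullary.Negation.Core using (¬_)

record Graph (n : ℕ) : Set₁ where
  field
    Adj    : Rel (Fin n) 0ℓ
    sym    : Symmetric Adj
    irrefl : Irreflexive _≡_ Adj
    adj?   : Decidable Adj

_≅_ : ∀ {m n} → Graph m → Graph n → Set
_≅_ {m} {n} G H =
  Σ[ φ ∈ Fin m ↔ Fin n ]
    (∀ u v → Graph.Adj G u v ⇔ Graph.Adj H (Inverse.to φ u) (Inverse.to φ v))

-- An undirected edge {u , v} is stored once, with its ends in increasing
-- order.  The proofs are irrelevant, so that edges with the same ends are
-- equal.
record Edge {n} (G : Graph n) : Set where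
  constructor edge
  field
    src tgt    : Fin n
    .src<tgt   : src < tgt
    .adjacent  : Graph.Adj G src tgt

module _ {n} (G : Graph n) where

  open Graph G

  record Path (u v : Fin n) : Set where
    field
      inner : List (Fin n)

    vertices : List (Fin n)
    vertices = u ∷ inner ++ [ v ]

    field
      walk     : Linked Adj vertices
      distinct : Unique vertices

  open Path

  -- p(u,v) ≥ k.  The second clause matters only for the path consisting of
  -- the edge uv alone: it has no inner vertices, so it is disjoint from
  -- itself, yet it may be used only once.
  DisjointPaths : Fin n → Fin n → ℕ → Set
  DisjointPaths u v k =
    Σ[ P ∈ (Fin k → Path u v) ]
      (∀ i j → i ≢ j →
        Disjoint (inner (P i)) (inner (P j)) × inner (P i) ≢ inner (P j))

  -- κ(G) ≥ k, where κ(G) is the minimum of p(u,v) over u ≢ v.  The minimum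
  -- is over a nonempty set only if there are at least two vertices.
  Connected : ℕ → Set
  Connected k = 2 ℕ.≤ n × (∀ u v → u ≢ v → DisjointPaths u v k)

-- Arcs are polygonal with rational vertices.  A nonempty intersection of two
-- rational segments contains a rational point, and is a single point in the
-- real plane if it is one over ℚ; so simplicity and the crossings below are
-- those of the corresponding arcs in the real plane.
Point : Set
Point = ℚ × ℚ

Segment : Set
Segment = Point × Point

_∈ˢ_ : Point → Segment → Set
(x₁ , x₂) ∈ˢ ((p₁ , p₂) , (q₁ , q₂)) =
  ∃[ t ] 0ℚ ≤ t × t ≤ 1ℚ
       × x₁ ≡ p₁ + t * (q₁ - p₁)
       × x₂ ≡ p₂ + t * (q₂ - p₂)

direction : Segment → Point
direction ((p₁ , p₂) , (q₁ , q₂)) = (q₁ - p₁) , (q₂ - p₂)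

NonParallel : Segment → Segment → Set
NonParallel s t =
  proj₁ (direction s) * proj₂ (direction t)
    ≢ proj₂ (direction s) * proj₁ (direction t)

_∈°_ : Point → Segment → Set
x ∈° s = x ∈ˢ s × x ≢ proj₁ s × x ≢ proj₂ s

segments : List Point → List Segment
segments (p ∷ q ∷ ps) = (p , q) ∷ segments (q ∷ ps)
segments _            = []

_OnPolyline_ : Point → List Point → Set
x OnPolyline ps = Any (x ∈ˢ_) (segments ps)

-- The polyline does not meet itself: each segment is nondegenerate and
-- meets the rest of the polyline only in the point where the rest begins.
SimplePolyline : List Point → Set
SimplePolyline (p ∷ q ∷ ps) =
    p ≢ q
  × (∀ x → x ∈ˢ (p , q) → x OnPolyline (q ∷ ps) → x ≡ q)
  × SimplePolyline (q ∷ ps)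
SimplePolyline _ = ⊤

record Drawing {n} (G : Graph n) : Set where
  field
    pos           : Fin n → Point
    pos-injective : Injective _≡_ _≡_ pos
    bends         : Edge G → List Point

  arc : Edge G → List Point
  arc e = pos (Edge.src e) ∷ bends e ++ [ pos (Edge.tgt e) ]

  _InteriorTo_ : Point → Edge G → Set
  x InteriorTo e =
    x OnPolyline arc e × x ≢ pos (Edge.src e) × x ≢ pos (Edge.tgt e)

  CrossAt : Edge G → Edge G → Point → Set
  CrossAt e f x = e ≢ f × x InteriorTo e × x InteriorTo f

  Cross : Edge G → Edge G → Set
  Cross e f = ∃ (CrossAt e f)

  -- `transversal` excludes arcs that merely touch or that overlap, so every
  -- common interior point of two edges is a genuine crossing.  It also puts
  -- crossings away from the bends, as in general position.
  field
    simple      : ∀ e → SimplePolyline (arc e)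
    avoids      : ∀ e w → ¬ (pos w InteriorTo e)
    transversal : ∀ e f x → CrossAt e f x →
      ∃[ s ] ∃[ t ] s ∈ₗ segments (arc e) × t ∈ₗ segments (arc f)
                  × x ∈° s × x ∈° t × NonParallel s t

record IsOnePlane {n} {G : Graph n} (D : Drawing G) : Set where
  open Drawing D
  open Edge
  field
    crossed-at-most-once : ∀ e f g x y → CrossAt e f x → CrossAt e g y →
      f ≡ g × x ≡ y
    no-adjacent-crossing : ∀ e f → Cross e f →
      src e ≢ src f × src e ≢ tgt f × tgt e ≢ src f × tgt e ≢ tgt f

record OnePlaneGraph : Set₁ where
  field
    order      : ℕ
    graph      : Graph order
    drawing    : Drawing graph
    isOnePlane : IsOnePlane drawing

record IsSpanningPlaneSubgraph (G : OnePlaneGraph)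
    (F : Graph (OnePlaneGraph.order G)) : Set where
  open OnePlaneGraph G
  open Edge
  field
    subgraph : ∀ {u v} → Graph.Adj F u v → Graph.Adj graph u v
    plane    : ∀ (e f : Edge graph) →
      Graph.Adj F (src e) (tgt e) → Graph.Adj F (src f) (tgt f) →
      ¬ Drawing.Cross drawing e f

{-# OPTIONS --safe #-}

module Submission where

-- The graphs are rings of four blobs.  A blob is a centre surrounded by nested
-- hexagons, consecutive hexagons being joined by spikes and by the two diagonals
-- of each quadrangle; the outermost hexagon provides six exits, and consecutive
-- blobs are joined by three disjoint edges.  Two of the three cross each other.
-- The third edge at blobs 0, 1 crosses the third edge at blobs 1, 2, and the
-- third edge at blobs 2, 3 crosses the third edge at blobs 3, 0.  A plane
-- subgraph F therefore has at most one edge between 0, 1 or at most one edge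
-- between 1, 2, and likewise at blob 3; these two edges separate blob 0 from
-- blob 2, so F is not 3-connected.
--
-- For 6-connectedness it suffices, by Menger's theorem, that fewer than six
-- vertices do not separate.  Any vertices u and w in consecutive blobs are joined
-- by six disjoint walks, one through each exit of the blob of u, and one of them
-- survives.
--
-- All edges are straight.  Two edges that should not cross are separated by a
-- line; up to the scale of the hexagons there are finitely many cases.

open import Defs
open import Data.Nat.Base using (ℕ)
open import Data.Product.Base using (_×_; Σ-syntax; ∃-syntax)
open import Relation.Binary.PropositionalEquality.Core using (_≢_)
open import Relation.Nullary.Negation.Core using (¬_)

-- The six walks are never shown to be disjoint directly. The vertices are coloured so that, apart
-- from its two ends, the walk through exit `i` uses only colour `i`; a set of fewer than six
-- vertices misses some colour, and that walk survives. Of the six walks from a blob to its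
-- successor, three use the links between the two, and the other three run backwards around the
-- ring. So every blob must also let three disjoint lanes pass from one neighbour to the other.
-- Exits 1 and 4 of the left and right blobs are opposite corners whose lane cannot stay on the
-- outermost hexagon, and fans from outermost nodes need a second hexagon too. This is why there are
-- at least two hexagons; beyond that their number is free and yields the infinite family. In the
-- drawing, vertices count as degenerate segments. A single comparison of half-open cells and links
-- then gives distinct positions, edges that avoid vertices, and the full list of crossings.
-- Separating lines are given by linear functionals evaluated at the hubs and spikes, so finite
-- tables settle every height and every scale.

-- Menger's theorem for two vertex sets of a digraph.

module Menger where

  open import Data.Fin.Base using (Fin; zero; suc; inject≤)
  open import Data.Fin.Properties using (_≟_; any?; all?; inject≤-injective; suc-injective)
  open import Data.Fin.Subset using (Subset; _∈_; _∉_; ∣_∣; _∪_; _∩_; ∁; _-_; ⁅_⁆; inside;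
    outside)
  open import Data.Fin.Subset.Properties using (_∈?_; anySubset?; x∈p∧x≢y⇒x∈p-y;
    x∈p⇒∣p-x∣<∣p∣; ∪-identityʳ; x∈p∪q⁺; x∈p∪q⁻; x∈p∩q⁺; x∈p∩q⁻; x∈⁅x⁆; x∈⁅y⁆⇒x≡y; x∉p⇒x∈∁p;
    x∈∁p⇒x∉p)
  open import Data.List.Base using (List; []; _∷_; _++_; [_])
  open import Data.List.Membership.Propositional using () renaming (_∈_ to _∈ₗ_)
  open import Data.List.Membership.Propositional.Properties using (∈-++⁻)
  open import Data.List.Relation.Binary.Disjoint.Propositional using (Disjoint)
  import Data.List.Relation.Unary.All as All
  import Data.List.Relation.Unary.All.Properties as All
  import Data.List.Relation.Unary.AllPairs as AllPairs
  open import Data.List.Relation.Unary.All using (All; []; _∷_)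
  open import Data.List.Relation.Unary.AllPairs using ([]; _∷_)
  open import Data.List.Relation.Unary.Any using (here; there)
  open import Data.List.Relation.Unary.Unique.Propositional using (Unique)
  import Data.List.Relation.Unary.Unique.Propositional.Properties as Unique
  open import Data.Nat.Base using (ℕ; zero; suc; _≤_; _<_; z≤n; s≤s)
  open import Data.Nat.Properties using (≤-<-trans; ≤-trans; <-≤-trans; <-irrefl; _<?_; ≮⇒≥;
    ≤-reflexive)
  open import Data.Product.Base using (_×_; _,_; proj₁; proj₂; Σ-syntax; ∃-syntax)
  open import Data.Sum.Base using (_⊎_; inj₁; inj₂; [_,_]′)
  open import Data.Empty using (⊥)
  open import Data.Vec.Base using ([]; _∷_; here; there)
  open import Function.Base using (_∘_; id)
  open import Function.Definitions using (Injective)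
  open import Relation.Binary.PropositionalEquality.Core using (_≡_; _≢_; refl; sym; trans;
    cong; cong₂; subst)
  open import Relation.Nullary.Decidable using (Dec; yes; no; _×-dec_; _⊎-dec_; _→-dec_; ¬?)
  open import Relation.Nullary.Negation using (¬_; contradiction)

  injective⇒≤∣∣ : ∀ {n k} {f : Fin k → Fin n} (P : Subset n) →
    Injective _≡_ _≡_ f → (∀ i → f i ∈ P) → k ≤ ∣ P ∣
  injective⇒≤∣∣ {k = zero}          P inj f∈P = z≤n
  injective⇒≤∣∣ {k = suc k} {f = f} P inj f∈P =
    ≤-<-trans
      (injective⇒≤∣∣ (P - f zero) (suc-injective ∘ inj)
        (λ i → x∈p∧x≢y⇒x∈p-y (f∈P (suc i)) (λ eq → contradiction (inj eq) λ ())))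
      (x∈p⇒∣p-x∣<∣p∣ (f∈P zero))

  -- If `p` were missed, `P - p` would still hold `k` distinct values, too many for its size. For
  -- linkages this says that a set with at most `k` elements is used up by the ends of `k` disjoint
  -- walks.
  injective⇒covers : ∀ {n k} {f : Fin k → Fin n} {P : Subset n} →
    Injective _≡_ _≡_ f → (∀ i → f i ∈ P) → ∣ P ∣ ≤ k →
    ∀ {p} → p ∈ P → ∃[ i ] f i ≡ p
  injective⇒covers {f = f} {P} inj f∈P ∣P∣≤k {p} p∈P with any? (λ i → f i ≟ p)
  ... | yes found = found
  ... | no ¬found = contradiction
    (<-≤-trans
      (≤-<-trans
        (injective⇒≤∣∣ (P - p) inj (λ i → x∈p∧x≢y⇒x∈p-y (f∈P i) (¬found ∘ (i ,_))))
        (x∈p⇒∣p-x∣<∣p∣ p∈P))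
      ∣P∣≤k)
    (<-irrefl refl)

  elements : ∀ {n} (P : Subset n) →
    Σ[ f ∈ (Fin ∣ P ∣ → Fin n) ] Injective _≡_ _≡_ f × (∀ i → f i ∈ P)
  elements [] = (λ ()) , (λ { {()} }) , λ ()
  elements (outside ∷ P) =
    let f , inj , f∈P = elements P in suc ∘ f , inj ∘ suc-injective , λ i → there (f∈P i)
  elements {suc n} (inside ∷ P) = g , g-inj , g∈
    where
    f = proj₁ (elements P)
    g : Fin (suc ∣ P ∣) → Fin (suc n)
    g zero    = zero
    g (suc i) = suc (f i)
    g-inj : Injective _≡_ _≡_ g
    g-inj {zero}  {zero}  eq = refl
    g-inj {suc i} {suc j} eq = cong suc (proj₁ (proj₂ (elements P)) (suc-injective eq))
    g∈ : ∀ i → g i ∈ inside ∷ P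
    g∈ zero    = here
    g∈ (suc i) = there (proj₂ (proj₂ (elements P)) i)

  ∣p∪⁅x⁆∣≤1+∣p∣ : ∀ {n} (p : Subset n) x → ∣ p ∪ ⁅ x ⁆ ∣ ≤ suc ∣ p ∣
  ∣p∪⁅x⁆∣≤1+∣p∣ (outside ∷ p) zero    = ≤-reflexive (cong (suc ∘ ∣_∣) (∪-identityʳ p))
  ∣p∪⁅x⁆∣≤1+∣p∣ (inside  ∷ p) zero    =
    ≤-trans (≤-reflexive (cong (suc ∘ ∣_∣) (∪-identityʳ p))) (Data.Nat.Properties.n≤1+n _)
  ∣p∪⁅x⁆∣≤1+∣p∣ (outside ∷ p) (suc x) = ∣p∪⁅x⁆∣≤1+∣p∣ p x
  ∣p∪⁅x⁆∣≤1+∣p∣ (inside  ∷ p) (suc x) = s≤s (∣p∪⁅x⁆∣≤1+∣p∣ p x)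

  Arcs : ℕ → Set
  Arcs n = List (Fin n × Fin n)

  data Walk {n} (E : Arcs n) : Fin n → Fin n → Set where
    stop : ∀ {v} → Walk E v v
    step : ∀ {u w v} → (u , w) ∈ₗ E → Walk E w v → Walk E u v

  tail : ∀ {n} {E : Arcs n} {u v} → Walk E u v → List (Fin n)
  tail stop               = []
  tail (step {w = w} _ p) = w ∷ tail p

  verts : ∀ {n} {E : Arcs n} {u v} → Walk E u v → List (Fin n)
  verts {u = u} p = u ∷ tail p

  module _ {n} {E : Arcs n} where

    _++ʷ_ : ∀ {u v w} → Walk E u v → Walk E v w → Walk E u w
    stop     ++ʷ q = q
    step e p ++ʷ q = step e (p ++ʷ q)

    verts-++ʷ : ∀ {u v w} (p : Walk E u v) (q : Walk E v w) →
      verts (p ++ʷ q) ≡ verts p ++ tail q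
    verts-++ʷ stop       q = refl
    verts-++ʷ {u} (step _ p) q = cong (u ∷_) (verts-++ʷ p q)

    end∈verts : ∀ {u v} (p : Walk E u v) → v ∈ₗ verts p
    end∈verts stop       = here refl
    end∈verts (step _ p) = there (end∈verts p)

    weakenʷ : ∀ {e u v} → Walk E u v → Walk (e ∷ E) u v
    weakenʷ stop       = stop
    weakenʷ (step e p) = step (there e) (weakenʷ p)

    tail-weakenʷ : ∀ {e u v} (p : Walk E u v) → tail (weakenʷ {e} p) ≡ tail p
    tail-weakenʷ stop       = refl
    tail-weakenʷ (step _ p) = cong (_ ∷_) (tail-weakenʷ p)

  -- Trivial walks are allowed and the ends count for disjointness, so `A` and `B` may overlap. This
  -- version for sets suits an induction on the arcs, in which `A` and `B` are replaced by
  -- separators.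
  record Linkage {n} (E : Arcs n) (A B : Subset n) (k : ℕ) : Set where
    field
      {start end} : Fin k → Fin n
      walk        : ∀ i → Walk E (start i) (end i)
      start∈      : ∀ i → start i ∈ A
      end∈        : ∀ i → end i ∈ B
      unique      : ∀ i → Unique (verts (walk i))
      disjoint    : ∀ {i j} → i ≢ j → Disjoint (verts (walk i)) (verts (walk j))

    start-injective : Injective _≡_ _≡_ start
    start-injective {i} {j} eq with i ≟ j
    ... | yes i≡j = i≡j
    ... | no  i≢j = contradiction (here refl , here eq) (disjoint i≢j)

    end-injective : Injective _≡_ _≡_ end
    end-injective {i} {j} eq with i ≟ j
    ... | yes i≡j = i≡j
    ... | no  i≢j = contradiction
      (end∈verts (walk i) , subst (_∈ₗ verts (walk j)) (sym eq) (end∈verts (walk j)))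
      (disjoint i≢j)

    meets-start : ∣ A ∣ ≤ k → ∀ i {z} → z ∈ₗ verts (walk i) → z ∈ A → z ≡ start i
    meets-start ∣A∣≤k i z∈walk z∈A with injective⇒covers start-injective start∈ ∣A∣≤k z∈A
    ... | j , refl with i ≟ j
    ...   | yes refl = refl
    ...   | no  i≢j  = contradiction (z∈walk , here refl) (disjoint i≢j)

    meets-end : ∣ B ∣ ≤ k → ∀ i {z} → z ∈ₗ verts (walk i) → z ∈ B → z ≡ end i
    meets-end ∣B∣≤k i z∈walk z∈B with injective⇒covers end-injective end∈ ∣B∣≤k z∈B
    ... | j , refl with i ≟ j
    ...   | yes refl = refl
    ...   | no  i≢j  = contradiction (z∈walk , end∈verts (walk j)) (disjoint i≢j)

  -- S meets every A–B walk; L contains whatever can be reached from A without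
  -- meeting S.
  record Separates {n} (E : Arcs n) (A B S L : Subset n) : Set where
    constructor separates
    field
      sources : ∀ v → v ∈ A → v ∈ S ⊎ v ∈ L
      closed  : All (λ e → proj₁ e ∈ L → proj₂ e ∈ S ⊎ proj₂ e ∈ L) E
      sinks   : ∀ v → v ∈ B → v ∉ L

  separates? : ∀ {n} (E : Arcs n) A B S L → Dec (Separates E A B S L)
  separates? E A B S L = Relation.Nullary.Decidable.map′
    (λ (a , c , b) → separates a c b) (λ (separates a c b) → a , c , b)
    (all? (λ v → v ∈? A →-dec (v ∈? S ⊎-dec v ∈? L))
      ×-dec All.all? (λ (v , w) → v ∈? L →-dec (w ∈? S ⊎-dec w ∈? L)) E
      ×-dec all? (λ v → v ∈? B →-dec ¬? (v ∈? L)))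

  module _ {n} {E : Arcs n} {S L : Subset n}
    (closed : All (λ e → proj₁ e ∈ L → proj₂ e ∈ S ⊎ proj₂ e ∈ L) E) where

    -- A simple walk that has reached `S` must stop, since its last vertex is the only one allowed
    -- in `S`; until then `closed` keeps it in `L`.
    walk-stays : ∀ {u v} (p : Walk E u v) → Unique (verts p) →
      (∀ {z} → z ∈ₗ verts p → z ∈ S → z ≡ v) → u ∈ S ⊎ u ∈ L →
      ∀ {z} → z ∈ₗ verts p → z ∈ S ⊎ z ∈ L
    walk-stays p _ _ u∈ (here refl) = u∈
    walk-stays (step e p) (u∉p ∷ uniq) meets (inj₁ u∈S) (there z∈p) =
      contradiction (meets (here refl) u∈S) (All.lookup u∉p (end∈verts p))
    walk-stays (step e p) (u∉p ∷ uniq) meets (inj₂ u∈L) (there z∈p) =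
      walk-stays p uniq (meets ∘ there) (All.lookup closed e u∈L) z∈p

    -- Backwards from the end: a vertex in `L` would force its successor into `S` or `L`, and only
    -- the first vertex may lie in `S`.
    walk-avoids : ∀ {u v} (p : Walk E u v) → (∀ {z} → z ∈ₗ tail p → z ∉ S) →
      v ∉ L → ∀ {z} → z ∈ₗ verts p → z ∉ L
    walk-avoids stop       _   v∉L (here refl) = v∉L
    walk-avoids (step e p) out v∉L (there z∈p) = walk-avoids p (out ∘ there) v∉L z∈p
    walk-avoids (step e p) out v∉L (here refl) u∈L with All.lookup closed e u∈L
    ... | inj₁ w∈S = out (here refl) w∈S
    ... | inj₂ w∈L = walk-avoids p (out ∘ there) v∉L (here refl) w∈L

  weakenˡ : ∀ {n} {E : Arcs n} {e A B k} → Linkage E A B k → Linkage (e ∷ E) A B k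
  weakenˡ {e = e} ℓ = record
    { walk     = λ i → weakenʷ (walk i)
    ; start∈   = start∈
    ; end∈     = end∈
    ; unique   = λ i → subst (λ t → Unique (start i ∷ t)) (sym (tail-weakenʷ (walk i))) (unique i)
    ; disjoint = λ {i} {j} i≢j (z∈i , z∈j) →
        disjoint i≢j (back i z∈i , back j z∈j)
    }
    where
    open Linkage ℓ
    back : ∀ i {z} → z ∈ₗ verts (weakenʷ {e = e} (walk i)) → z ∈ₗ verts (walk i)
    back i {z} = subst (λ t → z ∈ₗ start i ∷ t) (tail-weakenʷ (walk i))

  -- Göring's proof.  If deleting the arc (x , y) creates a separator S that is
  -- too small, then S ∪ {x} and S ∪ {y} have exactly k elements; linkages from A
  -- to S ∪ {x} and from S ∪ {y} to B meet only in S and can be glued.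
  module _ {n} {E : Arcs n} {x y : Fin n} {A B : Subset n} {k : ℕ}
    (robust : ∀ S L → Separates ((x , y) ∷ E) A B S L → k ≤ ∣ S ∣)
    {S L : Subset n} (sep : Separates E A B S L) (S<k : ∣ S ∣ < k) where

    open Separates sep

    P Q : Subset n
    P = S ∪ ⁅ x ⁆
    Q = S ∪ ⁅ y ⁆

    S⊆P : ∀ {v} → v ∈ S → v ∈ P
    S⊆P = x∈p∪q⁺ ∘ inj₁

    S⊆Q : ∀ {v} → v ∈ S → v ∈ Q
    S⊆Q = x∈p∪q⁺ ∘ inj₁

    x∈P : x ∈ P
    x∈P = x∈p∪q⁺ (inj₂ (x∈⁅x⁆ x))

    y∈Q : y ∈ Q
    y∈Q = x∈p∪q⁺ (inj₂ (x∈⁅x⁆ y))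

    ∈P⁻ : ∀ {v} → v ∈ P → v ∈ S ⊎ v ≡ x
    ∈P⁻ v∈P = Data.Sum.Base.map id (x∈⁅y⁆⇒x≡y x) (x∈p∪q⁻ S ⁅ x ⁆ v∈P)

    -- If the arc respected `closed`, then `S` and `L` would separate with the arc present, against
    -- `robust`. Hence the arc leads from `L` to a vertex outside both `S` and `L`.
    too-small : ¬ (x ∈ L → y ∈ S ⊎ y ∈ L)
    too-small arc = <-irrefl refl
      (<-≤-trans S<k (robust S L (separates sources (arc ∷ closed) sinks)))

    x∈L : x ∈ L
    x∈L with x ∈? L
    ... | yes x∈L = x∈L
    ... | no  x∉L = contradiction (λ x∈L → contradiction x∈L x∉L) too-small

    y∉S : y ∉ S
    y∉S y∈S = too-small (λ _ → inj₁ y∈S)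

    P≤k : ∣ P ∣ ≤ k
    P≤k = ≤-trans (∣p∪⁅x⁆∣≤1+∣p∣ S x) S<k

    Q≤k : ∣ Q ∣ ≤ k
    Q≤k = ≤-trans (∣p∪⁅x⁆∣≤1+∣p∣ S y) S<k

    -- The reachable part is `K ∩ L`. A walk leaves `L` only through `S` or along the arc from `x`,
    -- hence through `P`, and `K` contains no vertex of `P`.
    robust-P : ∀ T K → Separates E A P T K → k ≤ ∣ T ∣
    robust-P T K (separates src cls snk) = robust T (K ∩ L) (separates src′ (arc ∷ cls′) snk′)
      where
      src′ : ∀ v → v ∈ A → v ∈ T ⊎ v ∈ K ∩ L
      src′ v v∈A with src v v∈A | sources v v∈A
      ... | inj₁ v∈T | _        = inj₁ v∈T
      ... | inj₂ v∈K | inj₁ v∈S = contradiction v∈K (snk v (S⊆P v∈S))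
      ... | inj₂ v∈K | inj₂ v∈L = inj₂ (x∈p∩q⁺ (v∈K , v∈L))
      arc : x ∈ K ∩ L → y ∈ T ⊎ y ∈ K ∩ L
      arc x∈ = contradiction (proj₁ (x∈p∩q⁻ K L x∈)) (snk x x∈P)
      cls′ : All (λ e → proj₁ e ∈ K ∩ L → proj₂ e ∈ T ⊎ proj₂ e ∈ K ∩ L) E
      cls′ = All.tabulate λ {(v , w)} e v∈ → go e (x∈p∩q⁻ K L v∈)
        where
        go : ∀ {v w} → (v , w) ∈ₗ E → v ∈ K × v ∈ L → w ∈ T ⊎ w ∈ K ∩ L
        go {w = w} e (v∈K , v∈L) with All.lookup cls e v∈K | All.lookup closed e v∈L
        ... | inj₁ w∈T | _        = inj₁ w∈T
        ... | inj₂ w∈K | inj₁ w∈S = contradiction w∈K (snk w (S⊆P w∈S))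
        ... | inj₂ w∈K | inj₂ w∈L = inj₂ (x∈p∩q⁺ (w∈K , w∈L))
      snk′ : ∀ v → v ∈ B → v ∉ K ∩ L
      snk′ v v∈B v∈ = sinks v v∈B (proj₂ (x∈p∩q⁻ K L v∈))

    -- The reachable part is `K ∪ L`. Leaving `L` leads into `S` or to `y`, hence into `Q`, and from
    -- `Q` onwards everything lies in `T` or `K`.
    robust-Q : ∀ T K → Separates E Q B T K → k ≤ ∣ T ∣
    robust-Q T K (separates src cls snk) = robust T (K ∪ L) (separates src′ (arc ∷ cls′) snk′)
      where
      grow : ∀ {v} → v ∈ T ⊎ v ∈ K → v ∈ T ⊎ v ∈ K ∪ L
      grow = Data.Sum.Base.map id (x∈p∪q⁺ ∘ inj₁)
      via-S : ∀ {v} → v ∈ S ⊎ v ∈ L → v ∈ T ⊎ v ∈ K ∪ L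
      via-S (inj₁ v∈S) = grow (src _ (S⊆Q v∈S))
      via-S (inj₂ v∈L) = inj₂ (x∈p∪q⁺ (inj₂ v∈L))
      src′ : ∀ v → v ∈ A → v ∈ T ⊎ v ∈ K ∪ L
      src′ v v∈A = via-S (sources v v∈A)
      arc : x ∈ K ∪ L → y ∈ T ⊎ y ∈ K ∪ L
      arc _ = grow (src y y∈Q)
      cls′ : All (λ e → proj₁ e ∈ K ∪ L → proj₂ e ∈ T ⊎ proj₂ e ∈ K ∪ L) E
      cls′ = All.tabulate λ e v∈ →
        [ grow ∘ All.lookup cls e , via-S ∘ All.lookup closed e ]′ (x∈p∪q⁻ K L v∈)
      snk′ : ∀ v → v ∈ B → v ∉ K ∪ L
      snk′ v v∈B v∈ = [ snk v v∈B , sinks v v∈B ]′ (x∈p∪q⁻ K L v∈)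

    module _ (α : Linkage E A P k) (β : Linkage E Q B k) where

      private
        module α = Linkage α
        module β = Linkage β

      α-stays : ∀ i {z} → z ∈ₗ verts (α.walk i) → z ∈ S ⊎ z ∈ L
      α-stays i = walk-stays closed (α.walk i) (α.unique i)
        (λ z∈ z∈S → α.meets-end P≤k i z∈ (S⊆P z∈S)) (sources _ (α.start∈ i))

      β-avoids : ∀ j {z} → z ∈ₗ verts (β.walk j) → z ∉ L
      β-avoids j = walk-avoids closed (β.walk j) out (sinks _ (β.end∈ j))
        where
        out : ∀ {z} → z ∈ₗ tail (β.walk j) → z ∉ S
        out z∈ z∈S = contradiction (sym (β.meets-start Q≤k j (there z∈) (S⊆Q z∈S)))
          (All.lookup (AllPairs.head (β.unique j)) z∈)

      -- The walks of `α` stay in `S` and `L`, and those of `β` avoid `L`, so they can share only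
      -- vertices of `S`. These lie in `P`, where walks of `α` end, and in `Q`, where walks of `β`
      -- start.
      meet : ∀ i j {z} → z ∈ₗ verts (α.walk i) → z ∈ₗ verts (β.walk j) →
        z ∈ S × z ≡ α.end i × z ≡ β.start j
      meet i j z∈α z∈β with α-stays i z∈α
      ... | inj₁ z∈S = z∈S , α.meets-end P≤k i z∈α (S⊆P z∈S) , β.meets-start Q≤k j z∈β (S⊆Q z∈S)
      ... | inj₂ z∈L = contradiction z∈L (β-avoids j z∈β)

      Joins : Fin k → Fin k → Set
      Joins i j = (α.end i ≡ x × β.start j ≡ y) ⊎ (α.end i ≡ β.start j × α.end i ∈ S)

      partner : ∀ i → ∃[ j ] Joins i j
      partner i with ∈P⁻ (α.end∈ i)
      ... | inj₁ p∈S =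
        let j , eq = injective⇒covers β.start-injective β.start∈ Q≤k (S⊆Q p∈S)
        in  j , inj₂ (sym eq , p∈S)
      ... | inj₂ p≡x =
        let j , eq = injective⇒covers β.start-injective β.start∈ Q≤k y∈Q
        in  j , inj₁ (p≡x , eq)

      Glued : Fin k → Fin k → Set
      Glued i j = Σ[ p ∈ Walk ((x , y) ∷ E) (α.start i) (β.end j) ] Unique (verts p) ×
        (∀ {z} → z ∈ₗ verts p → z ∈ₗ verts (α.walk i) ⊎ z ∈ₗ verts (β.walk j))

      glue : ∀ {i j} → Joins i j → Glued i j
      glue {i} {j} joins = go joins (weakenʷ (α.walk i)) (tail-weakenʷ (α.walk i))
                                    (weakenʷ (β.walk j)) (tail-weakenʷ (β.walk j))
        where
        E′ = (x , y) ∷ E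
        go : Joins i j →
          (p : Walk E′ (α.start i) (α.end i)) → tail p ≡ tail (α.walk i) →
          (q : Walk E′ (β.start j) (β.end j)) → tail q ≡ tail (β.walk j) → Glued i j
        go (inj₁ (end≡x , start≡y)) p p≡ q q≡ =
          p ++ʷ step arc q ,
          subst Unique (sym eq) (Unique.++⁺ (α.unique i) (β.unique j) apart) ,
          (λ {z} → ∈-++⁻ (verts (α.walk i)) ∘ subst (z ∈ₗ_) eq)
          where
          arc : (α.end i , β.start j) ∈ₗ E′
          arc = here (cong₂ _,_ end≡x start≡y)
          eq : verts (p ++ʷ step arc q) ≡ verts (α.walk i) ++ verts (β.walk j)
          eq = trans (verts-++ʷ p _) (cong₂
            (λ s t → (α.start i ∷ s) ++ (β.start j ∷ t)) p≡ q≡)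
          apart : Disjoint (verts (α.walk i)) (verts (β.walk j))
          apart (z∈α , z∈β) = β-avoids j z∈β
            (subst (_∈ L) (sym (trans (proj₁ (proj₂ (meet i j z∈α z∈β))) end≡x)) x∈L)
        go (inj₂ (end≡start , end∈S)) p p≡ q q≡ =
          p ++ʷ q′ ,
          subst Unique (sym eq) (Unique.++⁺ (α.unique i) (AllPairs.tail (β.unique j)) apart) ,
          (λ {z} → Data.Sum.Base.map id there ∘ ∈-++⁻ (verts (α.walk i)) ∘ subst (z ∈ₗ_) eq)
          where
          q′ = subst (λ v → Walk E′ v (β.end j)) (sym end≡start) q
          tail-subst : ∀ {u v w} (eq : u ≡ v) (r : Walk E′ u w) →
            tail (subst (λ v → Walk E′ v w) eq r) ≡ tail r
          tail-subst refl r = refl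
          eq : verts (p ++ʷ q′) ≡ verts (α.walk i) ++ tail (β.walk j)
          eq = trans (verts-++ʷ p q′) (cong₂
            (λ s t → (α.start i ∷ s) ++ t) p≡ (trans (tail-subst (sym end≡start) q) q≡))
          apart : Disjoint (verts (α.walk i)) (tail (β.walk j))
          apart (z∈α , z∈β) = contradiction
            (sym (proj₂ (proj₂ (meet i j z∈α (there z∈β)))))
            (All.lookup (AllPairs.head (β.unique j)) z∈β)

      joins-injective : ∀ {i i′ j} → Joins i j → Joins i′ j → i ≡ i′
      joins-injective (inj₁ (p , _)) (inj₁ (q , _)) = α.end-injective (trans p (sym q))
      joins-injective (inj₂ (p , _)) (inj₂ (q , _)) = α.end-injective (trans p (sym q))
      joins-injective (inj₁ (_ , s)) (inj₂ (q , q∈S)) =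
        contradiction (subst (_∈ S) (trans q s) q∈S) y∉S
      joins-injective (inj₂ (q , q∈S)) (inj₁ (_ , s)) =
        contradiction (subst (_∈ S) (trans q s) q∈S) y∉S

      no-cross : ∀ {i i′ j z} → i ≢ i′ → Joins i′ j →
        z ∈ₗ verts (α.walk i) → z ∈ₗ verts (β.walk j) → ⊥
      no-cross {i} {j = j} i≢i′ joins z∈α z∈β with meet i j z∈α z∈β | joins
      ... | z∈S , z≡end , z≡start | inj₁ (_ , s) = y∉S (subst (_∈ S) (trans z≡start s) z∈S)
      ... | z∈S , z≡end , z≡start | inj₂ (q , _) =
        i≢i′ (α.end-injective (trans (sym z≡end) (trans z≡start (sym q))))

      göring : Linkage ((x , y) ∷ E) A B k
      göring = record
        { walk     = λ i → proj₁ (glued i)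
        ; start∈   = α.start∈
        ; end∈     = λ i → β.end∈ _
        ; unique   = λ i → proj₁ (proj₂ (glued i))
        ; disjoint = λ {i} {i′} i≢i′ (z∈ , z∈′) →
            separate i≢i′ (proj₂ (proj₂ (glued i)) z∈) (proj₂ (proj₂ (glued i′)) z∈′)
        }
        where
        glued : ∀ i → Glued i (proj₁ (partner i))
        glued i = glue (proj₂ (partner i))
        separate : ∀ {i i′ z} → i ≢ i′ →
          z ∈ₗ verts (α.walk i) ⊎ z ∈ₗ verts (β.walk (proj₁ (partner i))) →
          z ∈ₗ verts (α.walk i′) ⊎ z ∈ₗ verts (β.walk (proj₁ (partner i′))) →
          ⊥
        separate i≢i′ (inj₁ a) (inj₁ b) = α.disjoint i≢i′ (a , b)
        separate {i} {i′} i≢i′ (inj₂ a) (inj₂ b) = β.disjoint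
          (λ eq → i≢i′ (joins-injective (subst (Joins i) eq (proj₂ (partner i))) (proj₂ (partner i′))))
          (a , b)
        separate {i′ = i′} i≢i′ (inj₁ a) (inj₂ b) = no-cross i≢i′ (proj₂ (partner i′)) a b
        separate {i} i≢i′ (inj₂ a) (inj₁ b) = no-cross (i≢i′ ∘ sym) (proj₂ (partner i)) b a

  menger : ∀ {n} (E : Arcs n) (A B : Subset n) k →
    (∀ S L → Separates E A B S L → k ≤ ∣ S ∣) → Linkage E A B k
  menger [] A B k robust = record
    { walk     = λ i → stop {v = f (inject≤ i k≤)}
    ; start∈   = λ i → proj₁ (x∈p∩q⁻ A B (f∈ _))
    ; end∈     = λ i → proj₂ (x∈p∩q⁻ A B (f∈ _))
    ; unique   = λ i → [] ∷ []
    ; disjoint = λ { i≢j (here refl , here eq) → i≢j (inject≤-injective k≤ k≤ _ _ (f-inj eq)) }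
    }
    where
    -- Without arcs `A ∩ B` separates, and its elements are the required trivial walks.
    sep : Separates [] A B (A ∩ B) (A ∩ ∁ B)
    sep = separates src [] (λ v v∈B v∈ → x∈∁p⇒x∉p (proj₂ (x∈p∩q⁻ A (∁ B) v∈)) v∈B)
      where
      src : ∀ v → v ∈ A → v ∈ A ∩ B ⊎ v ∈ A ∩ ∁ B
      src v v∈A with v ∈? B
      ... | yes v∈B = inj₁ (x∈p∩q⁺ (v∈A , v∈B))
      ... | no  v∉B = inj₂ (x∈p∩q⁺ (v∈A , x∉p⇒x∈∁p v∉B))
    k≤ = robust (A ∩ B) (A ∩ ∁ B) sep
    f = proj₁ (elements (A ∩ B))
    f-inj = proj₁ (proj₂ (elements (A ∩ B)))
    f∈ = proj₂ (proj₂ (elements (A ∩ B)))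
  menger ((x , y) ∷ E) A B k robust
    -- Subsets can be searched: either the bound survives the deletion of the arc, or a separator
    -- that is too small is at hand.
    with anySubset? (λ S → anySubset? (λ L → separates? E A B S L ×-dec ∣ S ∣ <? k))
  ... | no none = weakenˡ (menger E A B k
          (λ S L sep → ≮⇒≥ (λ S<k → none (S , L , sep , S<k))))
  ... | yes (S , L , sep , S<k) = göring robust sep S<k
          (menger E A (P robust sep S<k) k (robust-P robust sep S<k))
          (menger E (Q robust sep S<k) B k (robust-Q robust sep S<k))

-- From vertex cuts to internally disjoint paths.

module CutConnectivity where

  open Menger
  open import Data.Fin.Base using (Fin; zero; suc)
  open import Data.Fin.Properties using (_≟_; any?)
  open import Data.Fin.Subset using (Subset; _∈_; _∉_; ∣_∣; _∪_; ⁅_⁆)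
  open import Data.Fin.Subset.Properties using (_∈?_; p⊆q⇒∣p∣≤∣q∣; x∈p∪q⁺; x∈⁅x⁆)
  open import Data.List.Base using ([]; _∷_; _++_; [_]; allFin; cartesianProduct; filter)
  open import Data.List.Membership.Propositional using () renaming (_∈_ to _∈ₗ_)
  open import Data.List.Membership.Propositional.Properties using (∈-filter⁺; ∈-filter⁻;
    ∈-cartesianProduct⁺; ∈-allFin)
  open import Data.List.Relation.Binary.Disjoint.Propositional using (Disjoint)
  import Data.List.Relation.Unary.All as All
  import Data.List.Relation.Unary.All.Properties as All
  open import Data.List.Relation.Unary.All using (All; []; _∷_)
  open import Data.List.Relation.Unary.AllPairs using ([]; _∷_)
  open import Data.List.Relation.Unary.Any using (here)
  open import Data.List.Relation.Unary.Linked using (Linked; [-]; _∷_)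
  open import Data.List.Relation.Unary.Unique.Propositional using (Unique)
  import Data.List.Relation.Unary.Unique.Propositional.Properties as Unique
  open import Data.Nat.Base using (ℕ; zero; suc; _≤_; _<_; s≤s)
  open import Data.Nat.Properties using (≤-<-trans; ≤-trans; <⇒≱; ≮⇒≥)
  open import Data.Product.Base using (_×_; _,_; proj₁; proj₂; ∃-syntax)
  open import Data.Sum.Base using (_⊎_; inj₁; inj₂; [_,_]′)
  open import Data.Empty using (⊥-elim)
  open import Data.Vec.Base using (tabulate)
  open import Data.Vec.Properties using (lookup⇒[]=; []=⇒lookup; lookup∘tabulate)
  open import Function.Base using (_∘_; id)
  open import Relation.Binary.Construct.Closure.ReflexiveTransitive using (Star; ε; _◅_)
  open import Relation.Binary.PropositionalEquality.Core using (_≡_; _≢_; refl; sym; trans;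
    cong; subst)
  open import Relation.Nullary.Decidable using (yes; no; does; _×-dec_; _⊎-dec_; ¬?; dec-true;
    decidable-stable)
  open import Relation.Nullary.Negation using (¬_; contradiction)
  open import Relation.Unary using (Pred; Decidable)
  open import Level using (0ℓ)

  module _ {n} {P : Pred (Fin n) 0ℓ} (P? : Decidable P) where

    ⟦_⟧ : Subset n
    ⟦_⟧ = tabulate (does ∘ P?)

    ∈⟦⟧⁺ : ∀ {v} → P v → v ∈ ⟦_⟧
    ∈⟦⟧⁺ {v} Pv = lookup⇒[]= v ⟦_⟧ (trans (lookup∘tabulate _ v) (dec-true (P? v) Pv))

    ∈⟦⟧⁻ : ∀ {v} → v ∈ ⟦_⟧ → P v
    ∈⟦⟧⁻ {v} v∈ with P? v | trans (sym (lookup∘tabulate (does ∘ P?) v)) ([]=⇒lookup v∈)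
    ... | yes Pv | _ = Pv

  outsider : ∀ {n} (P : Subset n) → ∣ P ∣ < n → ∃[ v ] v ∉ P
  outsider P P<n with any? (λ v → ¬? (v ∈? P))
  ... | yes found = found
  ... | no  none  = contradiction
    (injective⇒≤∣∣ P id (λ v → decidable-stable (v ∈? P) (none ∘ (v ,_))))
    (<⇒≱ P<n)

  Avoiding : ∀ {n} → Graph n → Subset n → Fin n → Fin n → Set
  Avoiding G S a b = Graph.Adj G a b × a ∉ S × b ∉ S

  CutConnected : ∀ {n} → Graph n → ℕ → Set
  CutConnected {n} G k = ∀ (S : Subset n) → ∣ S ∣ < k →
    ∀ {u w} → u ∉ S → w ∉ S → Star (Avoiding G S) u w

  module _ {n} (G : Graph n) {u v : Fin n} (u≢v : u ≢ v) where

    open Graph G using (Adj; adj?; irrefl)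

    Inner : Fin n → Set
    Inner a = a ≢ u × a ≢ v

    inner? : Decidable Inner
    inner? a = ¬? (a ≟ u) ×-dec ¬? (a ≟ v)

    fromSource? : Decidable (λ a → Adj u a × Inner a)
    fromSource? a = adj? u a ×-dec inner? a

    toSink? : Decidable (λ a → Adj a v × Inner a)
    toSink? a = adj? a v ×-dec inner? a

    innerArc? : Decidable (λ ((a , b) : Fin n × Fin n) → Adj a b × Inner a × Inner b)
    innerArc? (a , b) = adj? a b ×-dec inner? a ×-dec inner? b

    -- Menger's theorem is applied with `u` and `v` deleted, between the other neighbours of `u` and
    -- of `v`. Adding `u` in front and `v` behind turns a linkage into internally disjoint paths,
    -- none of which is the edge `uv`.
    innerArcs : Arcs n
    innerArcs = filter innerArc? (cartesianProduct (allFin n) (allFin n))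

    innerArc⁺ : ∀ {a b} → Adj a b → Inner a → Inner b → (a , b) ∈ₗ innerArcs
    innerArc⁺ {a} {b} ab ia ib = ∈-filter⁺ innerArc?
      (∈-cartesianProduct⁺ (∈-allFin a) (∈-allFin b)) (ab , ia , ib)

    innerArc⁻ : ∀ {a b} → (a , b) ∈ₗ innerArcs → Adj a b × Inner a × Inner b
    innerArc⁻ = proj₂ ∘ ∈-filter⁻ innerArc? {xs = cartesianProduct (allFin n) (allFin n)}

    private
      A B : Subset n
      A = ⟦ fromSource? ⟧
      B = ⟦ toSink? ⟧

    module _ {S L : Subset n} (sep : Separates innerArcs A B S L) where

      open Separates sep

      Reached : Fin n → Set
      Reached a = a ≡ u ⊎ (a ∈ L × Inner a)

      -- The second hypothesis keeps the walk off the edge uv, which is not among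
      -- the inner arcs.
      confined : ∀ {T} → (∀ {a} → a ∈ S → Inner a → a ∈ T) →
        (Adj u v → u ∈ T ⊎ v ∈ T) →
        ∀ {a b} → Star (Avoiding G T) a b → Reached a → Reached b
      confined S⊆T uv ε ra = ra
      confined {T} S⊆T uv {a} (_◅_ {j = c} (ac , a∉T , c∉T) rest) ra =
        confined S⊆T uv rest (next ra)
        where
        reach : Inner c → c ∈ S ⊎ c ∈ L → Reached c
        reach ic (inj₁ c∈S) = contradiction (S⊆T c∈S ic) c∉T
        reach ic (inj₂ c∈L) = inj₂ (c∈L , ic)
        next : Reached a → Reached c
        next ra with c ≟ u | c ≟ v | ra
        ... | yes c≡u | _        | _ = inj₁ c≡u
        ... | no  _   | yes refl | inj₁ refl =
          ⊥-elim ([ a∉T , c∉T ]′ (uv ac))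
        ... | no  _   | yes refl | inj₂ (a∈L , ia) =
          contradiction a∈L (sinks a (∈⟦⟧⁺ toSink? (ac , ia)))
        ... | no c≢u  | no c≢v   | inj₁ refl =
          reach (c≢u , c≢v) (sources c (∈⟦⟧⁺ fromSource? (ac , c≢u , c≢v)))
        ... | no c≢u  | no c≢v   | inj₂ (a∈L , ia) =
          reach (c≢u , c≢v) (All.lookup closed (innerArc⁺ ac ia (c≢u , c≢v)) a∈L)

      unreached : ¬ Reached v
      unreached (inj₁ v≡u)            = u≢v (sym v≡u)
      unreached (inj₂ (_ , _ , v≢v)) = v≢v refl

    module _ {k} (cut : CutConnected G (suc k)) where

      -- A small `S` would leave a walk from `u` to `v`, which `confined` forbids. `S` may contain
      -- `u` or `v`, which a cut must spare, so only its inner vertices are deleted.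
      robust-nonadjacent : ¬ Adj u v →
        ∀ S L → Separates innerArcs A B S L → suc k ≤ ∣ S ∣
      robust-nonadjacent ¬uv S L sep = ≮⇒≥ λ S<k →
        unreached sep (confined sep (λ a∈S ia → ∈⟦⟧⁺ T? (a∈S , ia)) (λ uv → contradiction uv ¬uv)
          (cut ⟦ T? ⟧ (≤-<-trans (p⊆q⇒∣p∣≤∣q∣ (proj₁ ∘ ∈⟦⟧⁻ T?)) S<k)
            (λ u∈ → proj₁ (proj₂ (∈⟦⟧⁻ T? u∈)) refl)
            (λ v∈ → proj₂ (proj₂ (∈⟦⟧⁻ T? v∈)) refl))
          (inj₁ refl))
        where
        T? : Decidable (λ a → a ∈ S × Inner a)
        T? a = a ∈? S ×-dec inner? a

      -- The edge `uv` is one path, so `k` others are enough. If `S` had fewer than `k` elements,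
      -- some `w` would lie outside `S`, `u` and `v`. A walk from `u` to `w` avoiding `S` and `v`,
      -- and one from `w` to `v` avoiding `S` and `u`, then connect `u` to `v` without the edge.
      robust-adjacent : suc k < n →
        ∀ S L → Separates innerArcs A B S L → k ≤ ∣ S ∣
      robust-adjacent k<n S L sep = ≮⇒≥ contra
        where
        Plus? : ∀ x → Decidable (λ a → (a ∈ S × Inner a) ⊎ a ≡ x)
        Plus? x a = (a ∈? S ×-dec inner? a) ⊎-dec a ≟ x
        contra : ¬ (∣ S ∣ < k)
        contra S<k with outsider ((S ∪ ⁅ u ⁆) ∪ ⁅ v ⁆) (≤-<-trans
            (≤-trans (∣p∪⁅x⁆∣≤1+∣p∣ (S ∪ ⁅ u ⁆) v) (s≤s (≤-trans (∣p∪⁅x⁆∣≤1+∣p∣ S u) S<k))) k<n)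
        ... | w , w∉ = unreached sep
          (confined sep (λ a∈S ia → ∈⟦⟧⁺ (Plus? u) (inj₁ (a∈S , ia)))
            (λ _ → inj₁ (∈⟦⟧⁺ (Plus? u) (inj₂ refl)))
            (cut _ (small u) (w∉T u w≢u) (x∉T u (u≢v ∘ sym) (λ (_ , v≢v) → v≢v refl)))
            w-reached)
          where
          w∉S : w ∉ S
          w∉S = w∉ ∘ x∈p∪q⁺ ∘ inj₁ ∘ x∈p∪q⁺ ∘ inj₁
          w≢u : w ≢ u
          w≢u refl = w∉ (x∈p∪q⁺ (inj₁ (x∈p∪q⁺ (inj₂ (x∈⁅x⁆ w)))))
          w≢v : w ≢ v
          w≢v refl = w∉ (x∈p∪q⁺ (inj₂ (x∈⁅x⁆ w)))
          small : ∀ x → ∣ ⟦ Plus? x ⟧ ∣ < suc k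
          small x = s≤s (≤-trans
            (p⊆q⇒∣p∣≤∣q∣ {q = S ∪ ⁅ x ⁆}
              (λ a∈ → [ x∈p∪q⁺ ∘ inj₁ ∘ proj₁ , (λ { refl → x∈p∪q⁺ (inj₂ (x∈⁅x⁆ x)) }) ]′
                (∈⟦⟧⁻ (Plus? x) a∈)))
            (≤-trans (∣p∪⁅x⁆∣≤1+∣p∣ S x) S<k))
          x∉T : ∀ x {y} → y ≢ x → ¬ Inner y → y ∉ ⟦ Plus? x ⟧
          x∉T x y≢x ¬iy y∈ = [ ¬iy ∘ proj₂ , y≢x ]′ (∈⟦⟧⁻ (Plus? x) y∈)
          w∉T : ∀ x → w ≢ x → w ∉ ⟦ Plus? x ⟧
          w∉T x w≢x w∈ = [ w∉S ∘ proj₁ , w≢x ]′ (∈⟦⟧⁻ (Plus? x) w∈)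
          w-reached : Reached sep w
          w-reached = confined sep (λ a∈S ia → ∈⟦⟧⁺ (Plus? v) (inj₁ (a∈S , ia)))
            (λ _ → inj₂ (∈⟦⟧⁺ (Plus? v) (inj₂ refl)))
            (cut _ (small v) (x∉T v u≢v (λ (u≢u , _) → u≢u refl)) (w∉T v w≢v))
            (inj₁ refl)

    inner-walk : ∀ {a b} → Inner a → (p : Walk innerArcs a b) → All Inner (verts p)
    inner-walk ia stop       = ia ∷ []
    inner-walk ia (step e p) = ia ∷ inner-walk (proj₂ (proj₂ (innerArc⁻ e))) p

    linked-walk : ∀ {a b} (p : Walk innerArcs a b) → Adj b v → Linked Adj (verts p ++ [ v ])
    linked-walk stop       bv = bv ∷ [-]
    linked-walk (step e p) bv = proj₁ (innerArc⁻ e) ∷ linked-walk p bv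

    module _ {k} (ℓ : Linkage innerArcs A B k) where

      open Linkage ℓ

      longPath : Fin k → Path G u v
      longPath i = record
        { inner    = verts (walk i)
        ; walk     = proj₁ s ∷ linked-walk (walk i) (proj₁ t)
        ; distinct = All.++⁺ (All.map (λ (a≢u , _) → a≢u ∘ sym) inn) (u≢v ∷ [])
                   ∷ Unique.++⁺ (unique i) ([] ∷ [])
                       (λ { (a∈ , here refl) → proj₂ (All.lookup inn a∈) refl })
        }
        where
        s   = ∈⟦⟧⁻ fromSource? (start∈ i)
        t   = ∈⟦⟧⁻ toSink? (end∈ i)
        inn = inner-walk (proj₂ s) (walk i)

      longPaths : DisjointPaths G u v k
      longPaths = longPath , λ i j i≢j →
        disjoint i≢j , λ eq → disjoint i≢j (here refl , subst (start i ∈ₗ_) eq (here refl))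

      allPaths : Adj u v → DisjointPaths G u v (suc k)
      allPaths uv = paths , apart
        where
        paths : Fin (suc k) → Path G u v
        paths zero    = record { inner = [] ; walk = uv ∷ [-] ; distinct = (u≢v ∷ []) ∷ [] ∷ [] }
        paths (suc i) = longPath i
        apart : ∀ i j → i ≢ j → Disjoint (Path.inner (paths i)) (Path.inner (paths j))
                              × Path.inner (paths i) ≢ Path.inner (paths j)
        apart zero    zero    i≢j = contradiction refl i≢j
        apart zero    (suc j) i≢j = (λ { (() , _) }) , λ ()
        apart (suc i) zero    i≢j = (λ { (_ , ()) }) , λ ()
        apart (suc i) (suc j) i≢j = proj₂ longPaths i j (i≢j ∘ cong suc)

  cutConnected⇒connected : ∀ {n k} (G : Graph n) → 2 ≤ n → suc k < n →
    CutConnected G (suc k) → Connected G (suc k)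
  cutConnected⇒connected {k = k} G 2≤n k<n cut = 2≤n , paths
    where
    paths : ∀ u v → u ≢ v → DisjointPaths G u v (suc k)
    paths u v u≢v with Graph.adj? G u v
    ... | yes uv = allPaths G u≢v (menger _ _ _ k (robust-adjacent G u≢v cut k<n)) uv
    ... | no ¬uv = longPaths G u≢v (menger _ _ _ (suc k) (robust-nonadjacent G u≢v cut ¬uv))

-- Segments with integral ends: separating lines and crossing points.

module PlaneSegments where

  open import Data.Integer.Base as ℤ using (ℤ; 1ℤ)
  import Data.Integer.Properties as ℤ
  import Data.Integer.Solver as ℤ-Solver
  open import Data.Product.Base using (_×_; _,_; proj₁; proj₂)
  open import Data.Rational.Base as ℚ using (ℚ; 0ℚ; 1ℚ; _+_; _-_; _*_; _≤_; _<_; -_; *≤*; *<*;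
    positive; nonNegative)
  import Data.Rational.Properties as ℚ
  import Data.Rational.Solver as ℚ-Solver
  open import Data.Rational.Literals using (fromℤ)
  import Data.Rational.Unnormalised.Base as ℚᵘ
  import Data.Rational.Unnormalised.Properties as ℚᵘ
  open import Data.Sum.Base using (_⊎_; inj₁; inj₂; [_,_]′)
  open import Function.Base using (_∘_; id)
  open import Relation.Binary.PropositionalEquality
  open import Relation.Nullary.Decidable using (yes; no)
  open import Relation.Nullary.Negation using (¬_; contradiction)

  fromℤ-≤ : ∀ {i j} → i ℤ.≤ j → fromℤ i ≤ fromℤ j
  fromℤ-≤ i≤j = *≤* (ℤ.*-monoʳ-≤-nonNeg 1ℤ i≤j)

  fromℤ-< : ∀ {i j} → i ℤ.< j → fromℤ i < fromℤ j
  fromℤ-< i<j = *<* (ℤ.*-monoʳ-<-pos 1ℤ i<j)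

  fromℤ-+ : ∀ i j → fromℤ (i ℤ.+ j) ≡ fromℤ i + fromℤ j
  fromℤ-+ i j = ℚ.toℚᵘ-injective (ℚᵘ.≃-trans
    (ℚᵘ.*≡* (solve 2 (λ i j → (i :+ j) :* (con 1ℤ :* con 1ℤ)
                           := (i :* con 1ℤ :+ j :* con 1ℤ) :* con 1ℤ) refl i j))
    (ℚᵘ.≃-sym (ℚ.toℚᵘ-homo-+ (fromℤ i) (fromℤ j))))
    where open ℤ-Solver.+-*-Solver

  fromℤ-* : ∀ i j → fromℤ (i ℤ.* j) ≡ fromℤ i * fromℤ j
  fromℤ-* i j = ℚ.toℚᵘ-injective (ℚᵘ.≃-trans
    (ℚᵘ.*≡* refl)
    (ℚᵘ.≃-sym (ℚ.toℚᵘ-homo-* (fromℤ i) (fromℤ j))))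

  fromℤ-neg : ∀ i → fromℤ (ℤ.- i) ≡ - fromℤ i
  fromℤ-neg ℤ.+0       = refl
  fromℤ-neg ℤ.+[1+ n ] = refl
  fromℤ-neg ℤ.-[1+ n ] = refl

  fromℤ-injective : ∀ {i j} → fromℤ i ≡ fromℤ j → i ≡ j
  fromℤ-injective refl = refl

  Pt : Set
  Pt = ℤ × ℤ

  opaque

    ⟨_∣_⟩ : Pt → Pt → ℤ
    ⟨ a , b ∣ x , y ⟩ = a ℤ.* x ℤ.+ b ℤ.* y

  embed : Pt → Point
  embed (x , y) = fromℤ x , fromℤ y

  embedˢ : Pt × Pt → Segment
  embedˢ (p , q) = embed p , embed q

  embed-injective : ∀ {p q} → embed p ≡ embed q → p ≡ q
  embed-injective {_ , _} {_ , _} refl = refl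

  ⟨_∣_⟩ℚ : Pt → Point → ℚ
  ⟨ a , b ∣ x , y ⟩ℚ = fromℤ a * x + fromℤ b * y

  opaque

    unfolding ⟨_∣_⟩

    ⟨∣⟩-embed : ∀ f p → ⟨ f ∣ embed p ⟩ℚ ≡ fromℤ ⟨ f ∣ p ⟩
    ⟨∣⟩-embed (a , b) (x , y) =
      sym (trans (fromℤ-+ (a ℤ.* x) (b ℤ.* y)) (cong₂ _+_ (fromℤ-* a x) (fromℤ-* b y)))

    ⟨∣⟩-between : ∀ f (p q : Pt) {x : Point} t →
      proj₁ x ≡ fromℤ (proj₁ p) + t * (fromℤ (proj₁ q) - fromℤ (proj₁ p)) →
      proj₂ x ≡ fromℤ (proj₂ p) + t * (fromℤ (proj₂ q) - fromℤ (proj₂ p)) →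
      ⟨ f ∣ x ⟩ℚ ≡ (1ℚ - t) * fromℤ ⟨ f ∣ p ⟩ + t * fromℤ ⟨ f ∣ q ⟩
    ⟨∣⟩-between f@(a , b) p@(p₁ , p₂) q@(q₁ , q₂) t refl refl = trans
      (affine (fromℤ a) (fromℤ b) (fromℤ p₁) (fromℤ p₂) (fromℤ q₁) (fromℤ q₂) t)
      (cong₂ (λ u v → (1ℚ - t) * u + t * v) (⟨∣⟩-embed f p) (⟨∣⟩-embed f q))
      where
      open ℚ-Solver.+-*-Solver
      affine : ∀ a b p₁ p₂ q₁ q₂ t → a * (p₁ + t * (q₁ - p₁)) + b * (p₂ + t * (q₂ - p₂))
                                   ≡ (1ℚ - t) * (a * p₁ + b * p₂) + t * (a * q₁ + b * q₂)
      affine = solve 7 (λ a b p₁ p₂ q₁ q₂ t →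
          a :* (p₁ :+ t :* (q₁ :- p₁)) :+ b :* (p₂ :+ t :* (q₂ :- p₂))
       := (con 1ℚ :- t) :* (a :* p₁ :+ b :* p₂) :+ t :* (a :* q₁ :+ b :* q₂)) refl

  1-t≥0 : ∀ {t} → t ≤ 1ℚ → 0ℚ ≤ 1ℚ - t
  1-t≥0 {t} t≤1 = subst (_≤ 1ℚ - t) (ℚ.+-inverseʳ t) (ℚ.+-monoˡ-≤ (- t) t≤1)

  1-t>0 : ∀ {t} → t < 1ℚ → 0ℚ < 1ℚ - t
  1-t>0 {t} t<1 = subst (_< 1ℚ - t) (ℚ.+-inverseʳ t) (ℚ.+-monoˡ-< (- t) t<1)

  mix-const : ∀ t g → (1ℚ - t) * g + t * g ≡ g
  mix-const = solve 2 (λ t g → (con 1ℚ :- t) :* g :+ t :* g := g) refl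
    where open ℚ-Solver.+-*-Solver

  module _ {t} (0≤t : 0ℚ ≤ t) (t≤1 : t ≤ 1ℚ) where

    mix-≤ : ∀ {u v u′ v′} → u ≤ u′ → v ≤ v′ → (1ℚ - t) * u + t * v ≤ (1ℚ - t) * u′ + t * v′
    mix-≤ u≤ v≤ = ℚ.+-mono-≤
      (ℚ.*-monoˡ-≤-nonNeg (1ℚ - t) {{nonNegative (1-t≥0 t≤1)}} u≤)
      (ℚ.*-monoˡ-≤-nonNeg t {{nonNegative 0≤t}} v≤)

    mix-lower : ∀ {u v g} → g ≤ u → g ≤ v → g ≤ (1ℚ - t) * u + t * v
    mix-lower {g = g} u≥ v≥ = subst (_≤ _) (mix-const t g) (mix-≤ u≥ v≥)

    -- Any weight on a value strictly below `g` would pull the combination below `g`.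
    mix-extreme : ∀ {u v g} → u ≤ g → v ≤ g → g ≤ (1ℚ - t) * u + t * v →
      (u < g → t ≡ 1ℚ) × (v < g → t ≡ 0ℚ)
    mix-extreme {u} {v} {g} u≤ v≤ g≤ = at-end , at-start
      where
      at-end : u < g → t ≡ 1ℚ
      at-end u< with t ℚ.<? 1ℚ
      ... | no  t≮1 = ℚ.≤-antisym t≤1 (ℚ.≮⇒≥ t≮1)
      ... | yes t<1 = contradiction
        (ℚ.≤-<-trans g≤ (subst (_ <_) (mix-const t g) (ℚ.+-mono-<-≤
          (ℚ.*-monoʳ-<-pos (1ℚ - t) {{positive (1-t>0 t<1)}} u<)
          (ℚ.*-monoˡ-≤-nonNeg t {{nonNegative 0≤t}} v≤))))
        (ℚ.<-irrefl refl)
      at-start : v < g → t ≡ 0ℚ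
      at-start v< with 0ℚ ℚ.<? t
      ... | no  0≮t = ℚ.≤-antisym (ℚ.≮⇒≥ 0≮t) 0≤t
      ... | yes 0<t = contradiction
        (ℚ.≤-<-trans g≤ (subst (_ <_) (mix-const t g) (ℚ.+-mono-≤-<
          (ℚ.*-monoˡ-≤-nonNeg (1ℚ - t) {{nonNegative (1-t≥0 t≤1)}} u≤)
          (ℚ.*-monoʳ-<-pos t {{positive 0<t}} v<))))
        (ℚ.<-irrefl refl)

  -- A line has A on one side and B on the other.  Since A is not contained in
  -- the line, A and B can meet only at an end of A.
  record Below (A B : Pt × Pt) : Set where
    constructor below
    field
      f      : Pt
      γ      : ℤ
      src≤   : ⟨ f ∣ proj₁ A ⟩ ℤ.≤ γ
      tgt≤   : ⟨ f ∣ proj₂ A ⟩ ℤ.≤ γ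
      strict : ⟨ f ∣ proj₁ A ⟩ ℤ.< γ ⊎ ⟨ f ∣ proj₂ A ⟩ ℤ.< γ
      src≥   : γ ℤ.≤ ⟨ f ∣ proj₁ B ⟩
      tgt≥   : γ ℤ.≤ ⟨ f ∣ proj₂ B ⟩

  end-at-0 : ∀ p q {x t} → x ≡ p + t * (q - p) → t ≡ 0ℚ → x ≡ p
  end-at-0 p q refl refl = trans (cong (p +_) (ℚ.*-zeroˡ (q - p))) (ℚ.+-identityʳ p)

  end-at-1 : ∀ p q {x t} → x ≡ p + t * (q - p) → t ≡ 1ℚ → x ≡ q
  end-at-1 p q refl refl = trans (cong (p +_) (ℚ.*-identityˡ (q - p))) (lemma p q)
    where
    open ℚ-Solver.+-*-Solver
    lemma : ∀ p q → p + (q - p) ≡ q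
    lemma = solve 2 (λ p q → p :+ (q :- p) := q) refl

  module _ {A B : Pt × Pt} (sep : Below A B) where

    open Below sep

    above-line : ∀ {x} → x ∈ˢ embedˢ B → fromℤ γ ≤ ⟨ f ∣ x ⟩ℚ
    above-line {x} (s , 0≤s , s≤1 , x₁≡ , x₂≡) =
      subst (fromℤ γ ≤_) (sym (⟨∣⟩-between f (proj₁ B) (proj₂ B) {x} s x₁≡ x₂≡))
        (mix-lower 0≤s s≤1 (fromℤ-≤ src≥) (fromℤ-≤ tgt≥))

    below-meet : ∀ {x} → x ∈ˢ embedˢ A → x ∈ˢ embedˢ B →
      x ≡ embed (proj₁ A) ⊎ x ≡ embed (proj₂ A)
    below-meet {x} (t , 0≤t , t≤1 , x₁≡ , x₂≡) x∈B = [ inj₂ ∘ at-end , inj₁ ∘ at-start ]′ strict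
      where
      p₁ = fromℤ (proj₁ (proj₁ A))
      p₂ = fromℤ (proj₂ (proj₁ A))
      q₁ = fromℤ (proj₁ (proj₂ A))
      q₂ = fromℤ (proj₂ (proj₂ A))
      extreme = mix-extreme 0≤t t≤1 (fromℤ-≤ src≤) (fromℤ-≤ tgt≤)
        (subst (fromℤ γ ≤_) (⟨∣⟩-between f (proj₁ A) (proj₂ A) {x} t x₁≡ x₂≡) (above-line x∈B))
      at-end : ⟨ f ∣ proj₁ A ⟩ ℤ.< γ → x ≡ embed (proj₂ A)
      at-end src< = cong₂ _,_ (end-at-1 p₁ q₁ x₁≡ t≡1) (end-at-1 p₂ q₂ x₂≡ t≡1)
        where t≡1 = proj₁ extreme (fromℤ-< src<)
      at-start : ⟨ f ∣ proj₂ A ⟩ ℤ.< γ → x ≡ embed (proj₁ A)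
      at-start tgt< = cong₂ _,_ (end-at-0 p₁ q₁ x₁≡ t≡0) (end-at-0 p₂ q₂ x₂≡ t≡0)
        where t≡0 = proj₂ extreme (fromℤ-< tgt<)

  -- For a degenerate segment, strictness puts its only point off the line, so even touching is
  -- excluded.
  below-point : ∀ {p B} → Below (p , p) B → ¬ (embed p ∈ˢ embedˢ B)
  below-point {p} sep p∈B = contradiction
    (ℚ.≤-<-trans (subst (fromℤ γ ≤_) (⟨∣⟩-embed f p) (above-line sep p∈B)) (fromℤ-< ([ id , id ]′ strict)))
    (ℚ.<-irrefl refl)
    where open Below sep

  det : Pt → Pt → ℤ
  det (a , b) (c , d) = a ℤ.* d ℤ.- b ℤ.* c

  _∸ᵖ_ : Pt → Pt → Pt
  (a , b) ∸ᵖ (c , d) = (a ℤ.- c) , (b ℤ.- d)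

  fromℤ-∸ : ∀ i j → fromℤ (i ℤ.- j) ≡ fromℤ i - fromℤ j
  fromℤ-∸ i j = trans (fromℤ-+ i (ℤ.- j)) (cong (fromℤ i +_) (fromℤ-neg j))

  nonParallel : ∀ {A B : Pt × Pt} →
    det (proj₂ A ∸ᵖ proj₁ A) (proj₂ B ∸ᵖ proj₁ B) ≢ ℤ.0ℤ → NonParallel (embedˢ A) (embedˢ B)
  nonParallel {(a₁ , a₂) , (b₁ , b₂)} {(c₁ , c₂) , (d₁ , d₂)} det≢0 eq =
    det≢0 (ℤ.i≡j⇒i-j≡0 (fromℤ-injective (begin
      fromℤ ((b₁ ℤ.- a₁) ℤ.* (d₂ ℤ.- c₂))             ≡⟨ hom b₁ a₁ d₂ c₂ ⟩
      (fromℤ b₁ - fromℤ a₁) * (fromℤ d₂ - fromℤ c₂)  ≡⟨ eq ⟩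
      (fromℤ b₂ - fromℤ a₂) * (fromℤ d₁ - fromℤ c₁)  ≡⟨ hom b₂ a₂ d₁ c₁ ⟨
      fromℤ ((b₂ ℤ.- a₂) ℤ.* (d₁ ℤ.- c₁))             ∎)))
    where
    open ≡-Reasoning
    hom : ∀ i j k l → fromℤ ((i ℤ.- j) ℤ.* (k ℤ.- l)) ≡ (fromℤ i - fromℤ j) * (fromℤ k - fromℤ l)
    hom i j k l = trans (fromℤ-* (i ℤ.- j) (k ℤ.- l)) (cong₂ _*_ (fromℤ-∸ i j) (fromℤ-∸ k l))

  *≡0⇒≡0 : ∀ k {r} → r ≢ 0ℚ → k * r ≡ 0ℚ → k ≡ 0ℚ
  *≡0⇒≡0 k {r} r≢0 eq = begin
    k                ≡⟨ ℚ.*-identityʳ k ⟨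
    k * 1ℚ           ≡⟨ cong (k *_) (ℚ.*-inverseʳ r) ⟨
    k * (r * ℚ.1/ r) ≡⟨ ℚ.*-assoc k r (ℚ.1/ r) ⟨
    (k * r) * ℚ.1/ r ≡⟨ cong (_* ℚ.1/ r) eq ⟩
    0ℚ * ℚ.1/ r      ≡⟨ ℚ.*-zeroˡ (ℚ.1/ r) ⟩
    0ℚ               ∎
    where
    open ≡-Reasoning
    instance _ = ℚ.≢-nonZero r≢0

  -- Two points common to both segments differ by a (q − p) and by b (s − r);
  -- taking determinants with s − r gives a det = 0.
  nonParallel-unique : ∀ {A B : Segment} {x y} → NonParallel A B →
    x ∈ˢ A → x ∈ˢ B → y ∈ˢ A → y ∈ˢ B → x ≡ y
  nonParallel-unique {(p₁ , p₂) , (q₁ , q₂)} {(r₁ , r₂) , (s₁ , s₂)} np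
    (a , _ , _ , x₁≡ , x₂≡) (b , _ , _ , x₁≡′ , x₂≡′) (c , _ , _ , y₁≡ , y₂≡) (d , _ , _ , y₁≡′ , y₂≡′)
    = cong₂ _,_ (coord p₁ u₁ x₁≡ y₁≡) (coord p₂ u₂ x₂≡ y₂≡)
    where
    open ℚ-Solver.+-*-Solver
    open ≡-Reasoning
    u₁ = q₁ - p₁
    u₂ = q₂ - p₂
    v₁ = s₁ - r₁
    v₂ = s₂ - r₂
    subtract : ∀ a c p u → (a - c) * u ≡ (p + a * u) - (p + c * u)
    subtract = solve 4 (λ a c p u → (a :- c) :* u := (p :+ a :* u) :- (p :+ c :* u)) refl
    scale : ∀ k u₁ v₂ u₂ v₁ → k * (u₁ * v₂ - u₂ * v₁) ≡ (k * u₁) * v₂ - (k * u₂) * v₁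
    scale = solve 5 (λ k u₁ v₂ u₂ v₁ →
      k :* (u₁ :* v₂ :- u₂ :* v₁) := (k :* u₁) :* v₂ :- (k :* u₂) :* v₁) refl
    parallel : ∀ k v₁ v₂ → (k * v₁) * v₂ - (k * v₂) * v₁ ≡ 0ℚ
    parallel = solve 3 (λ k v₁ v₂ → (k :* v₁) :* v₂ :- (k :* v₂) :* v₁ := con 0ℚ) refl
    restore : ∀ m n → m ≡ (m - n) + n
    restore = solve 2 (λ m n → m := (m :- n) :+ n) refl
    ≡⁺ : ∀ {m n} → m - n ≡ 0ℚ → m ≡ n
    ≡⁺ {m} {n} eq = trans (restore m n) (trans (cong (_+ n) eq) (ℚ.+-identityˡ n))
    diff : ∀ p u r v {x y} → x ≡ p + a * u → x ≡ r + b * v → y ≡ p + c * u → y ≡ r + d * v →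
      (a - c) * u ≡ (b - d) * v
    diff p u r v e₁ e₂ e₃ e₄ = begin
      (a - c) * u                ≡⟨ subtract a c p u ⟩
      (p + a * u) - (p + c * u)  ≡⟨ cong₂ _-_ (trans (sym e₁) e₂) (trans (sym e₃) e₄) ⟩
      (r + b * v) - (r + d * v)  ≡⟨ subtract b d r v ⟨
      (b - d) * v                ∎
    vanish : (a - c) * (u₁ * v₂ - u₂ * v₁) ≡ 0ℚ
    vanish = begin
      (a - c) * (u₁ * v₂ - u₂ * v₁)              ≡⟨ scale (a - c) u₁ v₂ u₂ v₁ ⟩
      ((a - c) * u₁) * v₂ - ((a - c) * u₂) * v₁  ≡⟨ cong₂ (λ m n → m * v₂ - n * v₁)
                                                      (diff p₁ u₁ r₁ v₁ x₁≡ x₁≡′ y₁≡ y₁≡′)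
                                                      (diff p₂ u₂ r₂ v₂ x₂≡ x₂≡′ y₂≡ y₂≡′) ⟩
      ((b - d) * v₁) * v₂ - ((b - d) * v₂) * v₁  ≡⟨ parallel (b - d) v₁ v₂ ⟩
      0ℚ                                         ∎
    a≡c : a ≡ c
    a≡c = ≡⁺ (*≡0⇒≡0 (a - c) (np ∘ ≡⁺) vanish)
    coord : ∀ p u {x y} → x ≡ p + a * u → y ≡ p + c * u → x ≡ y
    coord p u e₁ e₂ = trans e₁ (trans (cong (λ k → p + k * u) a≡c) (sym e₂))

-- Coordinates of the picture and finite tables of separating lines.

module Blobs where

  open PlaneSegments
  open import Data.Fin.Base using (Fin; suc)
  open import Data.Fin.Patterns
  import Data.Fin.Properties as Fin
  open import Data.Integer.Base as ℤ using (ℤ; +_; -[1+_]; 0ℤ)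
  import Data.Integer.Properties as ℤ
  open import Data.List.Base using (List; []; _∷_; map; _++_; allFin; foldr)
  open import Data.List.Relation.Unary.Any using (Any)
  import Data.List.Relation.Unary.Any as Any
  open import Data.Nat.Base using (suc; _≤_; _<_)
  open import Data.Product.Base using (_×_; _,_)
  open import Data.Sum.Base using (_⊎_)
  open import Function.Base using (_∘_)
  open import Relation.Binary.PropositionalEquality
  open import Relation.Nullary.Decidable using (Dec; from-yes; _×-dec_; _⊎-dec_)

  next : Fin 6 → Fin 6
  next 0F = 1F
  next 1F = 2F
  next 2F = 3F
  next 3F = 4F
  next 4F = 5F
  next 5F = 0F

  Blob : Set
  Blob = Fin 4

  -- Blobs 0, 1, 2, 3 lie on the left, at the top, on the right and at the bottom.
  -- Blob b is drawn with its centre at hub b and its corner q at hub b + spike b q.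
  hub : Blob → Pt
  hub 0F = -[1+ 9 ] , + 0
  hub 1F = + 0 , + 3
  hub 2F = + 10 , + 0
  hub 3F = + 0 , -[1+ 2 ]

  mirrorˣ mirrorʸ : Pt → Pt
  mirrorˣ (x , y) = (ℤ.- x) , y
  mirrorʸ (x , y) = x , (ℤ.- y)

  -- Corners `q` and 5 - `q` are mirror images, in the horizontal axis for a side blob and in the
  -- vertical axis for a middle one. Exits 0, 1, 2 of a side blob lead to blob 1 and exits 3, 4, 5
  -- to blob 3. In a middle blob, exits 2 and 3 lead to the side blob farther from them, which
  -- produces the last two crossings of `link`.
  sideSpike middleSpike : Fin 6 → Pt
  sideSpike 0F = -[1+ 0 ] , + 6
  sideSpike 1F = + 2 , + 4
  sideSpike 2F = + 3 , + 2
  sideSpike 3F = + 3 , -[1+ 1 ]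
  sideSpike 4F = + 2 , -[1+ 3 ]
  sideSpike 5F = -[1+ 0 ] , -[1+ 5 ]
  middleSpike 0F = -[1+ 2 ] , -[1+ 0 ]
  middleSpike 1F = -[1+ 2 ] , + 1
  middleSpike 2F = -[1+ 0 ] , + 2
  middleSpike 3F = + 1 , + 2
  middleSpike 4F = + 3 , + 1
  middleSpike 5F = + 3 , -[1+ 0 ]

  spike : Blob → Fin 6 → Pt
  spike 0F = sideSpike
  spike 1F = middleSpike
  spike 2F = mirrorˣ ∘ sideSpike
  spike 3F = mirrorʸ ∘ middleSpike

  -- The six crossings between blobs.  In the first four, both edges join the
  -- same two blobs; in the last two, both edges end in the same blob.
  link : Fin 6 → Fin 2 → (Blob × Fin 6) × (Blob × Fin 6)
  link 0F 0F = (0F , 1F) , (1F , 0F)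
  link 0F 1F = (0F , 2F) , (1F , 1F)
  link 1F 0F = (2F , 1F) , (1F , 5F)
  link 1F 1F = (2F , 2F) , (1F , 4F)
  link 2F 0F = (0F , 4F) , (3F , 0F)
  link 2F 1F = (0F , 3F) , (3F , 1F)
  link 3F 0F = (2F , 4F) , (3F , 5F)
  link 3F 1F = (2F , 3F) , (3F , 4F)
  link 4F 0F = (0F , 0F) , (1F , 3F)
  link 4F 1F = (2F , 0F) , (1F , 2F)
  link 5F 0F = (0F , 5F) , (3F , 3F)
  link 5F 1F = (2F , 5F) , (3F , 2F)

  -- Normal vectors of lines that separate any two disjoint parts of the picture,
  -- found by search.
  directions : List Pt
  directions = (+ 1 , + 0) ∷ (-[1+ 0 ] , + 0) ∷ (+ 0 , + 1) ∷ (+ 0 , -[1+ 0 ])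
    ∷ (+ 2 , + 3) ∷ (-[1+ 1 ] , -[1+ 2 ]) ∷ (+ 2 , -[1+ 2 ]) ∷ (-[1+ 1 ] , + 3) ∷ []

  tipValue : Pt → Blob × Fin 6 → ℤ
  tipValue f (b , q) = ⟨ f ∣ hub b ⟩ ℤ.+ ⟨ f ∣ spike b q ⟩

  BlobBelow BlobAbove : Pt → ℤ → Blob → Set
  BlobBelow f g b = ⟨ f ∣ hub b ⟩ ℤ.≤ g × (∀ q → tipValue f (b , q) ℤ.≤ g)
  BlobAbove f g b = g ℤ.≤ ⟨ f ∣ hub b ⟩ × (∀ q → g ℤ.≤ tipValue f (b , q))

  blobBelow? : ∀ f g b → Dec (BlobBelow f g b)
  blobBelow? f g b = (_ ℤ.≤? g) ×-dec Fin.all? (λ q → _ ℤ.≤? g)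

  blobAbove? : ∀ f g b → Dec (BlobAbove f g b)
  blobAbove? f g b = (g ℤ.≤? _) ×-dec Fin.all? (λ q → g ℤ.≤? _)

  LinkBelow : Pt → ℤ → (Blob × Fin 6) × (Blob × Fin 6) → Set
  LinkBelow f g (s , t) = tipValue f s ℤ.≤ g × tipValue f t ℤ.≤ g
    × (tipValue f s ℤ.< g ⊎ tipValue f t ℤ.< g)

  LinkAbove : Pt → ℤ → (Blob × Fin 6) × (Blob × Fin 6) → Set
  LinkAbove f g (s , t) = g ℤ.≤ tipValue f s × g ℤ.≤ tipValue f t

  linkBelow? : ∀ f g l → Dec (LinkBelow f g l)
  linkBelow? f g (s , t) = _ ℤ.≤? g ×-dec _ ℤ.≤? g ×-dec (_ ℤ.<? g ⊎-dec _ ℤ.<? g)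

  linkAbove? : ∀ f g l → Dec (LinkAbove f g l)
  linkAbove? f g (s , t) = g ℤ.≤? _ ×-dec g ℤ.≤? _

  -- The best threshold for a given direction, so that a search over directions is enough.
  linkTop : Pt → (Blob × Fin 6) × (Blob × Fin 6) → ℤ
  linkTop f (s , t) = tipValue f s ℤ.⊔ tipValue f t

  LinkVsBlob : Fin 6 → Fin 2 → Blob → Pt → Set
  LinkVsBlob c s b f = LinkBelow f g (link c s) × BlobAbove f g b
    where g = linkTop f (link c s)

  linkVsBlob? : ∀ c s b f → Dec (LinkVsBlob c s b f)
  linkVsBlob? c s b f = linkBelow? f _ (link c s) ×-dec blobAbove? f _ b

  opaque

    unfolding ⟨_∣_⟩

    linkVsBlob : ∀ c s b → Any (LinkVsBlob c s b) directions
    linkVsBlob = from-yes (Fin.all? λ c → Fin.all? λ s → Fin.all? λ b →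
      Any.any? (linkVsBlob? c s b) directions)

  LinkVsLink : Fin 6 → Fin 2 → Fin 6 → Fin 2 → Pt → Set
  LinkVsLink c s c′ s′ f = LinkBelow f g (link c s) × LinkAbove f g (link c′ s′)
    where g = linkTop f (link c s)

  linkVsLink? : ∀ c s c′ s′ f → Dec (LinkVsLink c s c′ s′ f)
  linkVsLink? c s c′ s′ f = linkBelow? f _ (link c s) ×-dec linkAbove? f _ (link c′ s′)

  opaque

    unfolding ⟨_∣_⟩

    linkVsLink : ∀ c s c′ s′ → c ≡ c′ ⊎
      Any (LinkVsLink c s c′ s′) directions ⊎ Any (LinkVsLink c′ s′ c s) directions
    linkVsLink = from-yes (Fin.all? λ c → Fin.all? λ s → Fin.all? λ c′ → Fin.all? λ s′ →
      c Fin.≟ c′ ⊎-dec Any.any? (linkVsLink? c s c′ s′) directions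
                 ⊎-dec Any.any? (linkVsLink? c′ s′ c s) directions)

  blobTop : Pt → Blob → ℤ
  blobTop f b = foldr ℤ._⊔_ ⟨ f ∣ hub b ⟩ (map (λ q → tipValue f (b , q)) (allFin 6))

  -- All values are integers, so raising the threshold by one gives the strict inequality that
  -- `Below` asks for.
  BlobVsBlob : Blob → Blob → Pt → Set
  BlobVsBlob b b′ f = BlobBelow f (blobTop f b) b × BlobAbove f (ℤ.suc (blobTop f b)) b′

  blobVsBlob? : ∀ b b′ f → Dec (BlobVsBlob b b′ f)
  blobVsBlob? b b′ f = blobBelow? f _ b ×-dec blobAbove? f _ b′

  opaque

    unfolding ⟨_∣_⟩

    blobVsBlob : ∀ b b′ → b ≡ b′ ⊎ Any (BlobVsBlob b b′) directions
    blobVsBlob = from-yes (Fin.all? λ b → Fin.all? λ b′ →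
      b Fin.≟ b′ ⊎-dec Any.any? (blobVsBlob? b b′) directions)

  -- Normals, in both signs, of the lines through the centre along the six spikes.
  rays : Blob → List Pt
  rays b = map (turn ∘ spike b) (allFin 6) ++ map (turn ∘ turn ∘ turn ∘ spike b) (allFin 6)
    where
    turn : Pt → Pt
    turn (x , y) = (ℤ.- y) , x

  -- Strictness is asked only at `p`, in keeping with the half-open cells: consecutive sectors share
  -- a spike, which has to be allowed on the line.
  SectorVsSector : Blob → Fin 6 → Fin 6 → Pt → Set
  SectorVsSector b p q f =
      ⟨ f ∣ spike b p ⟩ ℤ.< 0ℤ × ⟨ f ∣ spike b (next p) ⟩ ℤ.≤ 0ℤ
    × 0ℤ ℤ.≤ ⟨ f ∣ spike b q ⟩ × 0ℤ ℤ.≤ ⟨ f ∣ spike b (next q) ⟩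

  sectorVsSector? : ∀ b p q f → Dec (SectorVsSector b p q f)
  sectorVsSector? b p q f = _ ℤ.<? 0ℤ ×-dec _ ℤ.≤? 0ℤ ×-dec 0ℤ ℤ.≤? _ ×-dec 0ℤ ℤ.≤? _

  opaque

    unfolding ⟨_∣_⟩

    sectorVsSector : ∀ b p q → p ≡ q ⊎
      Any (SectorVsSector b p q) (rays b) ⊎ Any (SectorVsSector b q p) (rays b)
    sectorVsSector = from-yes (Fin.all? λ b → Fin.all? λ p → Fin.all? λ q →
      p Fin.≟ q ⊎-dec Any.any? (sectorVsSector? b p q) (rays b)
                ⊎-dec Any.any? (sectorVsSector? b q p) (rays b))

  -- Blobs 0 and 1 are drawn clockwise and their mirror images anticlockwise.
  oriented : Blob → Pt → Pt
  oriented 0F (x , y) = (ℤ.- x) , (ℤ.- y)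
  oriented 1F (x , y) = (ℤ.- x) , (ℤ.- y)
  oriented _  x       = x

  -- Functionals vanishing on the spike of p, on the next spike, and on the
  -- direction of the rim between them.
  left right across inward : Blob → Fin 6 → Pt
  left b p = let (v₁ , v₂) = spike b p in oriented b (v₂ , (ℤ.- v₁))
  right b p = let (w₁ , w₂) = spike b (next p) in oriented b (w₂ , (ℤ.- w₁))
  across b p = let (v₁ , v₂) = spike b p ; (w₁ , w₂) = spike b (next p) in
    oriented b ((w₂ ℤ.- v₂) , (v₁ ℤ.- w₁))
  inward b p = let (x , y) = across b p in (ℤ.- x) , (ℤ.- y)

  Sector : Blob → Fin 6 → Set
  Sector b p =
      ⟨ left   b p ∣ spike b p ⟩ ≡ 0ℤ × ⟨ left b p ∣ spike b (next p) ⟩ ℤ.< 0ℤ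
    × 0ℤ ℤ.< ⟨ right b p ∣ spike b p ⟩ × ⟨ right b p ∣ spike b (next p) ⟩ ≡ 0ℤ
    × (0ℤ ℤ.< ⟨ across b p ∣ spike b p ⟩
       × ⟨ across b p ∣ spike b (next p) ⟩ ≡ ⟨ across b p ∣ spike b p ⟩)
    × (⟨ inward b p ∣ spike b p ⟩ ℤ.< 0ℤ
       × ⟨ inward b p ∣ spike b (next p) ⟩ ≡ ⟨ inward b p ∣ spike b p ⟩)

  sector? : ∀ b p → Dec (Sector b p)
  sector? b p = _ ℤ.≟ _ ×-dec _ ℤ.<? _ ×-dec _ ℤ.<? _ ×-dec _ ℤ.≟ _
    ×-dec (_ ℤ.<? _ ×-dec _ ℤ.≟ _) ×-dec (_ ℤ.<? _ ×-dec _ ℤ.≟ _)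

  opaque

    unfolding ⟨_∣_⟩

    sector : ∀ b p → Sector b p
    sector = from-yes (Fin.all? λ b → Fin.all? (sector? b))

-- Separating lines for all vertices and edges, at every height and scale.

module Items where

  open PlaneSegments
  open Blobs
  open import Data.Fin.Base using (Fin; suc)
  open import Data.Fin.Patterns
  import Data.Fin.Properties as Fin
  open import Data.Integer.Base as ℤ using (ℤ; +_; 0ℤ; +≤+; +<+)
  import Data.Integer.Properties as ℤ
  import Data.Integer.Solver as ℤ-Solver
  open import Data.List.Base using (map)
  open import Data.List.Relation.Unary.Any using (Any)
  import Data.List.Relation.Unary.Any as Any
  open import Data.Nat.Base as ℕ using (ℕ; suc; _≤_; _<_; z≤n; s≤s; _∸_)
  import Data.Nat.Properties as ℕ
  open import Data.Product.Base using (_×_; _,_; proj₁; proj₂; uncurry)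
  open import Data.Sum.Base using (_⊎_; inj₁; inj₂)
  open import Data.Unit.Base using (⊤)
  open import Function.Base using (id)
  open import Relation.Binary.PropositionalEquality
  open import Relation.Nullary.Decidable using (yes; no)
  open import Relation.Nullary.Negation using (contradiction)
  open import Relation.Binary.Definitions using (tri<; tri≈; tri>)

  data Kind : Set where
    point rim spoke diag₁ diag₂ : Kind

  srcPos tgtPos : Kind → Fin 6 → Fin 6
  srcPos diag₂ = next
  srcPos _     = id
  tgtPos rim   = next
  tgtPos diag₁ = next
  tgtPos _     = id

  tgtHeight : Kind → ℕ → ℕ
  tgtHeight point = suc
  tgtHeight rim   = suc
  tgtHeight _     = id

  -- cell b k p κ lies in the quadrangle of blob b between the hexagons k and 1 + k
  -- and between the spikes p and next p, where hexagon 0 is the centre.  It is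
  -- half-open: it contains the spike and the corner at p but not those at next p,
  -- and the outer rim but not the inner one.
  data Item : Set where
    centreᵢ : Blob → Item
    cell    : Blob → ℕ → Fin 6 → Kind → Item
    bridge  : Fin 6 → Fin 2 → Item

  data Diagonal : Kind → Set where
    diag₁ : Diagonal diag₁
    diag₂ : Diagonal diag₂

  -- The drawing of a blob with R nested hexagons; the whole picture is scaled
  -- by R so that the outermost hexagon always has scale 1.
  module Picture (R : ℕ) {{R≢0 : ℕ.NonZero R}} where

    opaque

      loc : Blob → ℕ → Fin 6 → Pt
      loc b h q = let (c₁ , c₂) = hub b ; (v₁ , v₂) = spike b q in
        (+ R ℤ.* c₁ ℤ.+ + h ℤ.* v₁) , (+ R ℤ.* c₂ ℤ.+ + h ℤ.* v₂)

    Valid : Item → Set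
    Valid (centreᵢ b)    = ⊤
    Valid (cell b k p κ) = k < R × (Diagonal κ → 1 ≤ k)
    Valid (bridge c s)   = ⊤

    ends : Item → Pt × Pt
    ends (centreᵢ b)    = loc b 0 0F , loc b 0 0F
    ends (cell b k p κ) = loc b (suc k) (srcPos κ p) , loc b (tgtHeight κ k) (tgtPos κ p)
    ends (bridge c s)   = let ((b , p) , (b′ , q)) = link c s in loc b R p , loc b′ R q

    weight : Pt → Blob → ℕ → Fin 6 → ℤ
    weight f b h q = + h ℤ.* ⟨ f ∣ spike b q ⟩

    opaque

      unfolding ⟨_∣_⟩ loc

      ⟨∣⟩-loc : ∀ f b h q → ⟨ f ∣ loc b h q ⟩ ≡ + R ℤ.* ⟨ f ∣ hub b ⟩ ℤ.+ weight f b h q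
      ⟨∣⟩-loc (a₁ , a₂) b h q = lemma a₁ a₂ (+ R) (+ h)
        (proj₁ (hub b)) (proj₂ (hub b)) (proj₁ (spike b q)) (proj₂ (spike b q))
        where
        open ℤ-Solver.+-*-Solver
        lemma : ∀ a₁ a₂ r h c₁ c₂ v₁ v₂ →
            a₁ ℤ.* (r ℤ.* c₁ ℤ.+ h ℤ.* v₁) ℤ.+ a₂ ℤ.* (r ℤ.* c₂ ℤ.+ h ℤ.* v₂)
          ≡ r ℤ.* (a₁ ℤ.* c₁ ℤ.+ a₂ ℤ.* c₂) ℤ.+ h ℤ.* (a₁ ℤ.* v₁ ℤ.+ a₂ ℤ.* v₂)
        lemma = solve 8 (λ a₁ a₂ r h c₁ c₂ v₁ v₂ →
            a₁ :* (r :* c₁ :+ h :* v₁) :+ a₂ :* (r :* c₂ :+ h :* v₂)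
          := r :* (a₁ :* c₁ :+ a₂ :* c₂) :+ h :* (a₁ :* v₁ :+ a₂ :* v₂)) refl

    Apart : Item → Item → Set
    Apart i j = Below (ends i) (ends j) ⊎ Below (ends j) (ends i)

    -- Up to the scale `R`, a corner at height `h` is the convex combination of the hub and the tip
    -- with weights `R ∸ h` and `h`. A half-plane that contains the hub and the six tips therefore
    -- contains the whole blob.
    ⟨∣⟩-hull : ∀ f b {h} q → h ≤ R →
      ⟨ f ∣ loc b h q ⟩ ≡ + (R ∸ h) ℤ.* ⟨ f ∣ hub b ⟩ ℤ.+ + h ℤ.* tipValue f (b , q)
    ⟨∣⟩-hull f b {h} q h≤R = begin
      ⟨ f ∣ loc b h q ⟩                                  ≡⟨ ⟨∣⟩-loc f b h q ⟩
      + R ℤ.* c ℤ.+ + h ℤ.* v                            ≡⟨ cong (λ r → + r ℤ.* c ℤ.+ + h ℤ.* v) (ℕ.m∸n+n≡m h≤R) ⟨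
      (+ (R ∸ h) ℤ.+ + h) ℤ.* c ℤ.+ + h ℤ.* v            ≡⟨ lemma (+ (R ∸ h)) (+ h) c v ⟩
      + (R ∸ h) ℤ.* c ℤ.+ + h ℤ.* (c ℤ.+ v)              ∎
      where
      open ≡-Reasoning
      open ℤ-Solver.+-*-Solver
      c = ⟨ f ∣ hub b ⟩
      v = ⟨ f ∣ spike b q ⟩
      lemma : ∀ s h c v → (s ℤ.+ h) ℤ.* c ℤ.+ h ℤ.* v ≡ s ℤ.* c ℤ.+ h ℤ.* (c ℤ.+ v)
      lemma = solve 4 (λ s h c v → (s :+ h) :* c :+ h :* v := s :* c :+ h :* (c :+ v)) refl

    split-R : ∀ g {h} → h ≤ R → + (R ∸ h) ℤ.* g ℤ.+ + h ℤ.* g ≡ + R ℤ.* g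
    split-R g {h} h≤R = trans (sym (ℤ.*-distribʳ-+ g (+ (R ∸ h)) (+ h)))
      (cong (λ r → + r ℤ.* g) (ℕ.m∸n+n≡m h≤R))

    hull-below : ∀ {f g b h} q → BlobBelow f g b → h ≤ R → ⟨ f ∣ loc b h q ⟩ ℤ.≤ + R ℤ.* g
    hull-below {f} {g} {b} {h} q (c≤ , t≤) h≤R = subst₂ ℤ._≤_ (sym (⟨∣⟩-hull f b q h≤R)) (split-R g h≤R)
      (ℤ.+-mono-≤ (ℤ.*-monoˡ-≤-nonNeg (+ (R ∸ h)) c≤) (ℤ.*-monoˡ-≤-nonNeg (+ h) (t≤ q)))

    hull-above : ∀ {f g b h} q → BlobAbove f g b → h ≤ R → + R ℤ.* g ℤ.≤ ⟨ f ∣ loc b h q ⟩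
    hull-above {f} {g} {b} {h} q (c≥ , t≥) h≤R = subst₂ ℤ._≤_ (split-R g h≤R) (sym (⟨∣⟩-hull f b q h≤R))
      (ℤ.+-mono-≤ (ℤ.*-monoˡ-≤-nonNeg (+ (R ∸ h)) c≥) (ℤ.*-monoˡ-≤-nonNeg (+ h) (t≥ q)))

    ⟨∣⟩-tip : ∀ f b q → ⟨ f ∣ loc b R q ⟩ ≡ + R ℤ.* tipValue f (b , q)
    ⟨∣⟩-tip f b q = trans (⟨∣⟩-loc f b R q) (sym (ℤ.*-distribˡ-+ (+ R) ⟨ f ∣ hub b ⟩ ⟨ f ∣ spike b q ⟩))

    data InBlob (b : Blob) : Pt × Pt → Set where
      inBlob : ∀ {h h′} q q′ → h ≤ R → h′ ≤ R → InBlob b (loc b h q , loc b h′ q′)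

    cell-inBlob : ∀ {b k p} κ → k < R → InBlob b (ends (cell b k p κ))
    cell-inBlob point k<R = inBlob _ _ k<R k<R
    cell-inBlob rim   k<R = inBlob _ _ k<R k<R
    cell-inBlob spoke k<R = inBlob _ _ k<R (ℕ.<⇒≤ k<R)
    cell-inBlob diag₁ k<R = inBlob _ _ k<R (ℕ.<⇒≤ k<R)
    cell-inBlob diag₂ k<R = inBlob _ _ k<R (ℕ.<⇒≤ k<R)

    centre-inBlob : ∀ b → InBlob b (ends (centreᵢ b))
    centre-inBlob b = inBlob _ _ z≤n z≤n

    link-below : ∀ {f g} c s → LinkBelow f g (link c s) →
      ∀ {B} → + R ℤ.* g ℤ.≤ ⟨ f ∣ proj₁ B ⟩ → + R ℤ.* g ℤ.≤ ⟨ f ∣ proj₂ B ⟩ →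
      Below (ends (bridge c s)) B
    link-below {f} {g} c s (s≤ , t≤ , strict) src≥ tgt≥ = record
      { f = f ; γ = + R ℤ.* g
      ; src≤ = tip≤ _ _ s≤ ; tgt≤ = tip≤ _ _ t≤
      ; strict = Data.Sum.Base.map (tip< _ _) (tip< _ _) strict
      ; src≥ = src≥ ; tgt≥ = tgt≥
      }
      where
      tip≤ : ∀ b q → tipValue f (b , q) ℤ.≤ g → ⟨ f ∣ loc b R q ⟩ ℤ.≤ + R ℤ.* g
      tip≤ b q t≤ = subst (ℤ._≤ + R ℤ.* g) (sym (⟨∣⟩-tip f b q)) (ℤ.*-monoˡ-≤-nonNeg (+ R) t≤)
      tip< : ∀ b q → tipValue f (b , q) ℤ.< g → ⟨ f ∣ loc b R q ⟩ ℤ.< + R ℤ.* g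
      tip< b q t< = subst (ℤ._< + R ℤ.* g) (sym (⟨∣⟩-tip f b q))
          (ℤ.*-monoˡ-<-pos (+ R) {{ℤ.positive (+<+ (ℕ.>-nonZero⁻¹ R))}} t<)

    link-blob : ∀ c s b {A} → InBlob b A → Below (ends (bridge c s)) A
    link-blob c s b (inBlob q q′ h≤ h′≤) with Any.satisfied (linkVsBlob c s b)
    ... | f , link≤ , blob≥ = link-below c s link≤ (hull-above q blob≥ h≤) (hull-above q′ blob≥ h′≤)

    one-way : ∀ c s c′ s′ → Any (LinkVsLink c s c′ s′) directions →
      Below (ends (bridge c s)) (ends (bridge c′ s′))
    one-way c s c′ s′ any with Any.satisfied any
    ... | f , below-c , (s≥ , t≥) = link-below c s below-c (tip≥ _ _ _ s≥) (tip≥ _ _ _ t≥)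
      where
      tip≥ : ∀ g b q → g ℤ.≤ tipValue f (b , q) → + R ℤ.* g ℤ.≤ ⟨ f ∣ loc b R q ⟩
      tip≥ g b q t≥ = subst (+ R ℤ.* g ℤ.≤_) (sym (⟨∣⟩-tip f b q)) (ℤ.*-monoˡ-≤-nonNeg (+ R) t≥)

    link-link : ∀ {c c′} s s′ → c ≢ c′ → Apart (bridge c s) (bridge c′ s′)
    link-link {c} {c′} s s′ c≢c′ with linkVsLink c s c′ s′
    ... | inj₁ c≡c′      = contradiction c≡c′ c≢c′
    ... | inj₂ (inj₁ lt) = inj₁ (one-way c s c′ s′ lt)
    ... | inj₂ (inj₂ gt) = inj₂ (one-way c′ s′ c s gt)

    blob-blob : ∀ {b b′ A A′} → b ≢ b′ → InBlob b A → InBlob b′ A′ → Below A A′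
    blob-blob {b} {b′} b≢b′ (inBlob q₁ q₂ h₁ h₂) (inBlob q₃ q₄ h₃ h₄) with blobVsBlob b b′
    ... | inj₁ b≡b′ = contradiction b≡b′ b≢b′
    ... | inj₂ any with Any.satisfied any
    ...   | f , below-b , above-b′ = record
      { f = f ; γ = + R ℤ.* ℤ.suc g
      ; src≤ = ℤ.<⇒≤ (strict< q₁ h₁) ; tgt≤ = ℤ.<⇒≤ (strict< q₂ h₂)
      ; strict = inj₁ (strict< q₁ h₁)
      ; src≥ = hull-above q₃ above-b′ h₃ ; tgt≥ = hull-above q₄ above-b′ h₄
      }
      where
      g = blobTop f b
      strict< : ∀ {h} q → h ≤ R → ⟨ f ∣ loc b h q ⟩ ℤ.< + R ℤ.* ℤ.suc g
      strict< q h≤ = ℤ.≤-<-trans (hull-below q below-b h≤)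
        (ℤ.*-monoˡ-<-pos (+ R) {{ℤ.positive (+<+ (ℕ.>-nonZero⁻¹ R))}} (ℤ.suc[i]≤j⇒i<j ℤ.≤-refl))

    module _ (b : Blob) where

      at : ℕ × Fin 6 → Pt
      at (h , q) = loc b h q

      -- The hub contributes the same amount to every point of its blob, so only heights and spikes
      -- matter for separation inside it.
      below-in-blob : ∀ f γ s t u v →
        uncurry (weight f b) s ℤ.≤ γ → uncurry (weight f b) t ℤ.≤ γ →
        uncurry (weight f b) s ℤ.< γ ⊎ uncurry (weight f b) t ℤ.< γ →
        γ ℤ.≤ uncurry (weight f b) u → γ ℤ.≤ uncurry (weight f b) v →
        Below (at s , at t) (at u , at v)
      below-in-blob f γ s t u v s≤ t≤ strict u≥ v≥ = record
        { f = f ; γ = c ℤ.+ γ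
        ; src≤ = subst (ℤ._≤ c ℤ.+ γ) (sym (value s)) (ℤ.+-monoʳ-≤ c s≤)
        ; tgt≤ = subst (ℤ._≤ c ℤ.+ γ) (sym (value t)) (ℤ.+-monoʳ-≤ c t≤)
        ; strict = Data.Sum.Base.map
            (λ s< → subst (ℤ._< c ℤ.+ γ) (sym (value s)) (ℤ.+-monoʳ-< c s<))
            (λ t< → subst (ℤ._< c ℤ.+ γ) (sym (value t)) (ℤ.+-monoʳ-< c t<))
            strict
        ; src≥ = subst (c ℤ.+ γ ℤ.≤_) (sym (value u)) (ℤ.+-monoʳ-≤ c u≥)
        ; tgt≥ = subst (c ℤ.+ γ ℤ.≤_) (sym (value v)) (ℤ.+-monoʳ-≤ c v≥)
        }
        where
        c = + R ℤ.* ⟨ f ∣ hub b ⟩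
        value : ∀ s → ⟨ f ∣ at s ⟩ ≡ c ℤ.+ uncurry (weight f b) s
        value (h , q) = ⟨∣⟩-loc f b h q

      srcS tgtS : ℕ → Fin 6 → Kind → ℕ × Fin 6
      srcS k p κ = suc k , srcPos κ p
      tgtS k p κ = tgtHeight κ k , tgtPos κ p

      *≤0 : ∀ h {g} → g ℤ.≤ 0ℤ → + h ℤ.* g ℤ.≤ 0ℤ
      *≤0 h {g} g≤0 = subst (+ h ℤ.* g ℤ.≤_) (ℤ.*-zeroʳ (+ h)) (ℤ.*-monoˡ-≤-nonNeg (+ h) g≤0)

      *≥0 : ∀ h {g} → 0ℤ ℤ.≤ g → 0ℤ ℤ.≤ + h ℤ.* g
      *≥0 h {g} g≥0 = subst (ℤ._≤ + h ℤ.* g) (ℤ.*-zeroʳ (+ h)) (ℤ.*-monoˡ-≤-nonNeg (+ h) g≥0)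

      *<0 : ∀ h {g} → 1 ≤ h → g ℤ.< 0ℤ → + h ℤ.* g ℤ.< 0ℤ
      *<0 (suc h) {g} _ g<0 = subst (+ suc h ℤ.* g ℤ.<_) (ℤ.*-zeroʳ (+ suc h)) (ℤ.*-monoˡ-<-pos (+ suc h) g<0)

      sector-sector : ∀ {k k′ p q} κ κ′ → (Diagonal κ → 1 ≤ k) →
        Any (SectorVsSector b p q) (rays b) → Below (ends (cell b k p κ)) (ends (cell b k′ q κ′))
      sector-sector {k} {k′} {p} {q} κ κ′ diag any with Any.satisfied any
      ... | f , p<0 , p′≤0 , q≥0 , q′≥0 = below-in-blob f 0ℤ
        (srcS k p κ) (tgtS k p κ) (srcS k′ q κ′) (tgtS k′ q κ′)
        (*≤0 (suc k) (src κ)) (*≤0 (tgtHeight κ k) (tgt κ)) (strict κ diag)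
        (*≥0 (suc k′) (src′ κ′)) (*≥0 (tgtHeight κ′ k′) (tgt′ κ′))
        where
        p≤0 = ℤ.<⇒≤ p<0
        src : ∀ κ → ⟨ f ∣ spike b (srcPos κ p) ⟩ ℤ.≤ 0ℤ
        src point = p≤0
        src rim   = p≤0
        src spoke = p≤0
        src diag₁ = p≤0
        src diag₂ = p′≤0
        tgt : ∀ κ → ⟨ f ∣ spike b (tgtPos κ p) ⟩ ℤ.≤ 0ℤ
        tgt point = p≤0
        tgt rim   = p′≤0
        tgt spoke = p≤0
        tgt diag₁ = p′≤0
        tgt diag₂ = p≤0
        src′ : ∀ κ → 0ℤ ℤ.≤ ⟨ f ∣ spike b (srcPos κ q) ⟩
        src′ point = q≥0
        src′ rim   = q≥0
        src′ spoke = q≥0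
        src′ diag₁ = q≥0
        src′ diag₂ = q′≥0
        tgt′ : ∀ κ → 0ℤ ℤ.≤ ⟨ f ∣ spike b (tgtPos κ q) ⟩
        tgt′ point = q≥0
        tgt′ rim   = q′≥0
        tgt′ spoke = q≥0
        tgt′ diag₁ = q′≥0
        tgt′ diag₂ = q≥0
        strict : ∀ κ → (Diagonal κ → 1 ≤ k) →
          weight f b (suc k) (srcPos κ p) ℤ.< 0ℤ ⊎ weight f b (tgtHeight κ k) (tgtPos κ p) ℤ.< 0ℤ
        strict point _ = inj₁ (*<0 (suc k) (s≤s z≤n) p<0)
        strict rim   _ = inj₁ (*<0 (suc k) (s≤s z≤n) p<0)
        strict spoke _ = inj₁ (*<0 (suc k) (s≤s z≤n) p<0)
        strict diag₁ _ = inj₁ (*<0 (suc k) (s≤s z≤n) p<0)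
        -- Only the inner end of `diag₂` lies on the spike at `p`; for `k` equal to 0 it would be
        -- the centre, which is on the line.
        strict diag₂ d = inj₂ (*<0 k (d diag₂) p<0)

      module _ {p : Fin 6} where

        private
          f = inward b p
          g = ⟨ f ∣ spike b p ⟩
          g<0 = proj₁ (proj₂ (proj₂ (proj₂ (proj₂ (proj₂ (sector b p))))))
          g′≡g = proj₂ (proj₂ (proj₂ (proj₂ (proj₂ (proj₂ (sector b p))))))

        layer : ∀ h κ → weight f b h (srcPos κ p) ≡ + h ℤ.* g × weight f b h (tgtPos κ p) ≡ + h ℤ.* g
        layer h point = refl , refl
        layer h rim   = refl , cong (+ h ℤ.*_) g′≡g
        layer h spoke = refl , refl
        layer h diag₁ = refl , cong (+ h ℤ.*_) g′≡g
        layer h diag₂ = cong (+ h ℤ.*_) g′≡g , refl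

        antitone : ∀ {h h′} → h ≤ h′ → + h′ ℤ.* g ℤ.≤ + h ℤ.* g
        antitone h≤h′ = ℤ.*-monoʳ-≤-nonPos g {{ℤ.nonPositive (ℤ.<⇒≤ g<0)}} (+≤+ h≤h′)

        antitone-< : ∀ {h h′} → h < h′ → + h′ ℤ.* g ℤ.< + h ℤ.* g
        antitone-< h<h′ = ℤ.*-monoʳ-<-neg g {{ℤ.negative g<0}} (+<+ h<h′)

        tgtHeight-≥ : ∀ κ k → k ≤ tgtHeight κ k
        tgtHeight-≥ point k = ℕ.n≤1+n k
        tgtHeight-≥ rim   k = ℕ.n≤1+n k
        tgtHeight-≥ spoke k = ℕ.≤-refl
        tgtHeight-≥ diag₁ k = ℕ.≤-refl
        tgtHeight-≥ diag₂ k = ℕ.≤-refl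

        tgtHeight-≤ : ∀ κ k → tgtHeight κ k ≤ suc k
        tgtHeight-≤ point k = ℕ.≤-refl
        tgtHeight-≤ rim   k = ℕ.≤-refl
        tgtHeight-≤ spoke k = ℕ.n≤1+n k
        tgtHeight-≤ diag₁ k = ℕ.n≤1+n k
        tgtHeight-≤ diag₂ k = ℕ.n≤1+n k

        -- The line carries the side of hexagon `k` in this sector. The source of the item lies on
        -- hexagon 1 + `k`, strictly beyond it, and the target on one of the two hexagons.
        outer-below : ∀ k κ u v → + k ℤ.* g ℤ.≤ uncurry (weight f b) u → + k ℤ.* g ℤ.≤ uncurry (weight f b) v →
          Below (ends (cell b k p κ)) (at u , at v)
        outer-below k κ u v u≥ v≥ = below-in-blob f (+ k ℤ.* g) (srcS k p κ) (tgtS k p κ) u v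
          (ℤ.<⇒≤ src<)
          (subst (ℤ._≤ + k ℤ.* g) (sym (proj₂ (layer (tgtHeight κ k) κ))) (antitone (tgtHeight-≥ κ k)))
          (inj₁ src<) u≥ v≥
          where
          src< : weight f b (suc k) (srcPos κ p) ℤ.< + k ℤ.* g
          src< = subst (ℤ._< + k ℤ.* g) (sym (proj₁ (layer (suc k) κ))) (antitone-< (ℕ.n<1+n k))

        outer-inner : ∀ {k k′} κ κ′ → k < k′ → Below (ends (cell b k′ p κ′)) (ends (cell b k p κ))
        outer-inner {k} {k′} κ κ′ k<k′ = outer-below k′ κ′ (srcS k p κ) (tgtS k p κ)
          (subst (+ k′ ℤ.* g ℤ.≤_) (sym (proj₁ (layer (suc k) κ))) (antitone k<k′))
          (subst (+ k′ ℤ.* g ℤ.≤_) (sym (proj₂ (layer (tgtHeight κ k) κ)))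
            (antitone (ℕ.≤-trans (tgtHeight-≤ κ k) k<k′)))

        cell-centre : ∀ k κ → Below (ends (cell b k p κ)) (ends (centreᵢ b))
        cell-centre k κ = outer-below k κ (0 , 0F) (0 , 0F) (*≤0 k (ℤ.<⇒≤ g<0)) (*≤0 k (ℤ.<⇒≤ g<0))

        module _ {k : ℕ} where

          private
            l  = left b p
            r  = right b p
            a  = across b p
            l≡0 = proj₁ (sector b p)
            l<0 = proj₁ (proj₂ (sector b p))
            r>0 = proj₁ (proj₂ (proj₂ (sector b p)))
            r≡0 = proj₁ (proj₂ (proj₂ (proj₂ (sector b p))))
            a>0 = proj₁ (proj₁ (proj₂ (proj₂ (proj₂ (proj₂ (sector b p))))))
            a≡a = proj₂ (proj₁ (proj₂ (proj₂ (proj₂ (proj₂ (sector b p))))))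

          *≡0 : ∀ h {x} → x ≡ 0ℤ → + h ℤ.* x ≡ 0ℤ
          *≡0 h refl = ℤ.*-zeroʳ (+ h)

          grow : ∀ {x} → 0ℤ ℤ.< x → + k ℤ.* x ℤ.< + suc k ℤ.* x
          grow {x} x>0 = ℤ.*-monoʳ-<-pos x {{ℤ.positive x>0}} (+<+ (ℕ.n<1+n k))

          0<suc* : ∀ {x} → 0ℤ ℤ.< x → 0ℤ ℤ.< + suc k ℤ.* x
          0<suc* {x} x>0 = subst (ℤ._< + suc k ℤ.* x) (ℤ.*-zeroˡ x) 
              (ℤ.*-monoʳ-<-pos x {{ℤ.positive x>0}} {0ℤ} {+ suc k} (+<+ (s≤s z≤n)))

          -- Among the corners of the quadrangle, `right` is largest at the outer corner on the
          -- spike of `p` and nowhere else, so the line through that corner serves.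
          below-point-cell : ∀ κ → κ ≢ point → Below (ends (cell b k p κ)) (ends (cell b k p point))
          below-point-cell κ κ≢ = below-in-blob r γ (srcS k p κ) (tgtS k p κ) _ _
            (src κ) (ℤ.<⇒≤ (tgt< κ κ≢)) (inj₂ (tgt< κ κ≢)) ℤ.≤-refl ℤ.≤-refl
            where
            γ = weight r b (suc k) p
            zero< : ∀ h {x} → x ≡ 0ℤ → + h ℤ.* x ℤ.< γ
            zero< h x≡0 = subst (ℤ._< γ) (sym (*≡0 h x≡0)) (0<suc* r>0)
            src : ∀ κ → weight r b (suc k) (srcPos κ p) ℤ.≤ γ
            src point = ℤ.≤-refl
            src rim   = ℤ.≤-refl
            src spoke = ℤ.≤-refl
            src diag₁ = ℤ.≤-refl
            src diag₂ = ℤ.<⇒≤ (zero< (suc k) r≡0)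
            tgt< : ∀ κ → κ ≢ point → weight r b (tgtHeight κ k) (tgtPos κ p) ℤ.< γ
            tgt< point κ≢ = contradiction refl κ≢
            tgt< rim   _  = zero< (suc k) r≡0
            tgt< spoke _  = grow r>0
            tgt< diag₁ _  = zero< k r≡0
            tgt< diag₂ _  = grow r>0

          data Inwards : Kind → Set where
            spoke : Inwards spoke
            diag₁ : Inwards diag₁
            diag₂ : Inwards diag₂

          -- `across` is largest on the outer rim, and spokes and diagonals touch that rim only with
          -- their source.
          below-rim : ∀ {κ} → Inwards κ → Below (ends (cell b k p κ)) (ends (cell b k p rim))
          below-rim {κ} inw = below-in-blob a γ (srcS k p κ) (tgtS k p κ) _ _
            (src inw) (ℤ.<⇒≤ (tgt< inw)) (inj₂ (tgt< inw)) ℤ.≤-refl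
            (ℤ.≤-reflexive (cong (+ suc k ℤ.*_) (sym a≡a)))
            where
            γ = weight a b (suc k) p
            src : ∀ {κ} → Inwards κ → weight a b (suc k) (srcPos κ p) ℤ.≤ γ
            src spoke = ℤ.≤-refl
            src diag₁ = ℤ.≤-refl
            src diag₂ = ℤ.≤-reflexive (cong (+ suc k ℤ.*_) a≡a)
            tgt< : ∀ {κ} → Inwards κ → weight a b (tgtHeight κ k) (tgtPos κ p) ℤ.< γ
            tgt< spoke = grow a>0
            tgt< diag₁ = subst (ℤ._< γ) (cong (+ k ℤ.*_) (sym a≡a)) (grow a>0)
            tgt< diag₂ = grow a>0

          -- A diagonal has one end on the spike of `p` and the other strictly beside it. For
          -- `diag₁` the latter has height `k`, hence `1 ≤ k`.
          below-spoke : ∀ {κ} → Diagonal κ → 1 ≤ k → Below (ends (cell b k p κ)) (ends (cell b k p spoke))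
          below-spoke {κ} d 1≤k = below-in-blob l 0ℤ (srcS k p κ) (tgtS k p κ) _ _
            (src d) (tgt d) (strict d) (ℤ.≤-reflexive (sym (*≡0 (suc k) l≡0))) (ℤ.≤-reflexive (sym (*≡0 k l≡0)))
            where
            src : ∀ {κ} → Diagonal κ → weight l b (suc k) (srcPos κ p) ℤ.≤ 0ℤ
            src diag₁ = ℤ.≤-reflexive (*≡0 (suc k) l≡0)
            src diag₂ = *≤0 (suc k) (ℤ.<⇒≤ l<0)
            tgt : ∀ {κ} → Diagonal κ → weight l b (tgtHeight κ k) (tgtPos κ p) ℤ.≤ 0ℤ
            tgt diag₁ = *≤0 k (ℤ.<⇒≤ l<0)
            tgt diag₂ = ℤ.≤-reflexive (*≡0 k l≡0)
            strict : ∀ {κ} → Diagonal κ →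
              weight l b (suc k) (srcPos κ p) ℤ.< 0ℤ ⊎ weight l b (tgtHeight κ k) (tgtPos κ p) ℤ.< 0ℤ
            strict diag₁ = inj₂ (*<0 k 1≤k l<0)
            strict diag₂ = inj₁ (*<0 (suc k) (s≤s z≤n) l<0)

    data Crossing : Item → Item → Set where
      diagonals₁ : ∀ {b k p} → Crossing (cell b k p diag₁) (cell b k p diag₂)
      diagonals₂ : ∀ {b k p} → Crossing (cell b k p diag₂) (cell b k p diag₁)
      bridges₁   : ∀ {c} → Crossing (bridge c 0F) (bridge c 1F)
      bridges₂   : ∀ {c} → Crossing (bridge c 1F) (bridge c 0F)

    data Compared : Item → Item → Set where
      same  : ∀ {i} → Compared i i
      apart : ∀ {i j} → Apart i j → Compared i j
      cross : ∀ {i j} → Crossing i j → Compared i j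

    compare-quad : ∀ {b k p} κ κ′ → (Diagonal κ → 1 ≤ k) → (Diagonal κ′ → 1 ≤ k) →
      Compared (cell b k p κ) (cell b k p κ′)
    compare-quad point point d d′ = same
    compare-quad rim   rim   d d′ = same
    compare-quad spoke spoke d d′ = same
    compare-quad diag₁ diag₁ d d′ = same
    compare-quad diag₂ diag₂ d d′ = same
    compare-quad diag₁ diag₂ d d′ = cross diagonals₁
    compare-quad diag₂ diag₁ d d′ = cross diagonals₂
    compare-quad {b} point rim   d d′ = apart (inj₂ (below-point-cell b rim   λ ()))
    compare-quad {b} point spoke d d′ = apart (inj₂ (below-point-cell b spoke λ ()))
    compare-quad {b} point diag₁ d d′ = apart (inj₂ (below-point-cell b diag₁ λ ()))
    compare-quad {b} point diag₂ d d′ = apart (inj₂ (below-point-cell b diag₂ λ ()))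
    compare-quad {b} rim   point d d′ = apart (inj₁ (below-point-cell b rim   λ ()))
    compare-quad {b} spoke point d d′ = apart (inj₁ (below-point-cell b spoke λ ()))
    compare-quad {b} diag₁ point d d′ = apart (inj₁ (below-point-cell b diag₁ λ ()))
    compare-quad {b} diag₂ point d d′ = apart (inj₁ (below-point-cell b diag₂ λ ()))
    compare-quad {b} rim   spoke d d′ = apart (inj₂ (below-rim b spoke))
    compare-quad {b} rim   diag₁ d d′ = apart (inj₂ (below-rim b diag₁))
    compare-quad {b} rim   diag₂ d d′ = apart (inj₂ (below-rim b diag₂))
    compare-quad {b} spoke rim   d d′ = apart (inj₁ (below-rim b spoke))
    compare-quad {b} diag₁ rim   d d′ = apart (inj₁ (below-rim b diag₁))
    compare-quad {b} diag₂ rim   d d′ = apart (inj₁ (below-rim b diag₂))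
    compare-quad {b} spoke diag₁ d d′ = apart (inj₂ (below-spoke b diag₁ (d′ diag₁)))
    compare-quad {b} spoke diag₂ d d′ = apart (inj₂ (below-spoke b diag₂ (d′ diag₂)))
    compare-quad {b} diag₁ spoke d d′ = apart (inj₁ (below-spoke b diag₁ (d diag₁)))
    compare-quad {b} diag₂ spoke d d′ = apart (inj₁ (below-spoke b diag₂ (d diag₂)))

    compare : ∀ i j → Valid i → Valid j → Compared i j
    compare (centreᵢ b) (centreᵢ b′) _ _ with b Fin.≟ b′
    ... | yes refl = same
    ... | no  b≢b′ = apart (inj₁ (blob-blob b≢b′ (centre-inBlob b) (centre-inBlob b′)))
    compare (centreᵢ b) (cell b′ k p κ) _ (k<R , _) with b Fin.≟ b′
    ... | yes refl = apart (inj₂ (cell-centre b k κ))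
    ... | no  b≢b′ = apart (inj₁ (blob-blob b≢b′ (centre-inBlob b) (cell-inBlob κ k<R)))
    compare (cell b k p κ) (centreᵢ b′) (k<R , _) _ with b Fin.≟ b′
    ... | yes refl = apart (inj₁ (cell-centre b k κ))
    ... | no  b≢b′ = apart (inj₁ (blob-blob b≢b′ (cell-inBlob κ k<R) (centre-inBlob b′)))
    compare (bridge c s) (centreᵢ b) _ _ = apart (inj₁ (link-blob c s b (centre-inBlob b)))
    compare (centreᵢ b) (bridge c s) _ _ = apart (inj₂ (link-blob c s b (centre-inBlob b)))
    compare (bridge c s) (cell b k p κ) _ (k<R , _) = apart (inj₁ (link-blob c s b (cell-inBlob κ k<R)))
    compare (cell b k p κ) (bridge c s) (k<R , _) _ = apart (inj₂ (link-blob c s b (cell-inBlob κ k<R)))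
    compare (bridge c s) (bridge c′ s′) _ _ with c Fin.≟ c′
    ... | no  c≢c′ = apart (link-link s s′ c≢c′)
    compare (bridge c 0F) (bridge c 0F) _ _ | yes refl = same
    compare (bridge c 0F) (bridge c 1F) _ _ | yes refl = cross bridges₁
    compare (bridge c 1F) (bridge c 0F) _ _ | yes refl = cross bridges₂
    compare (bridge c 1F) (bridge c 1F) _ _ | yes refl = same
    compare (cell b k p κ) (cell b′ k′ q κ′) (k<R , d) (k′<R , d′) with b Fin.≟ b′
    ... | no b≢b′ = apart (inj₁ (blob-blob b≢b′ (cell-inBlob κ k<R) (cell-inBlob κ′ k′<R)))
    ... | yes refl with sectorVsSector b p q
    ...   | inj₂ (inj₁ lt) = apart (inj₁ (sector-sector b κ κ′ d lt))
    ...   | inj₂ (inj₂ gt) = apart (inj₂ (sector-sector b κ′ κ d′ gt))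
    ...   | inj₁ refl with ℕ.<-cmp k k′
    ...     | tri< k<k′ _ _ = apart (inj₂ (outer-inner b κ κ′ k<k′))
    ...     | tri> _ _ k′<k = apart (inj₁ (outer-inner b κ′ κ k′<k))
    ...     | tri≈ _ refl _ = compare-quad κ κ′ d d′

-- Crossing segments are not parallel.

module CrossingItems where

  open PlaneSegments
  open Blobs
  open Items
  open import Data.Fin.Base as Fin using (Fin; suc)
  open import Data.Fin.Patterns
  import Data.Fin.Properties as Fin
  open import Data.Integer.Base as ℤ using (ℤ; +_; 0ℤ; 1ℤ)
  import Data.Integer.Properties as ℤ
  import Data.Integer.Solver as ℤ-Solver
  open import Data.Nat.Base as ℕ using (ℕ; suc; _≤_)
  import Data.Nat.Properties as ℕ
  open import Data.Product.Base using (_×_; _,_; proj₁; proj₂)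
  open import Data.Rational.Base as ℚ using (ℚ; 0ℚ; 1ℚ)
  import Data.Rational.Properties as ℚ
  import Data.Rational.Solver as ℚ-Solver
  open import Data.Sum.Base using ([_,_]′)
  open import Function.Base using (_∘_; id)
  open import Relation.Binary.PropositionalEquality
  open import Relation.Nullary.Decidable using (from-yes; ¬?)

  module _ (p q : Point) where

    private
      p₁ = proj₁ p
      p₂ = proj₂ p
      q₁ = proj₁ q
      q₂ = proj₂ q

    src∈ˢ : p ∈ˢ (p , q)
    src∈ˢ = 0ℚ , ℚ.≤-refl , ℚ.nonNegative⁻¹ 1ℚ , at-0 p₁ q₁ , at-0 p₂ q₂
      where
      at-0 : ∀ p q → p ≡ p ℚ.+ 0ℚ ℚ.* (q ℚ.- p)
      at-0 p q = sym (end-at-0 p q refl refl)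

    tgt∈ˢ : q ∈ˢ (p , q)
    tgt∈ˢ = 1ℚ , ℚ.nonNegative⁻¹ 1ℚ , ℚ.≤-refl , at-1 p₁ q₁ , at-1 p₂ q₂
      where
      at-1 : ∀ p q → q ≡ p ℚ.+ 1ℚ ℚ.* (q ℚ.- p)
      at-1 p q = sym (end-at-1 p q refl refl)

    reverse∈ˢ : ∀ {x} → x ∈ˢ (p , q) → x ∈ˢ (q , p)
    reverse∈ˢ (t , 0≤t , t≤1 , x₁≡ , x₂≡) =
      1ℚ ℚ.- t , 1-t≥0 t≤1 , 1-t≤1 ,
      trans x₁≡ (flipped p₁ q₁ t) , trans x₂≡ (flipped p₂ q₂ t)
      where
      open ℚ-Solver.+-*-Solver
      flipped : ∀ p q t → p ℚ.+ t ℚ.* (q ℚ.- p) ≡ q ℚ.+ (1ℚ ℚ.- t) ℚ.* (p ℚ.- q)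
      flipped = solve 3 (λ p q t → p :+ t :* (q :- p) := q :+ (con 1ℚ :- t) :* (p :- q)) refl
      1-t≤1 : 1ℚ ℚ.- t ℚ.≤ 1ℚ
      1-t≤1 = subst (1ℚ ℚ.- t ℚ.≤_) (ℚ.+-identityʳ 1ℚ) (ℚ.+-monoʳ-≤ 1ℚ (ℚ.neg-antimono-≤ 0≤t))

  -- An edge orders its ends by index, an item by the geometry, so their segments agree only up to
  -- reversal.
  data _≈ˢ_ : Segment → Segment → Set where
    aligned  : ∀ {s} → s ≈ˢ s
    opposite : ∀ {p q} → (p , q) ≈ˢ (q , p)

  ∈-≈ˢ : ∀ {s t x} → s ≈ˢ t → x ∈ˢ s → x ∈ˢ t
  ∈-≈ˢ aligned            = id
  ∈-≈ˢ (opposite {p} {q}) = reverse∈ˢ p q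

  nonParallel-sym : ∀ {s t} → NonParallel s t → NonParallel t s
  nonParallel-sym {(p₁ , p₂) , (q₁ , q₂)} {(r₁ , r₂) , (s₁ , s₂)} np eq =
    np (trans (ℚ.*-comm (q₁ ℚ.- p₁) _) (trans (sym eq) (ℚ.*-comm (s₁ ℚ.- r₁) _)))

  nonParallel-≈ˢ : ∀ {s s′ t} → s ≈ˢ s′ → NonParallel s t → NonParallel s′ t
  nonParallel-≈ˢ aligned np = np
  nonParallel-≈ˢ {t = (r₁ , r₂) , (s₁ , s₂)} (opposite {p₁ , p₂} {q₁ , q₂}) np eq = np
    (trans (flipped q₁ p₁ (s₂ ℚ.- r₂)) (trans (cong ℚ.-_ eq) (sym (flipped q₂ p₂ (s₁ ℚ.- r₁)))))
    where
    open ℚ-Solver.+-*-Solver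
    flipped : ∀ q p d → (q ℚ.- p) ℚ.* d ≡ ℚ.- ((p ℚ.- q) ℚ.* d)
    flipped = solve 3 (λ q p d → (q :- p) :* d := :- ((p :- q) :* d)) refl

  tipPt : Blob × Fin 6 → Pt
  tipPt (b , q) = (proj₁ (hub b) ℤ.+ proj₁ (spike b q)) , (proj₂ (hub b) ℤ.+ proj₂ (spike b q))

  linkDirection : Fin 6 → Fin 2 → Pt
  linkDirection c s = tipPt (proj₂ (link c s)) ∸ᵖ tipPt (proj₁ (link c s))

  linkDirections-independent : ∀ c → det (linkDirection c 0F) (linkDirection c 1F) ≢ 0ℤ
  linkDirections-independent = from-yes (Fin.all? λ c → ¬? (det (linkDirection c 0F) (linkDirection c 1F) ℤ.≟ 0ℤ))

  spikes-independent : ∀ b p → det (spike b p) (spike b (next p)) ≢ 0ℤ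
  spikes-independent = from-yes (Fin.all? λ b → Fin.all? λ p → ¬? (det (spike b p) (spike b (next p)) ℤ.≟ 0ℤ))

  det-*ˡ : ∀ k a b c d → det ((k ℤ.* a) , (k ℤ.* b)) ((k ℤ.* c) , (k ℤ.* d)) ≡ (k ℤ.* k) ℤ.* det (a , b) (c , d)
  det-*ˡ = solve 5 (λ k a b c d → (k :* a) :* (k :* d) :- (k :* b) :* (k :* c)
                               := (k :* k) :* (a :* d :- b :* c)) refl
    where open ℤ-Solver.+-*-Solver

  -- At every height this reduces the two diagonals to two consecutive spikes, since the factor 2`k`
  -- + 1 is not zero.
  det-diagonals : ∀ k v₁ v₂ w₁ w₂ →
      det ((k ℤ.* w₁ ℤ.- (1ℤ ℤ.+ k) ℤ.* v₁) , (k ℤ.* w₂ ℤ.- (1ℤ ℤ.+ k) ℤ.* v₂))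
          ((k ℤ.* v₁ ℤ.- (1ℤ ℤ.+ k) ℤ.* w₁) , (k ℤ.* v₂ ℤ.- (1ℤ ℤ.+ k) ℤ.* w₂))
    ≡ (1ℤ ℤ.+ (k ℤ.+ k)) ℤ.* det (v₁ , v₂) (w₁ , w₂)
  det-diagonals = solve 5 (λ k v₁ v₂ w₁ w₂ →
      (k :* w₁ :- (con 1ℤ :+ k) :* v₁) :* (k :* v₂ :- (con 1ℤ :+ k) :* w₂)
      :- (k :* w₂ :- (con 1ℤ :+ k) :* v₂) :* (k :* v₁ :- (con 1ℤ :+ k) :* w₁)
    := (con 1ℤ :+ (k :+ k)) :* (v₁ :* w₂ :- v₂ :* w₁)) refl
    where open ℤ-Solver.+-*-Solver

  module Directions (R : ℕ) {{R≢0 : ℕ.NonZero R}} where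

    open Picture R

    *≢0 : ∀ i {j} → i ≢ 0ℤ → j ≢ 0ℤ → i ℤ.* j ≢ 0ℤ
    *≢0 i i≢0 j≢0 = [ i≢0 , j≢0 ]′ ∘ ℤ.i*j≡0⇒i≡0∨j≡0 i

    R≢0ℤ : + R ≢ 0ℤ
    R≢0ℤ eq = ℕ.≢-nonZero⁻¹ R (ℤ.+-injective eq)

    opaque
      unfolding loc

      loc-∸ : ∀ b h q h′ q′ → loc b h q ∸ᵖ loc b h′ q′ ≡
        ((+ h ℤ.* proj₁ (spike b q) ℤ.- + h′ ℤ.* proj₁ (spike b q′)) ,
         (+ h ℤ.* proj₂ (spike b q) ℤ.- + h′ ℤ.* proj₂ (spike b q′)))
      loc-∸ b h q h′ q′ = cong₂ _,_ (cancel (+ R ℤ.* proj₁ (hub b)) _ _) (cancel (+ R ℤ.* proj₂ (hub b)) _ _)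
        where
        open ℤ-Solver.+-*-Solver
        cancel : ∀ c x y → (c ℤ.+ x) ℤ.- (c ℤ.+ y) ≡ x ℤ.- y
        cancel = solve 3 (λ c x y → (c :+ x) :- (c :+ y) := x :- y) refl

      loc-tip : ∀ s → loc (proj₁ s) R (proj₂ s) ≡ ((+ R ℤ.* proj₁ (tipPt s)) , (+ R ℤ.* proj₂ (tipPt s)))
      loc-tip (b , q) = cong₂ _,_ (sym (ℤ.*-distribˡ-+ (+ R) _ _)) (sym (ℤ.*-distribˡ-+ (+ R) _ _))

      loc-centre : ∀ b q q′ → loc b 0 q ≡ loc b 0 q′
      loc-centre b q q′ = refl

    tip-∸ : ∀ s t → loc (proj₁ s) R (proj₂ s) ∸ᵖ loc (proj₁ t) R (proj₂ t) ≡
      ((+ R ℤ.* proj₁ (tipPt s ∸ᵖ tipPt t)) , (+ R ℤ.* proj₂ (tipPt s ∸ᵖ tipPt t)))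
    tip-∸ s t = trans (cong₂ _∸ᵖ_ (loc-tip s) (loc-tip t))
      (cong₂ _,_ (factor (+ R) (proj₁ (tipPt s)) (proj₁ (tipPt t)))
                 (factor (+ R) (proj₂ (tipPt s)) (proj₂ (tipPt t))))
      where
      open ℤ-Solver.+-*-Solver
      factor : ∀ r x y → r ℤ.* x ℤ.- r ℤ.* y ≡ r ℤ.* (x ℤ.- y)
      factor = solve 3 (λ r x y → r :* x :- r :* y := r :* (x :- y)) refl

    crossing-nonParallel₁ : ∀ {b k p} →
      NonParallel (embedˢ (ends (cell b k p diag₁))) (embedˢ (ends (cell b k p diag₂)))
    crossing-nonParallel₁ {b} {k} {p} = nonParallel {ends (cell b k p diag₁)} {ends (cell b k p diag₂)}
      (subst (_≢ 0ℤ) (sym eq) (*≢0 (+ suc (k ℕ.+ k)) (λ ()) (spikes-independent b p)))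
      where
      eq : det (loc b k (next p) ∸ᵖ loc b (suc k) p) (loc b k p ∸ᵖ loc b (suc k) (next p))
         ≡ + suc (k ℕ.+ k) ℤ.* det (spike b p) (spike b (next p))
      eq = trans (cong₂ det (loc-∸ b k (next p) (suc k) p) (loc-∸ b k p (suc k) (next p)))
        (det-diagonals (+ k) (proj₁ (spike b p)) (proj₂ (spike b p))
          (proj₁ (spike b (next p))) (proj₂ (spike b (next p))))

    crossing-nonParallel₂ : ∀ c → NonParallel (embedˢ (ends (bridge c 0F))) (embedˢ (ends (bridge c 1F)))
    crossing-nonParallel₂ c = nonParallel {ends (bridge c 0F)} {ends (bridge c 1F)}
      (subst (_≢ 0ℤ) (sym eq) (*≢0 (+ R ℤ.* + R) (*≢0 (+ R) R≢0ℤ R≢0ℤ) (linkDirections-independent c)))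
      where
      eq : det (loc _ R _ ∸ᵖ loc _ R _) (loc _ R _ ∸ᵖ loc _ R _)
         ≡ (+ R ℤ.* + R) ℤ.* det (linkDirection c 0F) (linkDirection c 1F)
      eq = trans (cong₂ det (tip-∸ (proj₂ (link c 0F)) (proj₁ (link c 0F)))
                            (tip-∸ (proj₂ (link c 1F)) (proj₁ (link c 1F))))
        (det-*ˡ (+ R) (proj₁ (linkDirection c 0F)) (proj₂ (linkDirection c 0F))
                      (proj₁ (linkDirection c 1F)) (proj₂ (linkDirection c 1F)))

    crossing-nonParallel : ∀ {i j} → Crossing i j → NonParallel (embedˢ (ends i)) (embedˢ (ends j))
    crossing-nonParallel {i} {j} diagonals₁ = crossing-nonParallel₁
    crossing-nonParallel {i} {j} diagonals₂ =
      nonParallel-sym {embedˢ (ends j)} {embedˢ (ends i)} crossing-nonParallel₁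
    crossing-nonParallel {i} {j} (bridges₁ {c}) = crossing-nonParallel₂ c
    crossing-nonParallel {i} {j} (bridges₂ {c}) =
      nonParallel-sym {embedˢ (ends j)} {embedˢ (ends i)} (crossing-nonParallel₂ c)

    crossing-unique : ∀ {i j j′} → Crossing i j → Crossing i j′ → j ≡ j′
    crossing-unique diagonals₁ diagonals₁ = refl
    crossing-unique diagonals₂ diagonals₂ = refl
    crossing-unique bridges₁   bridges₁   = refl
    crossing-unique bridges₂   bridges₂   = refl

-- The graph and its 1-plane drawing.

module RingOfBlobs where

  open PlaneSegments
  open Blobs
  open Items
  open CrossingItems
  open import Data.Fin.Base as Fin using (Fin; zero; suc; toℕ; fromℕ; combine; remQuot)
  open import Data.Fin.Patterns
  import Data.Fin.Properties as Fin
  open import Data.List.Base using ([]; [_])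
  open import Data.List.Relation.Unary.Any using (here)
  open import Data.Nat.Base as ℕ using (ℕ; zero; suc; _≤_; z≤n; s≤s)
  import Data.Nat.Properties as ℕ
  open import Data.Product.Base using (_×_; _,_; proj₁; proj₂; ∃-syntax; uncurry)
  open import Data.Product.Properties using (≡-dec)
  open import Data.Sum.Base using (_⊎_; inj₁; inj₂; [_,_]′; swap)
  open import Data.Unit.Base using (tt)
  open import Data.Empty using (⊥; ⊥-elim)
  open import Function.Base using (id)
  open import Function.Definitions using (Injective)
  open import Relation.Binary.PropositionalEquality
  open import Relation.Nullary.Decidable using (Dec; yes; no; from-yes; _×-dec_; _⊎-dec_; ¬?;
    recompute)
  open import Relation.Nullary.Negation using (¬_; contradiction)
  open import Relation.Binary.Definitions using (DecidableEquality)

  module Construction (r : ℕ) where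

    -- There are at least two hexagons: fans from outermost nodes and the detours of lanes use the
    -- hexagon below the outermost one.
    R : ℕ
    R = suc (suc r)

    open Picture R
    open Directions R

    -- node j p is the corner p of hexagon 1 + j.
    data Local : Set where
      centre : Local
      node   : Fin R → Fin 6 → Local

    Vertex : Set
    Vertex = Blob × Local

    top : Fin R
    top = fromℕ (suc r)

    tip : Blob × Fin 6 → Vertex
    tip (b , q) = b , node top q

    infix 4 _⇒_

    -- Each edge inside a blob gets one orientation, inwards or along the rim in the sense of
    -- `next`, matching the source and target of its cell.
    _⇒_ : Local → Local → Set
    centre   ⇒ _        = ⊥
    node j p ⇒ centre   = toℕ j ≡ 0
    node j p ⇒ node k q = toℕ j ≡ toℕ k × q ≡ next p
                        ⊎ toℕ j ≡ suc (toℕ k) × (q ≡ p ⊎ q ≡ next p ⊎ p ≡ next q)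

    _⇒?_ : ∀ x y → Dec (x ⇒ y)
    centre   ⇒? _        = no λ ()
    node j p ⇒? centre   = toℕ j ℕ.≟ 0
    node j p ⇒? node k q = (toℕ j ℕ.≟ toℕ k ×-dec q Fin.≟ next p)
      ⊎-dec (toℕ j ℕ.≟ suc (toℕ k) ×-dec (q Fin.≟ p ⊎-dec q Fin.≟ next p ⊎-dec p Fin.≟ next q))

    _≟ₗ_ : DecidableEquality Local
    centre   ≟ₗ centre   = yes refl
    centre   ≟ₗ node _ _ = no λ ()
    node _ _ ≟ₗ centre   = no λ ()
    node j p ≟ₗ node k q = Relation.Nullary.Decidable.map′
      (λ (j≡k , p≡q) → cong₂ node j≡k p≡q) (λ { refl → refl , refl }) (j Fin.≟ k ×-dec p Fin.≟ q)

    _≟ᵥ_ : DecidableEquality Vertex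
    _≟ᵥ_ = ≡-dec Fin._≟_ _≟ₗ_

    data Arc : Vertex → Vertex → Set where
      inside : ∀ {b x y} → x ⇒ y → Arc (b , x) (b , y)
      linked : ∀ c s → Arc (tip (proj₁ (link c s))) (tip (proj₂ (link c s)))

    arc? : ∀ u w → Dec (Arc u w)
    arc? u@(b , x) w@(b′ , y) = Relation.Nullary.Decidable.map′ to from
      ((b Fin.≟ b′ ×-dec x ⇒? y) ⊎-dec
        Fin.any? λ c → Fin.any? λ s → u ≟ᵥ tip (proj₁ (link c s)) ×-dec w ≟ᵥ tip (proj₂ (link c s)))
      where
      Cases = (b ≡ b′ × x ⇒ y) ⊎
        ∃[ c ] ∃[ s ] u ≡ tip (proj₁ (link c s)) × w ≡ tip (proj₂ (link c s))
      to : Cases → Arc u w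
      to (inj₁ (refl , x⇒y))           = inside x⇒y
      to (inj₂ (c , s , refl , refl)) = linked c s
      from : Arc u w → Cases
      from (inside x⇒y) = inj₁ (refl , x⇒y)
      from (linked c s) = inj₂ (c , s , refl , refl)

    -- As degenerate segments, vertices come under the same `compare` as edges, which gives both
    -- distinct positions and `avoids`.
    vertexItem : Vertex → Item
    vertexItem (b , centre)   = centreᵢ b
    vertexItem (b , node j p) = cell b (toℕ j) p point

    vertexItem-valid : ∀ v → Valid (vertexItem v)
    vertexItem-valid (b , centre)   = tt
    vertexItem-valid (b , node j p) = Fin.toℕ<n j , λ ()

    position : Vertex → Pt
    position v = proj₁ (ends (vertexItem v))

    vertexItem-ends : ∀ v → ends (vertexItem v) ≡ (position v , position v)
    vertexItem-ends (b , centre)   = refl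
    vertexItem-ends (b , node j p) = refl

    position-tip : ∀ s → position (tip s) ≡ loc (proj₁ s) R (proj₂ s)
    position-tip (b , q) = cong (λ h → loc b (suc h) q) (Fin.toℕ-fromℕ (suc r))

    vertexItem-injective : ∀ {v w} → vertexItem v ≡ vertexItem w → v ≡ w
    vertexItem-injective {b , centre}   {_ , centre}   refl = refl
    vertexItem-injective {b , node j p} {_ , node k q} eq =
      let b≡ , j≡ , p≡ = cell-injective eq in cong₂ _,_ b≡ (cong₂ node (Fin.toℕ-injective j≡) p≡)
      where
      cell-injective : ∀ {b b′ h h′ p p′ κ κ′} → cell b h p κ ≡ cell b′ h′ p′ κ′ → b ≡ b′ × h ≡ h′ × p ≡ p′
      cell-injective refl = refl , refl , refl

    vertexItem-uncrossed : ∀ v {j} → ¬ Crossing (vertexItem v) j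
    vertexItem-uncrossed (b , centre)   ()
    vertexItem-uncrossed (b , node _ _) ()

    verdict : ∀ {i j} → Compared i j → i ≡ j ⊎ Apart i j ⊎ Crossing i j
    verdict same      = inj₁ refl
    verdict (apart a) = inj₂ (inj₁ a)
    verdict (cross c) = inj₂ (inj₂ c)

    position-injective : ∀ {v w} → position v ≡ position w → v ≡ w
    position-injective {v} {w} v≡w
      with verdict (compare (vertexItem v) (vertexItem w) (vertexItem-valid v) (vertexItem-valid w))
    ... | inj₁ eq = vertexItem-injective eq
    ... | inj₂ (inj₂ crossing) = contradiction crossing (vertexItem-uncrossed v)
    ... | inj₂ (inj₁ (inj₁ lt)) = ⊥-elim (below-point
      (subst₂ Below (vertexItem-ends v) (trans (vertexItem-ends w) (cong (λ p → p , p) (sym v≡w))) lt)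
      (src∈ˢ (embed (position v)) (embed (position v))))
    ... | inj₂ (inj₁ (inj₂ gt)) = ⊥-elim (below-point
      (subst₂ Below (vertexItem-ends w) (trans (vertexItem-ends v) (cong (λ p → p , p) v≡w)) gt)
      (src∈ˢ (embed (position w)) (embed (position w))))

    insideItem : Blob → ∀ {x y} → x ⇒ y → Item
    insideItem b {node j p} {centre}   _                             = cell b 0 p spoke
    insideItem b {node j p} {node k q} (inj₁ _)                      = cell b (toℕ j) p rim
    insideItem b {node j p} {node k q} (inj₂ (_ , inj₁ _))           = cell b (toℕ j) p spoke
    insideItem b {node j p} {node k q} (inj₂ (_ , inj₂ (inj₁ _)))    = cell b (toℕ j) p diag₁
    insideItem b {node j p} {node k q} (inj₂ (_ , inj₂ (inj₂ _)))    = cell b (toℕ j) q diag₂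

    insideItem-valid : ∀ b {x y} (x⇒y : x ⇒ y) → Valid (insideItem b x⇒y)
    insideItem-valid b {node j p} {centre}   _ = s≤s z≤n , λ ()
    insideItem-valid b {node j p} {node k q} (inj₁ _) = Fin.toℕ<n j , λ ()
    insideItem-valid b {node j p} {node k q} (inj₂ (_ , inj₁ _)) = Fin.toℕ<n j , λ ()
    insideItem-valid b {node j p} {node k q} (inj₂ (j≡1+k , inj₂ (inj₁ _))) =
      Fin.toℕ<n j , λ _ → subst (1 ≤_) (sym j≡1+k) (s≤s z≤n)
    insideItem-valid b {node j p} {node k q} (inj₂ (j≡1+k , inj₂ (inj₂ _))) =
      Fin.toℕ<n j , λ _ → subst (1 ≤_) (sym j≡1+k) (s≤s z≤n)

    insideItem-ends : ∀ b {x y} (x⇒y : x ⇒ y) →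
      ends (insideItem b x⇒y) ≡ (position (b , x) , position (b , y))
    insideItem-ends b {node j p} {centre} j≡0 =
      cong₂ _,_ (cong (λ h → loc b (suc h) p) (sym j≡0)) (loc-centre b p 0F)
    insideItem-ends b {node j p} {node k _} (inj₁ (j≡k , refl)) =
      cong (λ h → loc b (suc (toℕ j)) p , loc b (suc h) (next p)) j≡k
    insideItem-ends b {node j p} {node k _} (inj₂ (j≡1+k , inj₁ refl)) =
      cong (λ h → loc b (suc (toℕ j)) p , loc b h p) j≡1+k
    insideItem-ends b {node j p} {node k _} (inj₂ (j≡1+k , inj₂ (inj₁ refl))) =
      cong (λ h → loc b (suc (toℕ j)) p , loc b h (next p)) j≡1+k
    insideItem-ends b {node j _} {node k q} (inj₂ (j≡1+k , inj₂ (inj₂ refl))) =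
      cong (λ h → loc b (suc (toℕ j)) (next q) , loc b h q) j≡1+k

    arcItem : ∀ {u w} → Arc u w → Item
    arcItem (inside {b} x⇒y) = insideItem b x⇒y
    arcItem (linked c s)     = bridge c s

    arcItem-valid : ∀ {u w} (a : Arc u w) → Valid (arcItem a)
    arcItem-valid (inside {b} x⇒y) = insideItem-valid b x⇒y
    arcItem-valid (linked c s)     = tt

    arcItem-ends : ∀ {u w} (a : Arc u w) → ends (arcItem a) ≡ (position u , position w)
    arcItem-ends (inside {b} x⇒y) = insideItem-ends b x⇒y
    arcItem-ends (linked c s)     =
      cong₂ _,_ (sym (position-tip (proj₁ (link c s)))) (sym (position-tip (proj₂ (link c s))))

    next≢ : ∀ p → p ≢ next p
    next≢ = from-yes (Fin.all? λ p → ¬? (p Fin.≟ next p))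

    link≢ : ∀ c s → proj₁ (proj₁ (link c s)) ≢ proj₁ (proj₂ (link c s))
    link≢ = from-yes (Fin.all? λ c → Fin.all? λ s →
      ¬? (proj₁ (proj₁ (link c s)) Fin.≟ proj₁ (proj₂ (link c s))))

    ⇒-irrefl : ∀ {x y} → x ≡ y → ¬ (x ⇒ y)
    ⇒-irrefl {node j p} refl (inj₁ (_ , p≡))    = next≢ p p≡
    ⇒-irrefl {node j p} refl (inj₂ (j≡1+j , _)) = ℕ.1+n≢n (sym j≡1+j)

    arc-irrefl : ∀ {u w} → u ≡ w → ¬ Arc u w
    arc-irrefl u≡w (inside x⇒y) = ⇒-irrefl (cong proj₂ u≡w) x⇒y
    arc-irrefl u≡w (linked c s) = link≢ c s (cong proj₁ u≡w)

    order : ℕ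
    order = 4 ℕ.* suc (R ℕ.* 6)

    encodeₗ : Local → Fin (suc (R ℕ.* 6))
    encodeₗ centre     = zero
    encodeₗ (node j p) = suc (combine j p)

    decodeₗ : Fin (suc (R ℕ.* 6)) → Local
    decodeₗ zero    = centre
    decodeₗ (suc i) = uncurry node (remQuot 6 i)

    decodeₗ-encodeₗ : ∀ x → decodeₗ (encodeₗ x) ≡ x
    decodeₗ-encodeₗ centre     = refl
    decodeₗ-encodeₗ (node j p) = cong (uncurry node) (Fin.remQuot-combine j p)

    encodeₗ-decodeₗ : ∀ i → encodeₗ (decodeₗ i) ≡ i
    encodeₗ-decodeₗ zero    = refl
    encodeₗ-decodeₗ (suc i) = cong suc (Fin.combine-remQuot {R} 6 i)

    opaque

      encode : Vertex → Fin order
      encode (b , x) = combine b (encodeₗ x)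

      decode : Fin order → Vertex
      decode i = let (b , k) = remQuot {4} (suc (R ℕ.* 6)) i in b , decodeₗ k

      decode-encode : ∀ v → decode (encode v) ≡ v
      decode-encode (b , x) = trans
        (cong (λ (b , k) → b , decodeₗ k) (Fin.remQuot-combine b (encodeₗ x)))
        (cong (b ,_) (decodeₗ-encodeₗ x))

      encode-decode : ∀ i → encode (decode i) ≡ i
      encode-decode i = trans
        (cong (combine (proj₁ (remQuot {4} (suc (R ℕ.* 6)) i))) (encodeₗ-decodeₗ _))
        (Fin.combine-remQuot {4} (suc (R ℕ.* 6)) i)

    decode-injective : Injective _≡_ _≡_ decode
    decode-injective {i} {j} eq = trans (sym (encode-decode i)) (trans (cong encode eq) (encode-decode j))

    Joined : Vertex → Vertex → Set
    Joined u w = Arc u w ⊎ Arc w u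

    G : Graph order
    G = record
      { Adj    = λ i j → Joined (decode i) (decode j)
      ; sym    = swap
      ; irrefl = λ { refl → [ arc-irrefl refl , arc-irrefl refl ]′ }
      ; adj?   = λ i j → arc? _ _ ⊎-dec arc? _ _
      }

    open Edge

    joined : (e : Edge G) → Joined (decode (src e)) (decode (tgt e))
    joined (edge s t _ adjacent) = recompute (Graph.adj? G s t) adjacent

    joinedItem : ∀ {u w} → Joined u w → Item
    joinedItem = [ arcItem , arcItem ]′

    joinedItem-valid : ∀ {u w} (a : Joined u w) → Valid (joinedItem a)
    joinedItem-valid (inj₁ a) = arcItem-valid a
    joinedItem-valid (inj₂ a) = arcItem-valid a

    joinedItem-ends : ∀ {u w} (a : Joined u w) →
      embedˢ (ends (joinedItem a)) ≈ˢ (embed (position u) , embed (position w))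
    joinedItem-ends (inj₁ a) = subst (λ s → embedˢ s ≈ˢ _) (sym (arcItem-ends a)) aligned
    joinedItem-ends (inj₂ a) = subst (λ s → embedˢ s ≈ˢ _) (sym (arcItem-ends a)) opposite

    opaque

      item : Edge G → Item
      item e = joinedItem (joined e)

      item-valid : ∀ e → Valid (item e)
      item-valid e = joinedItem-valid (joined e)

      pos : Fin order → Point
      pos i = embed (position (decode i))

      pos-embed : ∀ i → pos i ≡ embed (position (decode i))
      pos-embed i = refl

      pos-injective : Injective _≡_ _≡_ pos
      pos-injective eq = decode-injective (position-injective (embed-injective eq))

      item-ends : ∀ e → embedˢ (ends (item e)) ≈ˢ (pos (src e) , pos (tgt e))
      item-ends e = joinedItem-ends (joined e)

    ≈ˢ-sym : ∀ {s t} → s ≈ˢ t → t ≈ˢ s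
    ≈ˢ-sym aligned  = aligned
    ≈ˢ-sym opposite = opposite

    ≈ˢ-end : ∀ {s t} {x : Point} → s ≈ˢ t → x ≡ proj₁ s ⊎ x ≡ proj₂ s → x ≡ proj₁ t ⊎ x ≡ proj₂ t
    ≈ˢ-end aligned  = id
    ≈ˢ-end opposite = swap

    -- An item fixes the two end positions up to order, and the order is then forced by `src<tgt`.
    item-injective : ∀ {e f} → item e ≡ item f → e ≡ f
    item-injective {e@(edge s t s<t _)} {f@(edge s′ t′ s′<t′ _)} eq =
      unify (match {item e} {item f} (item-ends e) (item-ends f) eq)
      where
      match : ∀ {i j} {u w : Segment} → embedˢ (ends i) ≈ˢ u → embedˢ (ends j) ≈ˢ w → i ≡ j →
        u ≡ w ⊎ u ≡ Data.Product.Base.swap w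
      match aligned  aligned  refl = inj₁ refl
      match opposite aligned  refl = inj₂ refl
      match aligned  opposite refl = inj₂ refl
      match opposite opposite refl = inj₁ refl
      unify : (pos s , pos t) ≡ (pos s′ , pos t′) ⊎ (pos s , pos t) ≡ (pos t′ , pos s′) → e ≡ f
      unify (inj₁ eq) with pos-injective {s} {s′} (cong proj₁ eq) | pos-injective {t} {t′} (cong proj₂ eq)
      ... | refl | refl = refl
      unify (inj₂ eq) with pos-injective {s} {t′} (cong proj₁ eq) | pos-injective {t} {s′} (cong proj₂ eq)
      ... | refl | refl = contradiction
        (recompute (s Fin.<? t) s<t) (Fin.<-asym (recompute (s′ Fin.<? t′) s′<t′))

    segment : Edge G → Segment
    segment e = pos (src e) , pos (tgt e)

    Inside : Point → Edge G → Set
    Inside x e = x ∈ˢ segment e × x ≢ pos (src e) × x ≢ pos (tgt e)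

    not-end : ∀ {x e} → Inside x e → ¬ (x ≡ embed (proj₁ (ends (item e))) ⊎ x ≡ embed (proj₂ (ends (item e))))
    not-end {e = e} (_ , x≢s , x≢t) end = [ x≢s , x≢t ]′ (≈ˢ-end (item-ends e) end)

    on-item : ∀ e x → x ∈ˢ segment e → x ∈ˢ embedˢ (ends (item e))
    on-item e x = ∈-≈ˢ {x = x} (≈ˢ-sym (item-ends e))

    crossing-items : ∀ e f x → e ≢ f → Inside x e → Inside x f → Crossing (item e) (item f)
    crossing-items e f x e≢f x-in-e x-in-f
      with verdict (compare (item e) (item f) (item-valid e) (item-valid f))
    ... | inj₁ eq              = contradiction (item-injective eq) e≢f
    ... | inj₂ (inj₂ crossing) = crossing
    ... | inj₂ (inj₁ (inj₁ lt)) = contradiction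
      (below-meet lt {x} (on-item e x (proj₁ x-in-e)) (on-item f x (proj₁ x-in-f)))
      (not-end {x} {e} x-in-e)
    ... | inj₂ (inj₁ (inj₂ gt)) = contradiction
      (below-meet gt {x} (on-item f x (proj₁ x-in-f)) (on-item e x (proj₁ x-in-e)))
      (not-end {x} {f} x-in-f)

    segments-nonParallel : ∀ e f → Crossing (item e) (item f) → NonParallel (segment e) (segment f)
    segments-nonParallel e f crossing =
      nonParallel-≈ˢ {t = segment f} (item-ends e)
        (nonParallel-sym {segment f} {embedˢ (ends (item e))}
          (nonParallel-≈ˢ {t = embedˢ (ends (item e))} (item-ends f)
            (nonParallel-sym {embedˢ (ends (item e))} {embedˢ (ends (item f))} (crossing-nonParallel crossing))))

    avoids : ∀ e v → ¬ Inside (pos v) e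
    avoids e v v-in-e with verdict (compare (vertexItem (decode v)) (item e)
                             (vertexItem-valid (decode v)) (item-valid e))
    ... | inj₂ (inj₂ crossing) = vertexItem-uncrossed (decode v) crossing
    ... | inj₁ eq = not-end {pos v} {e} v-in-e
      (inj₁ (trans (pos-embed v) (cong (λ i → embed (proj₁ (ends i))) eq)))
    ... | inj₂ (inj₁ (inj₁ lt)) = below-point
      (subst (λ s → Below s (ends (item e))) (vertexItem-ends (decode v)) lt)
      (subst (_∈ˢ embedˢ (ends (item e))) (pos-embed v) (on-item e (pos v) (proj₁ v-in-e)))
    ... | inj₂ (inj₁ (inj₂ gt)) = not-end {pos v} {e} v-in-e (below-meet
      (subst (Below (ends (item e))) (vertexItem-ends (decode v)) gt)
      {pos v} (on-item e (pos v) (proj₁ v-in-e))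
      (subst (λ p → pos v ∈ˢ (p , p)) (pos-embed v) (src∈ˢ (pos v) (pos v))))

    drawing : Drawing G
    drawing = record
      { pos           = pos
      ; pos-injective = pos-injective
      ; bends         = λ _ → []
      ; simple        = λ e → ends≢ e , (λ _ _ ()) , tt
      ; avoids        = λ { e v (here v∈e , v≢) → avoids e v (v∈e , v≢) }
      ; transversal   = λ { e f x (e≢f , (here x∈e , x≢) , (here x∈f , x≢′)) →
          segment e , segment f , here refl , here refl , (x∈e , x≢) , (x∈f , x≢′) ,
          segments-nonParallel e f (crossing-items e f x e≢f (x∈e , x≢) (x∈f , x≢′)) }
      }
      where
      ends≢ : ∀ e → pos (src e) ≢ pos (tgt e)
      ends≢ e eq = Graph.irrefl G (pos-injective {src e} {tgt e} eq) (joined e)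

    open Drawing drawing using (CrossAt; Cross)

    cross-inside : ∀ e f x → CrossAt e f x → e ≢ f × Inside x e × Inside x f
    cross-inside e f x (e≢f , (here x∈e , x≢) , (here x∈f , x≢′)) = e≢f , (x∈e , x≢) , (x∈f , x≢′)

    cross-items : ∀ e f x → CrossAt e f x → Crossing (item e) (item f)
    cross-items e f x cr = let e≢f , x-in-e , x-in-f = cross-inside e f x cr in
      crossing-items e f x e≢f x-in-e x-in-f

    -- Crossing segments are not parallel. With `y` a common end of the two edges, this also rules
    -- out crossings of adjacent edges.
    cross-unique : ∀ e f x y → CrossAt e f x → y ∈ˢ segment e → y ∈ˢ segment f → x ≡ y
    cross-unique e f x y cr y∈e y∈f =
      let _ , x-in-e , x-in-f = cross-inside e f x cr in
      nonParallel-unique {segment e} {segment f} {x} {y}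
        (segments-nonParallel e f (cross-items e f x cr)) (proj₁ x-in-e) (proj₁ x-in-f) y∈e y∈f

    isOnePlane : IsOnePlane drawing
    isOnePlane = record
      { crossed-at-most-once = once
      ; no-adjacent-crossing = λ { e f (x , cr) →
          let _ , (_ , x≢s , x≢t) , _ = cross-inside e f x cr
              shared : ∀ v → pos v ∈ˢ segment e → ∀ {w} → pos w ∈ˢ segment f → v ≡ w → x ≡ pos v
              shared v v∈e {w} w∈f v≡w = cross-unique e f x (pos v) cr v∈e
                (subst (λ v → pos v ∈ˢ segment f) (sym v≡w) w∈f)
              s∈e = src∈ˢ (pos (src e)) (pos (tgt e))
              t∈e = tgt∈ˢ (pos (src e)) (pos (tgt e))
              s∈f = src∈ˢ (pos (src f)) (pos (tgt f))
              t∈f = tgt∈ˢ (pos (src f)) (pos (tgt f))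
          in  (λ eq → x≢s (shared (src e) s∈e {src f} s∈f eq))
            , (λ eq → x≢s (shared (src e) s∈e {tgt f} t∈f eq))
            , (λ eq → x≢t (shared (tgt e) t∈e {src f} s∈f eq))
            , (λ eq → x≢t (shared (tgt e) t∈e {tgt f} t∈f eq)) }
      }
      where
      once : ∀ e f g x y → CrossAt e f x → CrossAt e g y → f ≡ g × x ≡ y
      once e f g x y ef eg
        with item-injective {f} {g} (crossing-unique (cross-items e f x ef) (cross-items e g y eg))
      ... | refl = let _ , y-in-e , y-in-f = cross-inside e f y eg in
        refl , cross-unique e f x y ef (proj₁ y-in-e) (proj₁ y-in-f)

-- Six walks from a vertex to the exits of its blob.

module FansInBlobs where

  open Menger
  open CutConnectivity
  open Blobs
  open RingOfBlobs
  open import Data.Fin.Base as Fin using (Fin; zero; suc; toℕ; fromℕ<)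
  open import Data.Fin.Patterns
  import Data.Fin.Properties as Fin
  open import Data.Maybe.Base using (Maybe; just; nothing)
  open import Data.Nat.Base as ℕ using (ℕ; zero; suc; _≤_; _<_; s≤s; _⊓_)
  import Data.Nat.Properties as ℕ
  open import Data.Product.Base using (_,_; proj₁; proj₂; ∃-syntax)
  open import Data.Sum.Base using (_⊎_; inj₁; inj₂; swap)
  open import Relation.Binary.Construct.Closure.ReflexiveTransitive as Star using (Star; ε;
    _◅_; _◅◅_)
  open import Relation.Binary.Definitions using (tri<; tri≈; tri>)
  open import Relation.Binary.PropositionalEquality
  open import Relation.Nullary.Decidable using (Dec; from-yes; _⊎-dec_)
  open import Relation.Nullary.Negation using (contradiction)

  opposite : Fin 6 → Fin 6
  opposite p = next (next (next p))

  data Offset (p : Fin 6) : Fin 6 → Set where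
    at₀ : Offset p p
    at₁ : Offset p (next p)
    at₋₁ : ∀ {i} → p ≡ next i → Offset p i
    at₂ : Offset p (next (next p))
    at₋₂ : ∀ {i} → p ≡ next (next i) → Offset p i
    at₃ : Offset p (opposite p)

  offset : ∀ p i → Offset p i
  offset p i = classify (table p i)
    where
    Cases : Fin 6 → Fin 6 → Set
    Cases p i = i ≡ p ⊎ i ≡ next p ⊎ p ≡ next i ⊎ i ≡ next (next p) ⊎ p ≡ next (next i) ⊎ i ≡ opposite p
    cases? : ∀ p i → Dec (Cases p i)
    cases? p i = _ Fin.≟ _ ⊎-dec _ Fin.≟ _ ⊎-dec _ Fin.≟ _ ⊎-dec _ Fin.≟ _ ⊎-dec _ Fin.≟ _ ⊎-dec _ Fin.≟ _
    table : ∀ p i → Cases p i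
    table = from-yes (Fin.all? λ p → Fin.all? (cases? p))
    classify : ∀ {p i} → Cases p i → Offset p i
    classify (inj₁ refl)                             = at₀
    classify (inj₂ (inj₁ refl))                      = at₁
    classify (inj₂ (inj₂ (inj₁ eq)))                 = at₋₁ eq
    classify (inj₂ (inj₂ (inj₂ (inj₁ refl))))        = at₂
    classify (inj₂ (inj₂ (inj₂ (inj₂ (inj₁ eq)))))   = at₋₂ eq
    classify (inj₂ (inj₂ (inj₂ (inj₂ (inj₂ refl))))) = at₃

  -- On the hexagon of its base level, the neighbours of p lead to the exits at
  -- distance two from p.
  turnColour : Fin 6 → Fin 6 → Fin 6
  turnColour p q with offset p q
  ... | at₀     = opposite p
  ... | at₁     = next (next p)
  ... | at₋₁ _   = next (opposite p)
  ... | _      = opposite p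

  turn-self : ∀ p → turnColour p p ≡ opposite p
  turn-self = from-yes (Fin.all? λ p → turnColour p p Fin.≟ opposite p)

  turn-next : ∀ p → turnColour p (next p) ≡ next (next p)
  turn-next = from-yes (Fin.all? λ p → turnColour p (next p) Fin.≟ next (next p))

  turn-prev : ∀ i → turnColour (next (next i)) (next i) ≡ i
  turn-prev = from-yes (Fin.all? λ i → turnColour (next (next i)) (next i) Fin.≟ i)

  turn-opposite : ∀ p → turnColour p (opposite p) ≡ opposite p
  turn-opposite = from-yes (Fin.all? λ p → turnColour p (opposite p) Fin.≟ opposite p)

  module Fans (r : ℕ) where

    open Construction r

    record Step (ok : Vertex → Set) (u w : Vertex) : Set where
      constructor move
      field
        along : Joined u w
        from  : ok u
        to    : ok w

    Route : (Vertex → Set) → Vertex → Vertex → Set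
    Route ok = Star (Step ok)

    reverse : ∀ {ok u w} → Route ok u w → Route ok w u
    reverse = Star.reverse (λ (move uw u w) → move (swap uw) w u)

    -- A node of the outermost hexagon has no hexagon above it, so its fan turns on hexagon level
    -- `r`, one below the top.
    base : Fin R → ℕ
    base j = toℕ j ⊓ r

    -- The colours of a fan of six walks from x to the six exits of its blob.
    -- Above the base level of x they follow the spikes; the walk to the exit
    -- opposite x descends to the centre.
    fanColour : Local → Local → Maybe (Fin 6)
    fanColour centre     centre     = nothing
    fanColour centre     (node k q) = just q
    fanColour (node j p) centre     = just (opposite p)
    fanColour (node j p) (node k q) with ℕ.<-cmp (toℕ k) (base j)
    ... | tri< _ _ _ = just (opposite p)
    ... | tri≈ _ _ _ = just (turnColour p q)
    ... | tri> _ _ _ = just q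

    below-base : ∀ {j p} k q → toℕ k < base j → fanColour (node j p) (node k q) ≡ just (opposite p)
    below-base {j} k q k< with ℕ.<-cmp (toℕ k) (base j)
    ... | tri< _ _ _   = refl
    ... | tri≈ k≮ _ _  = contradiction k< k≮
    ... | tri> k≮ _ _  = contradiction k< k≮

    at-base : ∀ {j p} k q → toℕ k ≡ base j → fanColour (node j p) (node k q) ≡ just (turnColour p q)
    at-base {j} k q k≡ with ℕ.<-cmp (toℕ k) (base j)
    ... | tri< _ k≢ _  = contradiction k≡ k≢
    ... | tri≈ _ _ _   = refl
    ... | tri> _ k≢ _  = contradiction k≡ k≢

    above-base : ∀ {j p} k q → base j < toℕ k → fanColour (node j p) (node k q) ≡ just q
    above-base {j} k q k> with ℕ.<-cmp (toℕ k) (base j)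
    ... | tri< _ _ k≯  = contradiction k> k≯
    ... | tri≈ _ _ k≯  = contradiction k> k≯
    ... | tri> _ _ _   = refl

    level : ∀ {n} → n < R → ∃[ j ] toℕ {R} j ≡ n
    level n<R = fromℕ< n<R , Fin.toℕ-fromℕ< n<R

    top-level : ∀ j → toℕ {R} j ≡ suc r → j ≡ top
    top-level j j≡ = Fin.toℕ-injective (trans j≡ (sym (Fin.toℕ-fromℕ (suc r))))

    module _ {ok : Vertex → Set} (b : Blob) where

      down : ∀ {x y} → x ⇒ y → ok (b , x) → ok (b , y) → Step ok (b , x) (b , y)
      down x⇒y okx oky = move (inj₁ (inside x⇒y)) okx oky

      up : ∀ {x y} → y ⇒ x → ok (b , x) → ok (b , y) → Step ok (b , x) (b , y)
      up y⇒x okx oky = move (inj₂ (inside y⇒x)) okx oky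

      climb : ∀ d j i → toℕ j ℕ.+ d ≡ suc r → (∀ k → toℕ j ≤ toℕ k → ok (b , node k i)) →
        Route ok (b , node j i) (tip (b , i))
      climb zero    j i j+0≡ oks with top-level j (trans (sym (ℕ.+-identityʳ _)) j+0≡)
      ... | refl = ε
      climb (suc d) j i j+d≡ oks =
        let j+1<R = s≤s (ℕ.≤-trans (ℕ.m≤m+n (suc (toℕ j)) d) (ℕ.≤-reflexive (trans (sym (ℕ.+-suc _ d)) j+d≡)))
            k , k≡ = level j+1<R
        in  up (inj₂ (k≡ , inj₁ refl)) (oks j ℕ.≤-refl) (oks k (ℕ.≤-trans (ℕ.n≤1+n _) (ℕ.≤-reflexive (sym k≡))))
          ◅ climb d k i (trans (cong (ℕ._+ d) k≡) (trans (sym (ℕ.+-suc _ d)) j+d≡))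
              (λ l k≤l → oks l (ℕ.≤-trans (ℕ.n≤1+n _) (ℕ.≤-trans (ℕ.≤-reflexive (sym k≡)) k≤l)))

      climb-from : ∀ j i → (∀ k → toℕ j ≤ toℕ k → ok (b , node k i)) → Route ok (b , node j i) (tip (b , i))
      climb-from j i = climb (suc r ℕ.∸ toℕ j) j i (ℕ.m+[n∸m]≡n (ℕ.s≤s⁻¹ (Fin.toℕ<n j)))

      descend : ∀ n j p → toℕ j ≡ n → (∀ k → toℕ k ≤ n → ok (b , node k p)) → ok (b , centre) →
        Route ok (b , node j p) (b , centre)
      descend zero    j p j≡ oks okc = down j≡ (oks j (ℕ.≤-reflexive j≡)) okc ◅ ε
      descend (suc n) j p j≡ oks okc =
        let k , k≡ = level (ℕ.<-trans (ℕ.n<1+n n) (subst (_< R) j≡ (Fin.toℕ<n j)))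
        in  down (inj₂ (trans j≡ (cong suc (sym k≡)) , inj₁ refl))
              (oks j (ℕ.≤-reflexive j≡)) (oks k (ℕ.≤-trans (ℕ.≤-reflexive k≡) (ℕ.n≤1+n n)))
          ◅ descend n k p k≡ (λ l l≤ → oks l (ℕ.≤-trans l≤ (ℕ.n≤1+n n))) okc

      column : ∀ i → (∀ k → ok (b , node k i)) → ok (b , centre) → Route ok (b , centre) (tip (b , i))
      column i oks okc = reverse (descend (toℕ top) top i refl (λ k _ → oks k) okc)

      -- Below the top, exits at distance at most one are reached by stepping up a hexagon and
      -- climbing, those at distance two after a step along the own hexagon, and the opposite one
      -- through the centre. On the top hexagon, exits at distance one are neighbours, and those at
      -- distance two are reached over a corner of the hexagon below. The start is common to all six
      -- walks, so it has its own hypothesis.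
      fan : ∀ x i → ok (b , x) → (∀ y → fanColour x y ≡ just i → ok (b , y)) → Route ok (b , x) (tip (b , i))
      fan centre i okx oks = column i (λ k → oks (node k i) refl) okx
      fan (node j p) i okx oks with ℕ.<-cmp (toℕ j) (suc r)
      ... | tri> _ _ j> = contradiction (Fin.toℕ<n j) (ℕ.<⇒≱ (s≤s j>))
      ... | tri< j<1+r _ _ = spread (offset p i)
        where
        base≡j : base j ≡ toℕ j
        base≡j = ℕ.m≤n⇒m⊓n≡m (ℕ.s≤s⁻¹ j<1+r)
        above = level {suc (toℕ j)} (s≤s j<1+r)
        j⁺ = proj₁ above
        j⁺≡ = proj₂ above
        higher : ∀ {i′} k → (i′ ≡ i) → toℕ j⁺ ≤ toℕ k → ok (b , node k i′)
        higher k refl j⁺≤k = oks _ (above-base k i (subst (_< toℕ k) (sym base≡j) (subst (_≤ toℕ k) j⁺≡ j⁺≤k)))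
        rise : Route ok (b , node j⁺ i) (tip (b , i))
        rise = climb-from j⁺ i (λ k → higher k refl)
        spread : Offset p i → Route ok (b , node j p) (tip (b , i))
        spread at₀ = up (inj₂ (j⁺≡ , inj₁ refl)) okx (higher j⁺ refl ℕ.≤-refl) ◅ rise
        spread at₁ = up (inj₂ (j⁺≡ , inj₂ (inj₂ refl))) okx (higher j⁺ refl ℕ.≤-refl) ◅ rise
        spread (at₋₁ p≡) = up (inj₂ (j⁺≡ , inj₂ (inj₁ p≡))) okx (higher j⁺ refl ℕ.≤-refl) ◅ rise
        spread at₂ = down (inj₁ (refl , refl)) okx okn
          ◅ up (inj₂ (j⁺≡ , inj₂ (inj₂ refl))) okn (higher j⁺ refl ℕ.≤-refl) ◅ rise
          where okn = oks (node j (next p)) (trans (at-base j (next p) (sym base≡j)) (cong just (turn-next p)))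
        spread (at₋₂ refl) = up (inj₁ (refl , refl)) okx okn
          ◅ up (inj₂ (j⁺≡ , inj₂ (inj₁ refl))) okn (higher j⁺ refl ℕ.≤-refl) ◅ rise
          where okn = oks (node j (next i)) (trans (at-base j (next i) (sym base≡j)) (cong just (turn-prev i)))
        spread at₃ = descend (toℕ j) j p refl lower okc ◅◅ column i all okc
          where
          okc = oks centre refl
          lower : ∀ k → toℕ k ≤ toℕ j → ok (b , node k p)
          lower k k≤j with ℕ.m≤n⇒m<n∨m≡n k≤j
          ... | inj₁ k<j = oks _ (below-base k p (subst (toℕ k <_) (sym base≡j) k<j))
          ... | inj₂ k≡j = subst (λ l → ok (b , node l p)) (Fin.toℕ-injective (sym k≡j)) okx
          all : ∀ k → ok (b , node k i)
          all k with ℕ.<-cmp (toℕ k) (base j)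
          ... | tri< k< _ _ = oks _ (below-base k i k<)
          ... | tri≈ _ k≡ _ = oks _ (trans (at-base k i k≡) (cong just (turn-opposite p)))
          ... | tri> _ _ k> = oks _ (above-base k i k>)
      ... | tri≈ _ j≡1+r _ = spread (offset p i)
        where
        base≡r : base j ≡ r
        base≡r = trans (cong (_⊓ r) j≡1+r) (ℕ.m≥n⇒m⊓n≡n (ℕ.n≤1+n r))
        j≡top = top-level j j≡1+r
        under = level {r} (s≤s (ℕ.n≤1+n r))
        j⁻ = proj₁ under
        j⁻≡ = proj₂ under
        j≡1+j⁻ : toℕ j ≡ suc (toℕ j⁻)
        j≡1+j⁻ = trans j≡1+r (cong suc (sym j⁻≡))
        okt : ok (tip (b , i))
        okt = oks _ (above-base top i (subst₂ _<_ (sym base≡r) (sym (Fin.toℕ-fromℕ (suc r))) (ℕ.n<1+n r)))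
        t≡j : toℕ top ≡ toℕ j
        t≡j = cong toℕ (sym j≡top)
        t≡1+j⁻ : toℕ top ≡ suc (toℕ j⁻)
        t≡1+j⁻ = trans t≡j j≡1+j⁻
        turned : ∀ q {c} → turnColour p q ≡ c → c ≡ i → ok (b , node j⁻ q)
        turned q eq refl = oks _ (trans (at-base j⁻ q (trans j⁻≡ (sym base≡r))) (cong just eq))
        spread : Offset p i → Route ok (b , node j p) (tip (b , i))
        spread at₀ = subst (λ l → Route ok (b , node j p) (b , node l p)) j≡top ε
        spread at₁ = down (inj₁ (sym t≡j , refl)) okx okt ◅ ε
        spread (at₋₁ p≡) = up (inj₁ (t≡j , p≡)) okx okt ◅ ε
        spread at₂ = down (inj₂ (j≡1+j⁻ , inj₂ (inj₁ refl))) okx okn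
          ◅ up (inj₂ (t≡1+j⁻ , inj₂ (inj₂ refl))) okn okt ◅ ε
          where okn = turned (next p) (turn-next p) refl
        spread (at₋₂ refl) = down (inj₂ (j≡1+j⁻ , inj₂ (inj₂ refl))) okx okn
          ◅ up (inj₂ (t≡1+j⁻ , inj₂ (inj₁ refl))) okn okt ◅ ε
          where okn = turned (next i) (turn-prev i) refl
        spread at₃ = descend (toℕ j) j p refl lower okc ◅◅ column i all okc
          where
          okc = oks centre refl
          lower : ∀ k → toℕ k ≤ toℕ j → ok (b , node k p)
          lower k k≤j with ℕ.<-cmp (toℕ k) (base j)
          ... | tri< k< _ _ = oks _ (below-base k p k<)
          ... | tri≈ _ k≡ _ = oks _ (trans (at-base k p k≡) (cong just (turn-self p)))
          -- Above the base only the start itself is left, whose colour is `p` and not `opposite p`.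
          ... | tri> _ _ k> = subst (λ l → ok (b , node l p)) (Fin.toℕ-injective (ℕ.≤-antisym
                  (ℕ.≤-trans (ℕ.≤-reflexive j≡1+r) (subst (_< toℕ k) base≡r k>)) k≤j)) okx
          all : ∀ k → ok (b , node k i)
          all k with ℕ.<-cmp (toℕ k) (base j)
          ... | tri< k< _ _ = oks _ (below-base k i k<)
          ... | tri≈ _ k≡ _ = oks _ (trans (at-base k i k≡) (cong just (turn-opposite p)))
          ... | tri> _ _ k> = oks _ (above-base k i k>)

-- Walks between blobs and 6-connectedness.

module RoutesBetweenBlobs where

  open Menger
  open CutConnectivity
  open Blobs
  open RingOfBlobs
  open FansInBlobs
  open import Data.Fin.Base as Fin using (Fin; suc; toℕ)
  open import Data.Fin.Patterns
  import Data.Fin.Properties as Fin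
  open import Data.Fin.Subset using (Subset; _∈_; _∉_; ∣_∣)
  open import Data.Fin.Subset.Properties using (_∈?_)
  open import Data.Maybe.Base as Maybe using (Maybe; just; nothing)
  open import Data.Maybe.Properties as Maybe using (just-injective)
  open import Data.Nat.Base as ℕ using (ℕ; suc; _<_; z≤n; s≤s)
  import Data.Nat.Properties as ℕ
  open import Data.Product.Base using (_×_; _,_; proj₁; proj₂; ∃-syntax)
  open import Data.Sum.Base using (_⊎_; inj₁; inj₂)
  open import Data.Product.Properties using (≡-dec)
  open import Data.Vec.Base using (Vec; []; _∷_; lookup)
  open import Data.Empty using (⊥)
  open import Function.Base using (_∘_)
  open import Relation.Binary.Construct.Closure.ReflexiveTransitive as Star using (Star; ε;
    _◅_; _◅◅_)
  open import Relation.Binary.PropositionalEquality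
  open import Relation.Nullary.Decidable using (Dec; yes; no; from-yes; _×-dec_; _⊎-dec_; ¬?;
    decidable-stable)
  open import Relation.Nullary.Negation using (contradiction)

  after : Blob → Blob
  after 0F = 1F
  after 1F = 2F
  after 2F = 3F
  after 3F = 0F

  -- The other end of the link at an exit.
  opaque

    mate : Blob × Fin 6 → Blob × Fin 6
    mate (b , i) = lookup (lookup table b) i
      where
      table : Vec (Vec (Blob × Fin 6) 6) 4
      table = ((1F , 3F) ∷ (1F , 0F) ∷ (1F , 1F) ∷ (3F , 1F) ∷ (3F , 0F) ∷ (3F , 3F) ∷ [])
            ∷ ((0F , 1F) ∷ (0F , 2F) ∷ (2F , 0F) ∷ (0F , 0F) ∷ (2F , 2F) ∷ (2F , 1F) ∷ [])
            ∷ ((1F , 2F) ∷ (1F , 5F) ∷ (1F , 4F) ∷ (3F , 4F) ∷ (3F , 5F) ∷ (3F , 2F) ∷ [])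
            ∷ ((0F , 4F) ∷ (0F , 3F) ∷ (2F , 5F) ∷ (0F , 5F) ∷ (2F , 3F) ∷ (2F , 4F) ∷ [])
            ∷ []

  -- Three disjoint walks through each blob pair its exits towards one
  -- neighbour with its exits towards the other.  They follow the outermost
  -- hexagon, except that in blobs 0 and 2 the walk between exits 1 and 4 makes
  -- a detour over the hexagon below.
  opaque

    lane : Blob → Fin 6 → Fin 6
    lane b i = lookup (lookup table b) i
      where
      side middle : Vec (Fin 6) 6
      side   = 5F ∷ 4F ∷ 3F ∷ 2F ∷ 1F ∷ 0F ∷ []
      middle = 5F ∷ 2F ∷ 1F ∷ 4F ∷ 3F ∷ 0F ∷ []
      table : Vec (Vec (Fin 6) 6) 4
      table = side ∷ middle ∷ side ∷ middle ∷ []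

  _≟ₜ_ : (s t : Blob × Fin 6) → Dec (s ≡ t)
  _≟ₜ_ = ≡-dec Fin._≟_ Fin._≟_

  opaque

    unfolding mate

    mate-linked : ∀ b i → ∃[ c ] ∃[ s ]
      (link c s ≡ ((b , i) , mate (b , i)) ⊎ link c s ≡ (mate (b , i) , (b , i)))
    mate-linked = from-yes (Fin.all? λ b → Fin.all? λ i → Fin.any? λ c → Fin.any? λ s →
      ≡-dec _≟ₜ_ _≟ₜ_ (link c s) ((b , i) , mate (b , i))
      ⊎-dec ≡-dec _≟ₜ_ _≟ₜ_ (link c s) (mate (b , i) , (b , i)))

  data Lane : Blob → Fin 6 → Fin 6 → Set where
    forward  : ∀ {b i} → Lane b i (next i)
    backward : ∀ {b i} → Lane b (next i) i
    detour   : ∀ {b} → Lane b 1F 4F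
    detour⁻¹ : ∀ {b} → Lane b 4F 1F

  LaneCases : Blob → Fin 6 → Fin 6 → Set
  LaneCases b i j = j ≡ next i ⊎ i ≡ next j ⊎ (i ≡ 1F × j ≡ 4F) ⊎ (i ≡ 4F × j ≡ 1F)

  laneCases? : ∀ b i j → Dec (LaneCases b i j)
  laneCases? b i j = j Fin.≟ next i ⊎-dec i Fin.≟ next j
    ⊎-dec (i Fin.≟ 1F ×-dec j Fin.≟ 4F) ⊎-dec (i Fin.≟ 4F ×-dec j Fin.≟ 1F)

  opaque

    unfolding lane

    laneCases : ∀ b i → LaneCases b i (lane b i)
    laneCases = from-yes (Fin.all? λ b → Fin.all? λ i → laneCases? b i (lane b i))

  lane-correct : ∀ b i → Lane b i (lane b i)
  lane-correct b i = classify (laneCases b i)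
    where
    classify : ∀ {b i j} → LaneCases b i j → Lane b i j
    classify (inj₁ refl)                        = forward
    classify (inj₂ (inj₁ refl))                 = backward
    classify (inj₂ (inj₂ (inj₁ (refl , refl)))) = detour
    classify (inj₂ (inj₂ (inj₂ (refl , refl)))) = detour⁻¹

  -- One link, preceded if necessary by a lane, from an exit towards blob b.
  back : Blob → Blob × Fin 6 → Blob × Fin 6
  back b (x , i) with proj₁ (mate (x , i)) Fin.≟ b
  ... | yes _ = mate (x , i)
  ... | no  _ = mate (x , lane x i)

  -- Colours of the exits of the blobs other than b: the exit of b at which the
  -- route through them starts.  Three routes from b to its successor are links
  -- and the others pass through the two remaining blobs.  An exit of the
  -- successor has the colour of the route that ends there.
  exitColour : Blob → Blob × Fin 6 → Fin 6
  exitColour b (x , i) with proj₁ (mate (x , i)) Fin.≟ b | x Fin.≟ after (after (after b)) | x Fin.≟ after (after b)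
  ... | yes _ | _     | _     = proj₂ (mate (x , i))
  ... | no  _ | yes _ | _     = proj₂ (back b (x , i))
  ... | no  _ | no  _ | yes _ = proj₂ (back b (back (after (after (after b))) (x , i)))
  ... | no  _ | no  _ | no  _ = proj₂ (back b (back (after (after (after b))) (mate (x , i))))

  Arrives : Blob → Fin 6 → Blob × Fin 6 → Set
  Arrives b i s = proj₁ s ≡ after b × exitColour b s ≡ i

  throughLane : Blob × Fin 6 → Blob × Fin 6
  throughLane (x , i) = x , lane x i

  Passes : Blob → Fin 6 → Blob × Fin 6 → Set
  Passes b i s = proj₁ s ≢ b × proj₁ s ≢ after b
    × exitColour b s ≡ i × exitColour b (throughLane s) ≡ i

  RouteFrom : Blob → Fin 6 → Set
  RouteFrom b i = Arrives b i m₁ ⊎ (Passes b i m₁ × Passes b i m₂ × Arrives b i m₃)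
    where
    m₁ = mate (b , i)
    m₂ = mate (throughLane m₁)
    m₃ = mate (throughLane m₂)

  arrives? : ∀ b i s → Dec (Arrives b i s)
  arrives? b i s = proj₁ s Fin.≟ after b ×-dec exitColour b s Fin.≟ i

  passes? : ∀ b i s → Dec (Passes b i s)
  passes? b i s = ¬? (proj₁ s Fin.≟ b) ×-dec ¬? (proj₁ s Fin.≟ after b)
    ×-dec exitColour b s Fin.≟ i ×-dec exitColour b (throughLane s) Fin.≟ i

  routeFrom? : ∀ b i → Dec (RouteFrom b i)
  routeFrom? b i = arrives? b i m₁ ⊎-dec (passes? b i m₁ ×-dec passes? b i m₂ ×-dec arrives? b i m₃)
    where
    m₁ = mate (b , i)
    m₂ = mate (throughLane m₁)
    m₃ = mate (throughLane m₂)

  opaque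

    unfolding mate lane

    routeFrom : ∀ b i → RouteFrom b i
    routeFrom = from-yes (Fin.all? λ b → Fin.all? (routeFrom? b))

  after≢ : ∀ b → after b ≢ b
  after≢ = from-yes (Fin.all? λ b → ¬? (after b Fin.≟ b))

  data Around (b : Blob) : Blob → Set where
    here    : Around b b
    there₁  : Around b (after b)
    there₂  : Around b (after (after b))
    there₋₁ : ∀ {b′} → b ≡ after b′ → Around b b′

  around : ∀ b b′ → Around b b′
  around b b′ = classify (table b b′)
    where
    table : ∀ b b′ → b′ ≡ b ⊎ b′ ≡ after b ⊎ b′ ≡ after (after b) ⊎ b ≡ after b′
    table = from-yes (Fin.all? λ b → Fin.all? λ b′ →
      b′ Fin.≟ b ⊎-dec b′ Fin.≟ after b ⊎-dec b′ Fin.≟ after (after b) ⊎-dec b Fin.≟ after b′)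
    classify : b′ ≡ b ⊎ b′ ≡ after b ⊎ b′ ≡ after (after b) ⊎ b ≡ after b′ → Around b b′
    classify (inj₁ refl)               = here
    classify (inj₂ (inj₁ refl))        = there₁
    classify (inj₂ (inj₂ (inj₁ refl))) = there₂
    classify (inj₂ (inj₂ (inj₂ eq)))   = there₋₁ eq

  module _ {n k : ℕ} (S : Subset n) (κ : Fin n → Maybe (Fin k)) where

    Hit : Fin k → Set
    Hit i = ∃[ a ] (a ∈ S × κ a ≡ just i)

    hit? : ∀ i → Dec (Hit i)
    hit? i = Fin.any? (λ a → a ∈? S ×-dec Maybe.≡-dec Fin._≟_ (κ a) (just i))

    -- If `S` met every colour, choosing one vertex of `S` for each would inject the `k` colours
    -- into `S`.
    colour-outside : ∣ S ∣ < k → ∃[ i ] (∀ a → κ a ≡ just i → a ∉ S)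
    colour-outside S<k with Fin.any? (λ i → ¬? (hit? i))
    ... | yes (i , ¬hit) = i , λ a eq a∈S → ¬hit (a , a∈S , eq)
    ... | no  ¬free      = contradiction
      (injective⇒≤∣∣ {f = proj₁ ∘ hit} S (λ {i} {j} → hit-injective i j) (proj₁ ∘ proj₂ ∘ hit))
      (ℕ.<⇒≱ S<k)
      where
      hit : ∀ i → Hit i
      hit i = decidable-stable (hit? i) (λ ¬hit → ¬free (i , ¬hit))
      hit-injective : ∀ i j → proj₁ (hit i) ≡ proj₁ (hit j) → i ≡ j
      hit-injective i j eq = just-injective (trans (sym (proj₂ (proj₂ (hit i))))
        (trans (cong κ eq) (proj₂ (proj₂ (hit j)))))

  module Routes (r : ℕ) where

    open Construction r
    open Fans r

    module _ {ok : Vertex → Set} where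

      link-step : ∀ s → ok (tip s) → ok (tip (mate s)) → Step ok (tip s) (tip (mate s))
      link-step (b , i) oks okt with mate-linked b i
      ... | c , s , inj₁ eq = move (inj₁ (subst (λ (t , u) → Arc (tip t) (tip u)) eq (linked c s))) oks okt
      ... | c , s , inj₂ eq = move (inj₂ (subst (λ (t , u) → Arc (tip t) (tip u)) eq (linked c s))) oks okt

      under : Fin R
      under = proj₁ (level {r} (s≤s (ℕ.n≤1+n r)))

      top≡1+under : toℕ top ≡ suc (toℕ under)
      top≡1+under = trans (Fin.toℕ-fromℕ (suc r)) (cong suc (sym (proj₂ (level {r} (s≤s (ℕ.n≤1+n r))))))

      detour-route : ∀ b → ok (tip (b , 1F)) → ok (tip (b , 4F)) →
        ok (b , node under 2F) → ok (b , node under 3F) → Route ok (tip (b , 1F)) (tip (b , 4F))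
      detour-route b ok₁ ok₄ ok₂ ok₃ =
          down b (inj₂ (top≡1+under , inj₂ (inj₁ refl))) ok₁ ok₂
        ◅ down b (inj₁ (refl , refl)) ok₂ ok₃
        ◅ up b (inj₂ (top≡1+under , inj₂ (inj₂ refl))) ok₃ ok₄
        ◅ ε

      -- Every detour has an end at exit 1, so the lower nodes are needed at most for lanes at that
      -- exit; `passColour` gives them its colour.
      lane-route : ∀ {b i j} → Lane b i j → ok (tip (b , i)) → ok (tip (b , j)) →
        (i ≡ 1F ⊎ j ≡ 1F → ok (b , node under 2F) × ok (b , node under 3F)) →
        Route ok (tip (b , i)) (tip (b , j))
      lane-route {b} forward  oki okj _ = down b (inj₁ (refl , refl)) oki okj ◅ ε
      lane-route {b} backward oki okj _ = up b (inj₁ (refl , refl)) oki okj ◅ ε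
      lane-route {b} detour   oki okj inner =
        let ok₂ , ok₃ = inner (inj₁ refl) in detour-route b oki okj ok₂ ok₃
      lane-route {b} detour⁻¹ oki okj inner =
        let ok₂ , ok₃ = inner (inj₂ refl) in reverse (detour-route b okj oki ok₂ ok₃)

    -- Vertices of the blobs on the way that are not on a route are coloured
    -- arbitrarily.
    passColour : Blob → Vertex → Maybe (Fin 6)
    passColour b (x , centre)   = nothing
    passColour b (x , node k q) with k Fin.≟ top
    ... | yes _ = just (exitColour b (x , q))
    ... | no  _ = just (exitColour b (x , 1F))

    pass-tip : ∀ b s → passColour b (tip s) ≡ just (exitColour b s)
    pass-tip b s with top Fin.≟ top
    ... | yes _       = refl
    ... | no  top≢top = contradiction refl top≢top

    -- `under` does not depend on `ok`; an arbitrary predicate fixes the implicit argument.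
    under≢top : under {λ _ → ⊥} ≢ top
    under≢top eq = ℕ.1+n≢n (sym (trans (cong toℕ eq) (top≡1+under {λ _ → ⊥})))

    pass-under : ∀ b x q → passColour b (x , node (under {λ _ → ⊥}) q) ≡ just (exitColour b (x , 1F))
    pass-under b x q with under {λ _ → ⊥} Fin.≟ top
    ... | yes eq = contradiction eq under≢top
    ... | no  _  = refl

    -- The fan of `w` is recoloured by `exitColour`: its branch at an exit belongs to the walk that
    -- arrives there, whose colour was fixed at its exit from `b`.
    colour : Blob → Local → Local → Vertex → Maybe (Fin 6)
    colour b u w v@(x , y) with x Fin.≟ b | x Fin.≟ after b
    ... | yes _ | _     = fanColour u y
    ... | no  _ | yes _ = Maybe.map (λ i → exitColour b (after b , i)) (fanColour w y)
    ... | no  _ | no  _ = passColour b v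

    colour-start : ∀ b u w y → colour b u w (b , y) ≡ fanColour u y
    colour-start b u w y with b Fin.≟ b
    ... | yes _  = refl
    ... | no b≢b = contradiction refl b≢b

    colour-finish : ∀ b u w y → colour b u w (after b , y)
      ≡ Maybe.map (λ i → exitColour b (after b , i)) (fanColour w y)
    colour-finish b u w y with after b Fin.≟ b | after b Fin.≟ after b
    ... | yes eq | _      = contradiction eq (after≢ b)
    ... | no  _  | yes _  = refl
    ... | no  _  | no ≢   = contradiction refl ≢

    colour-pass : ∀ {b u w} v → proj₁ v ≢ b → proj₁ v ≢ after b → colour b u w v ≡ passColour b v
    colour-pass {b} (x , y) x≢b x≢b′ with x Fin.≟ b | x Fin.≟ after b
    ... | yes x≡b | _        = contradiction x≡b x≢b
    ... | no  _   | yes x≡b′ = contradiction x≡b′ x≢b′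
    ... | no  _   | no  _    = refl

    module _ {ok : Vertex → Set} b {u w} i (oku : ok (b , u)) (okw : ok (after b , w))
      (oks : ∀ v → colour b u w v ≡ just i → ok v) where

      leave : Route ok (b , u) (tip (b , i))
      leave = fan b u i oku (λ y eq → oks (b , y) (trans (colour-start b u w y) eq))

      arrive : ∀ s → Arrives b i s → Route ok (tip s) (after b , w)
      arrive (_ , j) (refl , refl) = reverse (fan (after b) w j okw
        (λ y eq → oks (after b , y) (trans (colour-finish b u w y) (cong (Maybe.map _) eq))))

      ok-end : ∀ {x} (route : Route ok x (tip (b , i))) → ok x → ok (tip (b , i))
      ok-end ε okx = okx
      ok-end (move _ _ oky ◅ route) _ = ok-end route oky

      ok-arrival : ∀ s → Arrives b i s → ok (tip s)
      ok-arrival s a = start-ok (arrive s a)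
        where
        start-ok : ∀ {x} → Route ok x (after b , w) → ok x
        start-ok ε                  = okw
        start-ok (move _ okx _ ◅ _) = okx

      ok-pass : ∀ s → proj₁ s ≢ b → proj₁ s ≢ after b → exitColour b s ≡ i → ok (tip s)
      ok-pass s s≢b s≢b′ eq = oks (tip s)
        (trans (colour-pass (tip s) s≢b s≢b′) (trans (pass-tip b s) (cong just eq)))

      pass : ∀ s → Passes b i s → Route ok (tip s) (tip (throughLane s)) × ok (tip s) × ok (tip (throughLane s))
      pass s@(x , j) (x≢b , x≢b′ , eq , eq′) =
        lane-route (lane-correct x j) ok₁ ok₂ inner , ok₁ , ok₂
        where
        ok₁ = ok-pass s x≢b x≢b′ eq
        ok₂ = ok-pass (throughLane s) x≢b x≢b′ eq′
        ok-under : exitColour b (x , 1F) ≡ i → ∀ q → ok (x , node (under {ok}) q)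
        ok-under eq q = oks _ (trans (colour-pass (x , node (under {ok}) q) x≢b x≢b′)
          (trans (pass-under b x q) (cong just eq)))
        inner : j ≡ 1F ⊎ lane x j ≡ 1F → ok (x , node (under {ok}) 2F) × ok (x , node (under {ok}) 3F)
        inner (inj₁ refl) = ok-under eq 2F , ok-under eq 3F
        inner (inj₂ l≡1)  = ok-under eq″ 2F , ok-under eq″ 3F
          where eq″ = trans (cong (λ l → exitColour b (x , l)) (sym l≡1)) eq′

      neighbours : Route ok (b , u) (after b , w)
      neighbours = go (routeFrom b i)
        where
        m₁ = mate (b , i)
        m₂ = mate (throughLane m₁)
        m₃ = mate (throughLane m₂)
        oki = ok-end leave oku
        go : RouteFrom b i → Route ok (b , u) (after b , w)
        go (inj₁ a₁) = leave ◅◅ link-step (b , i) oki (ok-arrival m₁ a₁) ◅ arrive m₁ a₁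
        go (inj₂ (p₁ , p₂ , a₃)) =
          let route₁ , ok₁ , ok₁′ = pass m₁ p₁
              route₂ , ok₂ , ok₂′ = pass m₂ p₂
          in  leave ◅◅ link-step (b , i) oki ok₁ ◅ route₁
                ◅◅ link-step (throughLane m₁) ok₁′ ok₂ ◅ route₂
                ◅◅ link-step (throughLane m₂) ok₂′ (ok-arrival m₃ a₃) ◅ arrive m₃ a₃

    module _ (S : Subset order) (S<6 : ∣ S ∣ < 6) where

      Ok : Vertex → Set
      Ok v = encode v ∉ S

      free-colour : (κ : Vertex → Maybe (Fin 6)) → ∃[ i ] (∀ v → κ v ≡ just i → Ok v)
      free-colour κ = let i , free = colour-outside S (κ ∘ decode) S<6 in
        i , λ v eq → free (encode v) (trans (cong κ (decode-encode v)) eq)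

      adjacent-blobs : ∀ b {u w} → Ok (b , u) → Ok (after b , w) → Route Ok (b , u) (after b , w)
      adjacent-blobs b {u} {w} oku okw =
        let i , oks = free-colour (colour b u w) in neighbours b i oku okw oks

      survivor : ∀ b → ∃[ x ] Ok (b , x)
      survivor b = let i , oks = free-colour exits in node top i , oks (tip (b , i)) (exits-tip i)
        where
        exits : Vertex → Maybe (Fin 6)
        exits (x , centre)   = nothing
        exits (x , node k q) = just q
        exits-tip : ∀ i → exits (tip (b , i)) ≡ just i
        exits-tip i = refl

      -- Walks are available between consecutive blobs only. Vertices of the same blob or of
      -- opposite blobs are joined through a surviving vertex of a blob next to both.
      connected : ∀ {b b′ x y} → Around b b′ → Ok (b , x) → Ok (b′ , y) → Route Ok (b , x) (b′ , y)
      connected {b} here oku okw =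
        let z , okz = survivor (after b) in adjacent-blobs b oku okz ◅◅ reverse (adjacent-blobs b okw okz)
      connected {b} there₁ oku okw = adjacent-blobs b oku okw
      connected {b} there₂ oku okw =
        let z , okz = survivor (after b) in adjacent-blobs b oku okz ◅◅ adjacent-blobs (after b) okz okw
      connected {b′ = b′} (there₋₁ refl) oku okw = reverse (adjacent-blobs b′ okw oku)

    cutConnected : CutConnected G 6
    cutConnected S S<6 {i} {j} i∉S j∉S = subst₂ (Star (Avoiding G S)) (encode-decode i) (encode-decode j)
      (Star.gmap encode transport (connected S S<6 (around (proj₁ (decode i)) (proj₁ (decode j)))
        (subst (_∉ S) (sym (encode-decode i)) i∉S) (subst (_∉ S) (sym (encode-decode j)) j∉S)))
      where
      transport : ∀ {u w} → Step (λ v → encode v ∉ S) u w → Avoiding G S (encode u) (encode w)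
      transport {u} {w} (move uw oku okw) =
        subst₂ Joined (sym (decode-encode u)) (sym (decode-encode w)) uw , oku , okw

    7<order : 7 < order
    7<order = s≤s (s≤s (s≤s (s≤s (s≤s (s≤s (s≤s (s≤s z≤n)))))))

    sixConnected : Connected G 6
    sixConnected = cutConnected⇒connected G
      (ℕ.≤-trans (s≤s (s≤s z≤n)) 7<order) (ℕ.<-trans (ℕ.n<1+n 6) 7<order) cutConnected

-- No spanning plane subgraph is 3-connected.

module SpanningPlaneSubgraphs where

  open PlaneSegments
  open Blobs
  open Items
  open CrossingItems
  open RingOfBlobs
  open import Data.Fin.Base as Fin using (Fin)
  open import Data.Fin.Patterns
  import Data.Fin.Properties as Fin
  open import Data.Integer.Base as ℤ using (ℤ; +_; -[1+_])
  open import Data.List.Base using ([]; _∷_; _++_; [_])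
  open import Data.List.Membership.Propositional using () renaming (_∈_ to _∈ₗ_)
  open import Data.List.Relation.Unary.Any using (here; there)
  open import Data.List.Relation.Unary.Linked using (Linked; _∷_)
  open import Data.Nat.Base using (ℕ; _≤_; z≤n; s≤s)
  open import Data.Product.Base using (_×_; _,_; proj₁; proj₂; ∃-syntax)
  open import Data.Product.Properties using (≡-dec)
  open import Data.Rational.Base as ℚ using (ℚ; 0ℚ; 1ℚ; _/_)
  import Data.Rational.Properties as ℚ
  import Data.Rational.Solver as ℚ-Solver
  open import Data.Rational.Literals using (fromℤ)
  open import Data.Sum.Base as Sum using (_⊎_; inj₁; inj₂)
  open import Data.Empty using (⊥; ⊥-elim)
  open import Function.Base using (_∘_)
  open import Relation.Binary.Definitions using (tri<; tri≈; tri>)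
  open import Relation.Binary.PropositionalEquality hiding ([_])
  open import Relation.Nullary.Decidable using (Dec; yes; no; from-yes; _×-dec_; _⊎-dec_; ¬?)
  open import Relation.Nullary.Negation using (¬_; contradiction)

  -- Intersections of the lines through the ends given by `tipPt`, before scaling by `R`. The first
  -- four are mirror images of one another; the last two lie on the vertical axis by symmetry.
  crossingPoint : Fin 6 → Point
  crossingPoint 0F = -[1+ 46 ] / 9 , + 26 / 9
  crossingPoint 1F = + 47 / 9 , + 26 / 9
  crossingPoint 2F = -[1+ 46 ] / 9 , -[1+ 25 ] / 9
  crossingPoint 3F = + 47 / 9 , -[1+ 25 ] / 9
  crossingPoint 4F = 0ℚ , + 61 / 12
  crossingPoint 5F = 0ℚ , -[1+ 60 ] / 12

  crossingParameter : Fin 6 → Fin 2 → ℚ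
  crossingParameter 4F _  = + 11 / 12
  crossingParameter 5F _  = + 11 / 12
  crossingParameter _  0F = + 5 / 9
  crossingParameter _  1F = + 4 / 9

  OnLink : Fin 6 → Fin 2 → Set
  OnLink c s = 0ℚ ℚ.≤ t × t ℚ.≤ 1ℚ
    × proj₁ x ≡ proj₁ p ℚ.+ t ℚ.* (proj₁ q ℚ.- proj₁ p)
    × proj₂ x ≡ proj₂ p ℚ.+ t ℚ.* (proj₂ q ℚ.- proj₂ p)
    × proj₁ x ≢ proj₁ p × proj₁ x ≢ proj₁ q
    where
    x = crossingPoint c
    t = crossingParameter c s
    p = embed (tipPt (proj₁ (link c s)))
    q = embed (tipPt (proj₂ (link c s)))

  onLink? : ∀ c s → Dec (OnLink c s)
  onLink? c s = _ ℚ.≤? _ ×-dec _ ℚ.≤? _ ×-dec _ ℚ.≟ _ ×-dec _ ℚ.≟ _ ×-dec ¬? (_ ℚ.≟ _) ×-dec ¬? (_ ℚ.≟ _)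

  opaque

    onLink : ∀ c s → OnLink c s
    onLink = from-yes (Fin.all? λ c → Fin.all? (onLink? c))

  LinksDisjoint : Fin 6 → Set
  LinksDisjoint c = proj₁ (link c 0F) ≢ proj₁ (link c 1F) × proj₁ (link c 0F) ≢ proj₂ (link c 1F)

  linksDisjoint : ∀ c → LinksDisjoint c
  linksDisjoint = from-yes (Fin.all? linksDisjoint?)
    where
    linksDisjoint? : ∀ c → Dec (LinksDisjoint c)
    linksDisjoint? c = ¬? (≡-dec Fin._≟_ Fin._≟_ (proj₁ (link c 0F)) (proj₁ (link c 1F)))
      ×-dec ¬? (≡-dec Fin._≟_ Fin._≟_ (proj₁ (link c 0F)) (proj₂ (link c 1F)))

  -- The ring of blobs is cut between blobs 0 and 1 (if α = 0) or between 1 and 2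
  -- (if α = 1), and between 0 and 3 (if β = 0) or between 3 and 2 (if β = 1).
  side : Fin 2 → Fin 2 → Blob → Fin 2
  side α β 0F = 0F
  side α β 1F = Fin.opposite α
  side α β 2F = 1F
  side α β 3F = Fin.opposite β

  -- The two crossing links between the blobs on either side of the cut.
  cutLink : Fin 2 → Fin 2 → Fin 2 → Fin 6
  cutLink 0F _  0F = 0F
  cutLink 1F _  0F = 1F
  cutLink _  0F 1F = 2F
  cutLink _  1F 1F = 3F

  -- Later `α` and `β` index links missing from `F` at crossings 4 and 5. What may join the two
  -- sides is then confined to two crossing pairs of links.
  Cut : Fin 2 → Fin 2 → Fin 6 → Fin 2 → Set
  Cut α β c s = side α β (proj₁ (proj₁ (link c s))) ≡ side α β (proj₁ (proj₂ (link c s)))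
    ⊎ (c ≡ 4F × s ≡ α) ⊎ (c ≡ 5F × s ≡ β) ⊎ ∃[ k ] c ≡ cutLink α β k

  cut? : ∀ α β c s → Dec (Cut α β c s)
  cut? α β c s = _ Fin.≟ _ ⊎-dec (c Fin.≟ 4F ×-dec s Fin.≟ α) ⊎-dec (c Fin.≟ 5F ×-dec s Fin.≟ β)
    ⊎-dec Fin.any? λ k → c Fin.≟ cutLink α β k

  opaque

    cut : ∀ α β c s → Cut α β c s
    cut = from-yes (Fin.all? λ α → Fin.all? λ β → Fin.all? λ c → Fin.all? λ s → cut? α β c s)

  CutSides : Fin 2 → Fin 2 → Fin 2 → Fin 2 → Set
  CutSides α β k s = side α β (proj₁ (proj₁ l)) ≢ side α β (proj₁ (proj₂ l))
    where l = link (cutLink α β k) s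

  cutSides : ∀ α β k s → CutSides α β k s
  cutSides = from-yes (Fin.all? λ α → Fin.all? λ β → Fin.all? λ k → Fin.all? λ s → cutSides? α β k s)
    where
    cutSides? : ∀ α β k s → Dec (CutSides α β k s)
    cutSides? α β k s = ¬? (_ Fin.≟ _)

  scale : ℚ → Point → Point
  scale ρ (x , y) = ρ ℚ.* x , ρ ℚ.* y

  scale-∈ˢ : ∀ ρ (p q x : Point) → x ∈ˢ (p , q) → scale ρ x ∈ˢ (scale ρ p , scale ρ q)
  scale-∈ˢ ρ (p₁ , p₂) (q₁ , q₂) (x₁ , x₂) (t , 0≤t , t≤1 , x₁≡ , x₂≡) =
    t , 0≤t , t≤1 , trans (cong (ρ ℚ.*_) x₁≡) (factor ρ t p₁ q₁) , trans (cong (ρ ℚ.*_) x₂≡) (factor ρ t p₂ q₂)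
    where
    open ℚ-Solver.+-*-Solver
    factor : ∀ ρ t p q → ρ ℚ.* (p ℚ.+ t ℚ.* (q ℚ.- p)) ≡ ρ ℚ.* p ℚ.+ t ℚ.* (ρ ℚ.* q ℚ.- ρ ℚ.* p)
    factor = solve 4 (λ ρ t p q → ρ :* (p :+ t :* (q :- p)) := ρ :* p :+ t :* (ρ :* q :- ρ :* p)) refl

  scale-≢ : ∀ {ρ} → ρ ≢ 0ℚ → ∀ x y → proj₁ x ≢ proj₁ y → scale ρ x ≢ scale ρ y
  scale-≢ {ρ} ρ≢0 (x , _) (y , _) x≢y eq = x≢y (begin
    x              ≡⟨ restore x y ⟩
    (x ℚ.- y) ℚ.+ y ≡⟨ cong (ℚ._+ y) (*≡0⇒≡0 (x ℚ.- y) ρ≢0 vanish) ⟩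
    0ℚ ℚ.+ y       ≡⟨ ℚ.+-identityˡ y ⟩
    y              ∎)
    where
    open ≡-Reasoning
    open ℚ-Solver.+-*-Solver
    restore : ∀ x y → x ≡ (x ℚ.- y) ℚ.+ y
    restore = solve 2 (λ x y → x := (x :- y) :+ y) refl
    expand : ∀ ρ x y → (x ℚ.- y) ℚ.* ρ ≡ ρ ℚ.* x ℚ.- ρ ℚ.* y
    expand = solve 3 (λ ρ x y → (x :- y) :* ρ := ρ :* x :- ρ :* y) refl
    vanish : (x ℚ.- y) ℚ.* ρ ≡ 0ℚ
    vanish = trans (expand ρ x y) (trans (cong (ℚ._- (ρ ℚ.* y)) (cong proj₁ eq)) (ℚ.+-inverseʳ (ρ ℚ.* y)))

  -- The walk must change sides somewhere, and the vertex just before the change is not the last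
  -- one. On a path it is the start or an inner vertex.
  exit : ∀ {n} {R : Fin n → Fin n → Set} (σ : Fin n → Fin 2) x inner {v} →
    Linked R (x ∷ inner ++ [ v ]) → σ x ≡ 1F → σ v ≡ 0F →
    ∃[ a ] ∃[ b ] (a ∈ₗ x ∷ inner × R a b × σ a ≡ 1F × σ b ≡ 0F)
  exit σ x []       {v} (xv ∷ _) σx σv = x , v , here refl , xv , σx , σv
  exit σ x (y ∷ ys) (xy ∷ rest) σx σv with σ y in σy
  ... | 0F = x , y , here refl , xy , σx , σy
  ... | 1F = let a , b , a∈ , ab , σa , σb = exit σ y ys rest σy σv in a , b , there a∈ , ab , σa , σb

  module NoThreeConnected (r : ℕ) where

    open Construction r
    open Picture R
    open Directions R using (loc-tip)
    open Edge

    ρ : ℚ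
    ρ = fromℤ (+ R)

    ρ≢0 : ρ ≢ 0ℚ
    ρ≢0 ()

    tipIndex : Blob × Fin 6 → Fin order
    tipIndex = encode ∘ tip

    tipIndex-injective : ∀ {s t} → tipIndex s ≡ tipIndex t → s ≡ t
    tipIndex-injective {s} {t} eq
      with trans (sym (decode-encode (tip s))) (trans (cong decode eq) (decode-encode (tip t)))
    ... | refl = refl

    pos-tip : ∀ s → pos (tipIndex s) ≡ scale ρ (embed (tipPt s))
    pos-tip s = begin
      pos (tipIndex s)                            ≡⟨ pos-embed (tipIndex s) ⟩
      embed (position (decode (encode (tip s))))  ≡⟨ cong (embed ∘ position) (decode-encode (tip s)) ⟩
      embed (position (tip s))                    ≡⟨ cong embed (position-tip s) ⟩
      embed (loc (proj₁ s) R (proj₂ s))           ≡⟨ cong embed (loc-tip s) ⟩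
      embed (+ R ℤ.* proj₁ (tipPt s) , + R ℤ.* proj₂ (tipPt s))
        ≡⟨ cong₂ _,_ (fromℤ-* (+ R) (proj₁ (tipPt s))) (fromℤ-* (+ R) (proj₂ (tipPt s))) ⟩
      scale ρ (embed (tipPt s))                   ∎
      where open ≡-Reasoning

    linkSrc linkTgt : Fin 6 → Fin 2 → Fin order
    linkSrc c s = tipIndex (proj₁ (link c s))
    linkTgt c s = tipIndex (proj₂ (link c s))

    link-adjacent : ∀ c s → Graph.Adj G (linkSrc c s) (linkTgt c s)
    link-adjacent c s = inj₁ (subst₂ Arc
      (sym (decode-encode (tip (proj₁ (link c s))))) (sym (decode-encode (tip (proj₂ (link c s)))))
      (linked c s))

    Between : Edge G → Fin order → Fin order → Set
    Between e i j = (src e ≡ i × tgt e ≡ j) ⊎ (src e ≡ j × tgt e ≡ i)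

    edgeBetween : ∀ {i j} → Graph.Adj G i j → ∃[ e ] Between e i j
    edgeBetween {i} {j} ij with Fin.<-cmp i j
    ... | tri< i<j _ _ = edge i j i<j ij , inj₁ (refl , refl)
    ... | tri≈ _ i≡j _ = contradiction ij (Graph.irrefl G {i} {j} i≡j)
    ... | tri> _ _ j<i = edge j i j<i (Graph.sym G {i} {j} ij) , inj₂ (refl , refl)

    linkEdge : ∀ c s → ∃[ e ] Between e (linkSrc c s) (linkTgt c s)
    linkEdge c s = edgeBetween (link-adjacent c s)

    between-inside : ∀ e i j x → Between e i j →
      x ∈ˢ (pos i , pos j) → x ≢ pos i → x ≢ pos j → Inside x e
    between-inside e i j x (inj₁ (refl , refl)) x∈ x≢i x≢j = x∈ , x≢i , x≢j
    between-inside e i j x (inj₂ (refl , refl)) x∈ x≢i x≢j = reverse∈ˢ (pos i) (pos j) {x} x∈ , x≢j , x≢i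

    crossing-inside : ∀ c s → Inside (scale ρ (crossingPoint c)) (proj₁ (linkEdge c s))
    crossing-inside c s = between-inside (proj₁ (linkEdge c s)) (linkSrc c s) (linkTgt c s) x (proj₂ (linkEdge c s))
      (subst₂ (λ p q → x ∈ˢ (p , q)) (sym (pos-tip (proj₁ (link c s)))) (sym (pos-tip (proj₂ (link c s))))
        (scale-∈ˢ ρ p q (crossingPoint c) (crossingParameter c s , 0≤t , t≤1 , x₁≡ , x₂≡)))
      (λ eq → scale-≢ ρ≢0 (crossingPoint c) p x≢p (trans eq (pos-tip (proj₁ (link c s)))))
      (λ eq → scale-≢ ρ≢0 (crossingPoint c) q x≢q (trans eq (pos-tip (proj₂ (link c s)))))
      where
      x = scale ρ (crossingPoint c)
      p = embed (tipPt (proj₁ (link c s)))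
      q = embed (tipPt (proj₂ (link c s)))
      table = onLink c s
      0≤t = proj₁ table
      t≤1 = proj₁ (proj₂ table)
      x₁≡ = proj₁ (proj₂ (proj₂ table))
      x₂≡ = proj₁ (proj₂ (proj₂ (proj₂ table)))
      x≢p = proj₁ (proj₂ (proj₂ (proj₂ (proj₂ table))))
      x≢q = proj₂ (proj₂ (proj₂ (proj₂ (proj₂ table))))

    linkEdges-distinct : ∀ c → proj₁ (linkEdge c 0F) ≢ proj₁ (linkEdge c 1F)
    linkEdges-distinct c eq = go (proj₂ (linkEdge c 0F)) (proj₂ (linkEdge c 1F)) eq
      where
      go : ∀ {e f} → Between e (linkSrc c 0F) (linkTgt c 0F) → Between f (linkSrc c 1F) (linkTgt c 1F) → e ≢ f
      go (inj₁ (p , _)) (inj₁ (q , _)) refl = proj₁ (linksDisjoint c) (tipIndex-injective (trans (sym p) q))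
      go (inj₁ (p , _)) (inj₂ (q , _)) refl = proj₂ (linksDisjoint c) (tipIndex-injective (trans (sym p) q))
      go (inj₂ (_ , p)) (inj₁ (_ , q)) refl = proj₂ (linksDisjoint c) (tipIndex-injective (trans (sym p) q))
      go (inj₂ (_ , p)) (inj₂ (_ , q)) refl = proj₁ (linksDisjoint c) (tipIndex-injective (trans (sym p) q))

    links-cross : ∀ c → Drawing.Cross drawing (proj₁ (linkEdge c 0F)) (proj₁ (linkEdge c 1F))
    links-cross c =
      let x∈e , x≢e = crossing-inside c 0F ; x∈f , x≢f = crossing-inside c 1F in
      scale ρ (crossingPoint c) , linkEdges-distinct c , (here x∈e , x≢e) , (here x∈f , x≢f)

    onePlaneGraph : OnePlaneGraph
    onePlaneGraph = record { order = order ; graph = G ; drawing = drawing ; isOnePlane = isOnePlane }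

    module _ (F : Graph order) (spanning : IsSpanningPlaneSubgraph onePlaneGraph F) where

      open IsSpanningPlaneSubgraph spanning

      Chosen : Fin 6 → Fin 2 → Set
      Chosen c s = Graph.Adj F (linkSrc c s) (linkTgt c s)

      chosen-edge : ∀ i j e → Graph.Adj F i j → Between e i j → Graph.Adj F (src e) (tgt e)
      chosen-edge i j e ij (inj₁ (refl , refl)) = ij
      chosen-edge i j e ij (inj₂ (refl , refl)) = Graph.sym F ij

      not-both : ∀ c → Chosen c 0F → ¬ Chosen c 1F
      not-both c c₀ c₁ = plane _ _
        (chosen-edge (linkSrc c 0F) (linkTgt c 0F) (proj₁ (linkEdge c 0F)) c₀ (proj₂ (linkEdge c 0F)))
        (chosen-edge (linkSrc c 1F) (linkTgt c 1F) (proj₁ (linkEdge c 1F)) c₁ (proj₂ (linkEdge c 1F)))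
        (links-cross c)

      chosen-unique : ∀ c {s s′} → Chosen c s → Chosen c s′ → s ≡ s′
      chosen-unique c {0F} {0F} _ _ = refl
      chosen-unique c {0F} {1F} p q = contradiction q (not-both c p)
      chosen-unique c {1F} {0F} p q = contradiction p (not-both c q)
      chosen-unique c {1F} {1F} _ _ = refl

      missing : ∀ c → ∃[ s ] ¬ Chosen c s
      missing c with Graph.adj? F (linkSrc c 0F) (linkTgt c 0F)
      ... | no  ¬c₀ = 0F , ¬c₀
      ... | yes c₀  = 1F , not-both c c₀

      α β : Fin 2
      α = proj₁ (missing 4F)
      β = proj₁ (missing 5F)

      σ : Fin order → Fin 2
      σ i = side α β (proj₁ (decode i))

      data Departure (k : Fin 2) (a : Fin order) : Set where
        departs : ∀ {s} t → Chosen (cutLink α β k) s → decode a ≡ tip t →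
          (t ≡ proj₁ (link (cutLink α β k) s) ⊎ t ≡ proj₂ (link (cutLink α β k) s)) →
          side α β (proj₁ t) ≡ 1F → Departure k a

      tip-of : ∀ {a t} → decode a ≡ tip t → a ≡ tipIndex t
      tip-of {a} eq = trans (sym (encode-decode a)) (cong encode eq)

      leaves : ∀ {a} c s t t′ → Chosen c s → decode a ≡ tip t →
        (t ≡ proj₁ (link c s) × t′ ≡ proj₂ (link c s)) ⊎ (t ≡ proj₂ (link c s) × t′ ≡ proj₁ (link c s)) →
        side α β (proj₁ t) ≡ 1F → side α β (proj₁ t′) ≡ 0F → ∃[ k ] Departure k a
      leaves c s t t′ chosen a≡ ends σt σt′ with cut α β c s
      ... | inj₁ eq = ⊥-elim (differ ends)
        where
        differ : (t ≡ proj₁ (link c s) × t′ ≡ proj₂ (link c s)) ⊎ (t ≡ proj₂ (link c s) × t′ ≡ proj₁ (link c s)) → ⊥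
        differ (inj₁ (refl , refl)) = Fin.0≢1+n (trans (sym σt′) (trans (sym eq) σt))
        differ (inj₂ (refl , refl)) = Fin.0≢1+n (trans (sym σt′) (trans eq σt))
      ... | inj₂ (inj₁ (refl , refl))          = contradiction chosen (proj₂ (missing 4F))
      ... | inj₂ (inj₂ (inj₁ (refl , refl)))   = contradiction chosen (proj₂ (missing 5F))
      ... | inj₂ (inj₂ (inj₂ (k , refl)))      = k , departs t chosen a≡ (Sum.map proj₁ proj₁ ends) σt

      arc-kinds : ∀ {u w} → Arc u w → proj₁ u ≡ proj₁ w
        ⊎ ∃[ c ] ∃[ s ] (u ≡ tip (proj₁ (link c s)) × w ≡ tip (proj₂ (link c s)))
      arc-kinds (inside _)   = inj₁ refl
      arc-kinds (linked c s) = inj₂ (c , s , refl , refl)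

      departure : ∀ {a b} → Graph.Adj F a b → σ a ≡ 1F → σ b ≡ 0F → ∃[ k ] Departure k a
      departure {a} {b} ab σa σb with subgraph {a} {b} ab
      ... | inj₁ arc with arc-kinds arc
      ...   | inj₁ eq = contradiction (trans (sym σb) (trans (cong (side α β) (sym eq)) σa)) Fin.0≢1+n
      ...   | inj₂ (c , s , a≡ , b≡) = leaves c s _ _
        (subst₂ (Graph.Adj F) (tip-of a≡) (tip-of b≡) ab) a≡ (inj₁ (refl , refl))
        (trans (cong (side α β ∘ proj₁) (sym a≡)) σa) (trans (cong (side α β ∘ proj₁) (sym b≡)) σb)
      departure {a} {b} ab σa σb | inj₂ arc with arc-kinds arc
      ...   | inj₁ eq = contradiction (trans (sym σb) (trans (cong (side α β) eq) σa)) Fin.0≢1+n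
      ...   | inj₂ (c , s , b≡ , a≡) = leaves c s _ _
        (subst₂ (Graph.Adj F) (tip-of b≡) (tip-of a≡) (Graph.sym F ab)) a≡ (inj₂ (refl , refl))
        (trans (cong (side α β ∘ proj₁) (sym a≡)) σa) (trans (cong (side α β ∘ proj₁) (sym b≡)) σb)

      -- `F` contains at most one link of the crossing pair, and that link has only one end on side
      -- 1. The two possible departures thus form a vertex cut.
      departure-unique : ∀ {k a a′} → Departure k a → Departure k a′ → a ≡ a′
      departure-unique {k} (departs {s} t chosen a≡ end σt) (departs t′ chosen′ a′≡ end′ σt′)
        with chosen-unique (cutLink α β k) chosen chosen′
      ... | refl = trans (tip-of a≡) (trans (cong tipIndex (same-end end end′)) (sym (tip-of a′≡)))
        where
        p = proj₁ (link (cutLink α β k) s)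
        q = proj₂ (link (cutLink α β k) s)
        same-end : t ≡ p ⊎ t ≡ q → t′ ≡ p ⊎ t′ ≡ q → t ≡ t′
        same-end (inj₁ eq) (inj₁ eq′) = trans eq (sym eq′)
        same-end (inj₂ eq) (inj₂ eq′) = trans eq (sym eq′)
        same-end (inj₁ refl) (inj₂ refl) = contradiction (trans σt (sym σt′)) (cutSides α β k s)
        same-end (inj₂ refl) (inj₁ refl) = contradiction (trans σt′ (sym σt)) (cutSides α β k s)

      source sink : Fin order
      source = encode (2F , centre)
      sink   = encode (0F , centre)

      σ-source : σ source ≡ 1F
      σ-source = cong (side α β ∘ proj₁) (decode-encode (2F , centre))

      σ-sink : σ sink ≡ 0F
      σ-sink = cong (side α β ∘ proj₁) (decode-encode (0F , centre))

      source≢sink : source ≢ sink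
      source≢sink eq = Fin.0≢1+n (trans (sym σ-sink) (trans (cong σ (sym eq)) σ-source))

      -- A centre is never an exit. Departures are therefore inner vertices of the paths, where
      -- disjointness applies.
      departs≢source : ∀ {k} → ¬ Departure k source
      departs≢source (departs (b , q) _ eq _ _) with trans (sym (decode-encode (2F , centre))) eq
      ... | ()

      path-departs : (P : Path F source sink) → ∃[ k ] ∃[ a ] (a ∈ₗ Path.inner P × Departure k a)
      path-departs P with exit σ source (Path.inner P) (Path.walk P) σ-source σ-sink
      ... | a , b , a∈ , ab , σa , σb with departure ab σa σb | a∈
      ...   | k , d | here refl = contradiction d departs≢source
      ...   | k , d | there a∈inner = k , a , a∈inner , d

      -- Two of three paths leave side 1 through the same crossing pair, hence through the same
      -- inner vertex.
      notThreeConnected : ¬ Connected F 3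
      notThreeConnected (_ , paths) =
        let P , disjoint = paths source sink source≢sink
            f = path-departs ∘ P
            i , j , i<j , k≡ = Fin.pigeonhole (s≤s (s≤s (s≤s z≤n))) (proj₁ ∘ f)
            _ , a , a∈ , d   = f i
            _ , a′ , a′∈ , d′ = f j
            a≡a′ = departure-unique d (subst (λ k → Departure k a′) (sym k≡) d′)
        in  proj₁ (disjoint i j (Fin.<⇒≢ i<j)) (a∈ , subst (_∈ₗ Path.inner (P j)) (sym a≡a′) a′∈)

-- Infinitely many isomorphism types.

open import Data.Fin.Permutation using (↔⇒≡)
open import Data.Nat.Properties using (suc-injective; *-cancelˡ-≡; *-cancelʳ-≡)
open import Data.Product.Base using (_,_)
open import Relation.Binary.PropositionalEquality.Core using (_≡_)
open RingOfBlobs using (module Construction)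
open RoutesBetweenBlobs using (module Routes)
open SpanningPlaneSubgraphs using (module NoThreeConnected)

-- The order is 4 (1 + 6 `R`), so the numbers of vertices alone tell the graphs apart.
order-injective : ∀ {i j} → Construction.order i ≡ Construction.order j → i ≡ j
order-injective {i} {j} eq =
  suc-injective (suc-injective (*-cancelʳ-≡ _ _ 6 (suc-injective (*-cancelˡ-≡ _ _ 4 eq))))

theorem4 : Σ[ G ∈ (ℕ → OnePlaneGraph) ]
    (∀ i j → i ≢ j → ¬ (OnePlaneGraph.graph (G i) ≅ OnePlaneGraph.graph (G j)))
    × (∀ i → Connected (OnePlaneGraph.graph (G i)) 6
    × ¬ (∃[ F ] (IsSpanningPlaneSubgraph (G i) F × Connected F 3)))
theorem4 = NoThreeConnected.onePlaneGraph
  , (λ i j i≢j (φ , _) → i≢j (order-injective (↔⇒≡ φ)))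
  , λ i → Routes.sixConnected i
        , λ (F , spanning , connected) → NoThreeConnected.notThreeConnected i F spanning connected
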